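{- Let $G$ be a finite connected graph with at least two vertices and edge set $E$, and fix an acyclic cycle signature $\sigma$ and an acyclic cocycle signature $\sigma^*$. For every $\sigma$-compatible (discrete) orientation $\overrightarrow{O}$, there is a unique pair $(T,\overrightarrow{C^*})$ with $T$ a spanning tree and $\overrightarrow{C^*}\in\operatorname{im}_\mathbb{Z}(D^T)$ such that $\overrightarrow{O}\in(\mathrm{hoc}_{\sigma,\sigma^*}(T)-\overrightarrow{C^*})\cap[0,1]^E$, and this set is a standard half-open cell; let $\varphi_{\sigma,\sigma^*}(\overrightarrow{O})$ be its generating set. Then $\varphi_{\sigma,\sigma^*}$ is a bijection from the set of $\sigma$-compatible orientations of $G$ to the set of spanning forests of $G$.
   Context: $G$ is a finite connected graph (loops and multiple edges allowed). Fix a reference orientation; orientations are identified with $\{0,1\}^E$ and continuous orientations with $[0,1]^E$ (coordinate $1$: oriented as in the reference orientation; $0$: oppositely; strictly between: "bi-oriented"). Directed cycles (cycles with a cyclic direction) and directed cocycles (inclusion-minimal cuts with all edges directed from one side to the other) are identified with $\{0,\pm1\}$-vectors ($+1$ where directed as the reference, $-1$ where opposite). $D$ is the vertex–edge incidence matrix of the reference orientation (entry $1$ if the vertex is the head of a non-loop arc, $-1$ if tail, $0$ otherwise) with its last row removed; $\operatorname{im}_\mathbb{Z}(D^T)=\operatorname{im}(D^T)\cap\mathbb{Z}^E$. A cycle signature $\sigma$ chooses a direction $\sigma(C)$ of each cycle $C$; it is acyclic if $\sum_C a_C\sigma(C)=0$ with all $a_C\ge0$ forces all $a_C=0$. A discrete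 orientation is $\sigma$-compatible if every directed cycle contained in it is of the form $\sigma(C)$. Acyclic cocycle signatures $\sigma^*$ are defined analogously with cocycles. For a spanning tree $T$: $C(T,e)$ ($e\notin T$) is the unique cycle in $T\cup\{e\}$ and $C^*(T,e)$ ($e\in T$) is the unique cocycle in $(E\setminus T)\cup\{e\}$. $\mathrm{hoc}_{\sigma,\sigma^*}(T)\subseteq[0,1]^E$ is the set of continuous orientations in which each $e\notin T$ is oriented as in $\sigma(C(T,e))$ and each $e\in T$ is either oriented as in $\sigma^*(C^*(T,e))$ or bi-oriented. A standard half-open cell in $\mathbb{R}^E$ is a set $\prod_{e\in E}I_e$ with each $I_e$ equal to $\{a_e\}$, $(a_e-1,a_e]$ or $[a_e,a_e+1)$ for integers $a_e$; its generating set is $\{e: I_e\text{ is not a point}\}$. A spanning forest is a subset of $E$ containing no cycle.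
   Formalization: Continuous orientations, the sets hoc(T) and the standard half-open cells are taken in rational instead of real coordinates, and the potentials defining the image of D^T are rational. -}

module Defs where

open import Data.Nat using (ℕ; zero; suc)
open import Data.Bool using (Bool; true; false; _xor_)
open import Data.Fin using (Fin; fromℕ; inject₁) renaming (zero to fzero; suc to fsuc)
open import Data.Fin.Subset using (Subset; _∈_; _∉_; _⊆_; _∪_; ⁅_⁆; ∁)
open import Data.Vec using (lookup; tabulate)
open import Data.Integer as ℤ using (ℤ; +_; -[1+_])
open import Data.Rational as ℚ using (ℚ; 0ℚ; 1ℚ)
open import Data.List using (List; []; _∷_)
open import Data.List.Relation.Unary.All using (All)
open import Data.Product using (Σ; _×_; _,_; proj₁; proj₂)
open import Data.Sum using (_⊎_)
open import Data.Empty using (⊥)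
open import Data.Unit using (⊤)
open import Relation.Nullary using (¬_)
open import Relation.Binary.PropositionalEquality using (_≡_; _≢_)

-- Graphs: vertices Fin n, edges Fin m, reference orientation given by
-- tail/head of each edge (loops and parallel edges allowed).

record Graph (n m : ℕ) : Set where
  field
    tail : Fin m → Fin n
    head : Fin m → Fin n
open Graph public

Vector : ℕ → Set
Vector m = Fin m → ℤ

+1ℤ -1ℤ 0ℤ : ℤ
+1ℤ = + 1
-1ℤ = -[1+ 0 ]
0ℤ = + 0

fromℤ : ℤ → ℚ
fromℤ z = z ℚ./ 1

_≗v_ : ∀ {m} → Vector m → Vector m → Set
v ≗v w = ∀ e → v e ≡ w e

module _ {n m : ℕ} (G : Graph n m) where

  start end : Fin m × Bool → Fin n
  start (e , true)  = tail G e
  start (e , false) = head G e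
  end (e , true)  = head G e
  end (e , false) = tail G e

  record DirCycleWalk : Set where
    field
      len     : ℕ
      step    : Fin (suc len) → Fin m × Bool
      consec  : ∀ (i : Fin len) → end (step (inject₁ i)) ≡ start (step (fsuc i))
      closed  : end (step (fromℕ len)) ≡ start (step fzero)
      edgeInj : ∀ i j → proj₁ (step i) ≡ proj₁ (step j) → i ≡ j
      vertInj : ∀ i j → start (step i) ≡ start (step j) → i ≡ j
  open DirCycleWalk public

  Represents : DirCycleWalk → Vector m → Set
  Represents w v = ∀ e →
      (v e ≡ +1ℤ × Σ (Fin (suc (len w))) (λ i → step w i ≡ (e , true)))
    ⊎ (v e ≡ -1ℤ × Σ (Fin (suc (len w))) (λ i → step w i ≡ (e , false)))
    ⊎ (v e ≡ 0ℤ × (∀ i → proj₁ (step w i) ≢ e))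

  IsDirCycle : Vector m → Set
  IsDirCycle v = Σ DirCycleWalk (λ w → Represents w v)

  SuppEq : Vector m → Subset m → Set
  SuppEq v C = ∀ e → (e ∈ C → v e ≢ 0ℤ) × (v e ≢ 0ℤ → e ∈ C)

  IsCycle : Subset m → Set
  IsCycle C = Σ (Vector m) (λ v → IsDirCycle v × SuppEq v C)

  cutset : Subset n → Subset m
  cutset S = tabulate (λ e → lookup S (tail G e) xor lookup S (head G e))

  IsCut : Subset m → Set
  IsCut C = Σ (Subset n) (λ S → C ≡ cutset S) × Σ (Fin m) (λ e → e ∈ C)

  IsCocycle : Subset m → Set
  IsCocycle C = IsCut C × (∀ C' → IsCut C' → C' ⊆ C → C ⊆ C')

  cutvecAux : Bool → Bool → ℤ
  cutvecAux true false = +1ℤ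
  cutvecAux false true = -1ℤ
  cutvecAux _ _ = 0ℤ

  cutvec : Subset n → Vector m
  cutvec S e = cutvecAux (lookup S (tail G e)) (lookup S (head G e))

  IsDirCocycle : Vector m → Set
  IsDirCocycle v = Σ (Subset n) (λ S → IsCocycle (cutset S) × v ≗v cutvec S)

  IsSignature : (Subset m → Set) → (Vector m → Set) → (Subset m → Vector m) → Set
  IsSignature IsSet IsDir σ = ∀ C → IsSet C → IsDir (σ C) × SuppEq (σ C) C

  lincomb : (Subset m → Vector m) → List (Subset m × ℕ) → Vector m
  lincomb σ [] e = 0ℤ
  lincomb σ ((C , a) ∷ cs) e = (+ a) ℤ.* σ C e ℤ.+ lincomb σ cs e

  IsAcyclic : (Subset m → Set) → (Subset m → Vector m) → Set
  IsAcyclic IsSet σ = ∀ (cs : List (Subset m × ℕ)) → All (λ p → IsSet (proj₁ p)) cs →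
    (∀ e → lincomb σ cs e ≡ 0ℤ) → All (λ p → proj₂ p ≡ 0) cs

  CycleSignature : (Subset m → Vector m) → Set
  CycleSignature σ = IsSignature IsCycle IsDirCycle σ × IsAcyclic IsCycle σ

  CocycleSignature : (Subset m → Vector m) → Set
  CocycleSignature σ = IsSignature IsCocycle IsDirCocycle σ × IsAcyclic IsCocycle σ

  data Reach (T : Subset m) (u : Fin n) : Fin n → Set where
    here : Reach T u u
    fwd  : ∀ {e} → e ∈ T → Reach T u (tail G e) → Reach T u (head G e)
    bwd  : ∀ {e} → e ∈ T → Reach T u (head G e) → Reach T u (tail G e)

  Connected : Set
  Connected = ∀ u v → Reach (tabulate (λ _ → true)) u v

  SpanningForest : Subset m → Set
  SpanningForest F = ∀ C → IsCycle C → ¬ (C ⊆ F)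

  SpanningTree : Subset m → Set
  SpanningTree T = SpanningForest T × (∀ u v → Reach T u v)

  Orientation : Set
  Orientation = Fin m → Bool

  ContainedIn : Vector m → Orientation → Set
  ContainedIn v O = ∀ e → (v e ≡ +1ℤ → O e ≡ true) × (v e ≡ -1ℤ → O e ≡ false)

  Compatible : (Subset m → Vector m) → Orientation → Set
  Compatible σ O = ∀ v → IsDirCycle v → ContainedIn v O →
    Σ (Subset m) (λ C → IsCycle C × v ≗v σ C)

  ContVec : Set
  ContVec = Fin m → ℚ

  InUnitCube : ContVec → Set
  InUnitCube x = ∀ e → 0ℚ ℚ.≤ x e × x e ℚ.≤ 1ℚ

  OrientedAs : ℤ → ℚ → Set
  OrientedAs s q = (s ≡ +1ℤ → q ≡ 1ℚ) × (s ≡ -1ℤ → q ≡ 0ℚ)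

  BiOriented : ℚ → Set
  BiOriented q = 0ℚ ℚ.< q × q ℚ.< 1ℚ

  -- hoc_{σ,σ*}(T); the cycle C(T,e) (resp. cocycle C*(T,e)) is referred to as
  -- "the (unique) cycle contained in T ∪ {e}" (resp. cocycle in (E∖T) ∪ {e})
  InHoc : (Subset m → Vector m) → (Subset m → Vector m) → Subset m → ContVec → Set
  InHoc σ σ* T x = InUnitCube x × (∀ e →
      (e ∉ T → ∀ C → IsCycle C → C ⊆ (T ∪ ⁅ e ⁆) → OrientedAs (σ C e) (x e))
    × (e ∈ T → ∀ C → IsCocycle C → C ⊆ (∁ T ∪ ⁅ e ⁆) →
         OrientedAs (σ* C e) (x e) ⊎ BiOriented (x e)))

  ShiftedHoc : (Subset m → Vector m) → (Subset m → Vector m) → Subset m → Vector m → ContVec → Set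
  ShiftedHoc σ σ* T c y = InUnitCube y × InHoc σ σ* T (λ e → y e ℚ.+ fromℤ (c e))

  toCont : Orientation → ContVec
  toCont O e with O e
  ... | true = 1ℚ
  ... | false = 0ℚ

-- D: incidence matrix with the last row (vertex) removed; im(D^T) ∩ ℤ^E.
-- (D^T p)_e = p(head e) - p(tail e) with p(last vertex) = 0.
InImZDT : ∀ {k m} → Graph (suc (suc k)) m → Vector m → Set
InImZDT {k} {m} G c = Σ (Fin (suc (suc k)) → ℚ) (λ p → p (fromℕ (suc k)) ≡ 0ℚ ×
  (∀ e → fromℤ (c e) ≡ p (head G e) ℚ.- p (tail G e)))

data HInterval : Set where
  point : ℤ → HInterval
  lopen : ℤ → HInterval
  ropen : ℤ → HInterval

_∈I_ : ℚ → HInterval → Set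
q ∈I point a = q ≡ a ℚ./ 1
q ∈I lopen a = (a ℤ.- +1ℤ) ℚ./ 1 ℚ.< q × q ℚ.≤ a ℚ./ 1
q ∈I ropen a = a ℚ./ 1 ℚ.≤ q × q ℚ.< (a ℤ.+ +1ℤ) ℚ./ 1

NonPoint : HInterval → Set
NonPoint (point _) = ⊥
NonPoint (lopen _) = ⊤
NonPoint (ropen _) = ⊤

IsCellRep : ∀ {m} → ((Fin m → ℚ) → Set) → (Fin m → HInterval) → Set
IsCellRep X I = ∀ y → (X y → ∀ e → y e ∈I I e) × ((∀ e → y e ∈I I e) → X y)

IsStandardCell : ∀ {m} → ((Fin m → ℚ) → Set) → Set
IsStandardCell {m} X = Σ (Fin m → HInterval) (IsCellRep X)

GeneratingSet : ∀ {m} → (Fin m → HInterval) → Subset m → Set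
GeneratingSet I F = ∀ e → (e ∈ F → NonPoint (I e)) × (NonPoint (I e) → e ∈ F)

module _ {k m : ℕ} (G : Graph (suc (suc k)) m) (σ σ* : Subset m → Vector m) where

  GoodPair : Orientation G → Subset m → Vector m → Set
  GoodPair O T c = SpanningTree G T × InImZDT G c × ShiftedHoc G σ σ* T c (toCont G O)

  Phi : Orientation G → Subset m → Set
  Phi O F = Σ (Subset m) (λ T → Σ (Vector m) (λ c → GoodPair O T c ×
    Σ (Fin m → HInterval) (λ I → IsCellRep (ShiftedHoc G σ σ* T c) I × GeneratingSet I F)))

{-# OPTIONS --safe #-}
module Submission where

-- Write O_T for the orientation that σ and σ* give to a tree T. By definition of hoc, (T , c)
-- is good for O iff c = O_T − O and c is a potential difference, and the generating set is then
-- {e ∈ T : O_T e = O e}. A circulation that runs along O_T off T is a nonnegative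
-- combination of signature cycles, a potential difference that runs along O_T on T one of
-- signature cocycles; so if both a vector and its opposite are of this kind, it vanishes by acyclicity.
-- Applied to c₁ − c₂, and with Minty's painting lemma to compare trees, this gives the
-- uniqueness of (T , c) and the injectivity of φ. For existence, reversing cocycles
-- against σ* leads from a σ-compatible orientation to one compatible with both signatures;
-- T ↦ O_T injects the trees into these, and deciding the edges one after another injects them back into
-- the trees, so T ↦ O_T is onto. Directing the edges one after another in the same
-- way injects the forests into the σ-compatible orientations, so φ is onto as well.

open import Defs
open import Algebra.Properties.AbelianGroup using (inverseʳ-unique)
import Algebra.Properties.Group as GroupProperties
import Algebra.Properties.Semiring.Sum as SemiringSum
open import Data.Bool using (Bool; true; false; not; if_then_else_; _xor_; _∧_; _∨_)
import Data.Bool.Properties as Boolₚ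
open import Data.Empty using (⊥; ⊥-elim)
open import Data.Fin as Fin using (Fin) renaming (zero to fzero; suc to fsuc)
open import Data.Fin.Induction using (<-weakInduction)
import Data.Fin.Properties as Finₚ
open import Data.Fin.Relation.Unary.Top using (view; ‵fromℕ; ‵inject₁)
open import Data.Fin.Subset using (Subset; _∈_; _∉_; _⊆_; _∪_; ⁅_⁆; ∁)
import Data.Fin.Subset.Properties as Subsetₚ
open import Data.Integer as ℤ using (ℤ; +_; -[1+_]; _+_; _*_; _-_; -_; ∣_∣)
import Data.Integer.Properties as ℤₚ
open import Data.Integer.Tactic.RingSolver using (solve-∀)
open import Data.List using (List; []; _∷_; _++_; allFin)
open import Data.List.Membership.Propositional using () renaming (_∈_ to _∈ₗ_)
open import Data.List.Membership.Propositional.Properties using (∈-allFin)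
open import Data.List.Relation.Unary.All using (All; []; _∷_)
import Data.List.Relation.Unary.All.Properties as Allₚ
open import Data.List.Relation.Unary.Any using (here; there)
open import Data.Nat as ℕ using (ℕ; zero; suc)
import Data.Nat.Properties as ℕₚ
open import Data.Product using (Σ; _×_; _,_; proj₁; proj₂)
open import Data.Rational as ℚ using (ℚ; 0ℚ; 1ℚ)
import Data.Rational.Properties as ℚₚ
import Data.Rational.Unnormalised as ℚᵘ
import Data.Rational.Unnormalised.Properties as ℚᵘₚ
open import Data.Sum using (_⊎_; inj₁; inj₂)
open import Data.Unit using (⊤; tt)
open import Data.Vec using (lookup; tabulate)
import Data.Vec.Properties as Vecₚ
open import Relation.Binary.Definitions using (tri<; tri≈; tri>)
open import Relation.Binary.PropositionalEquality
open import Relation.Nullary using (¬_; Dec; yes; no; isYes; ¬?; _×-dec_; _→-dec_)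

open SemiringSum ℤₚ.+-*-semiring using (sum; sum-cong-≗; ∑-distrib-+; ∑-comm; *-distribˡ-sum)
module ℚGroup = GroupProperties ℚₚ.+-0-group

-- No inverse of φ and no counting polynomial is used: neither the tree with a given O_T nor the
-- orientation that belongs to a given forest is constructed directly. Surjectivity comes from
-- injections between finite sets in both directions, and these need partially decided orientations.
-- They are paintings of the unchanged edge set: for circulations, `none` deletes an edge and `bi`
-- contracts it, so no minor of the graph is ever formed, and passing to cocycles merely exchanges
-- the two. Each choice in such an injection asks whether a painting is still compatible, which is
-- decidable because a signature has only finitely many vectors (`search`). All vectors are
-- integral, so a nonnegative combination is a sum with repetitions, and peeling off one positive
-- vector at a time ends because an ℓ¹ norm drops.

neg-unique : ∀ a b → a + b ≡ 0ℤ → b ≡ - a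
neg-unique = inverseʳ-unique ℤₚ.+-0-abelianGroup

-- Signs, paintings and conforming integers.

sgn : Bool → ℤ
sgn true  = +1ℤ
sgn false = -1ℤ

sgn≢0 : ∀ b → sgn b ≢ 0ℤ
sgn≢0 true  ()
sgn≢0 false ()

sgn-not : ∀ b → sgn (not b) ≡ - sgn b
sgn-not true  = refl
sgn-not false = refl

neg-cong : ∀ {a b} → a ≡ b → - a ≡ - b
neg-cong = cong (λ x → - x)

neg-≢0 : ∀ {a} → a ≢ 0ℤ → - a ≢ 0ℤ
neg-≢0 {+ zero} p q = p refl
neg-≢0 {+ suc n} p ()
neg-≢0 { -[1+ n ]} p ()

data Unit : ℤ → Set where
  u0 : Unit 0ℤ
  u± : ∀ b → Unit (sgn b)

-- Conf u z: the entry u ∈ {0, ±1} is zero or has the sign of z.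
data Conf : ℤ → ℤ → Set where
  c0 : ∀ {b} → Conf 0ℤ b
  c+ : ∀ {n} → Conf +1ℤ (+ suc n)
  c- : ∀ {n} → Conf -1ℤ -[1+ n ]

-- A painting in the sense of Minty: for circulations, bi leaves the coordinate free and none forces
-- it to vanish; for potential differences the two are exchanged by dual.
data State : Set where
  bi none : State
  dir     : Bool → State

dual : State → State
dual bi      = none
dual none    = bi
dual (dir b) = dir b

Fit : State → ℤ → Set
Fit bi          z = ⊤
Fit none        z = z ≡ 0ℤ
Fit (dir true)  z = 0ℤ ℤ.≤ z
Fit (dir false) z = z ℤ.≤ 0ℤ

Fit? : ∀ s z → Dec (Fit s z)
Fit? bi          z = yes tt
Fit? none        z = z ℤ.≟ 0ℤ
Fit? (dir true)  z = 0ℤ ℤ.≤? z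
Fit? (dir false) z = z ℤ.≤? 0ℤ

Fit-0 : ∀ s → Fit s 0ℤ
Fit-0 bi          = tt
Fit-0 none        = refl
Fit-0 (dir true)  = ℤₚ.≤-refl
Fit-0 (dir false) = ℤₚ.≤-refl

Fit-+ : ∀ s {a b} → Fit s a → Fit s b → Fit s (a + b)
Fit-+ bi          _ _ = tt
Fit-+ none        refl refl = refl
Fit-+ (dir true)  p q = ℤₚ.+-mono-≤ p q
Fit-+ (dir false) p q = ℤₚ.+-mono-≤ p q

Fit-sgn : ∀ b → Fit (dir b) (sgn b)
Fit-sgn true  = ℤ.+≤+ ℕ.z≤n
Fit-sgn false = ℤ.-≤+

Fit-neg : ∀ b {z} → Fit (dir b) (- z) → Fit (dir (not b)) z
Fit-neg true  {+ zero}  p = p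
Fit-neg true  { -[1+ n ]} p = ℤ.-≤+
Fit-neg false {+ n} p = ℤ.+≤+ ℕ.z≤n
Fit-neg false { -[1+ n ]} (ℤ.+≤+ ())

Fit-neg′ : ∀ b {z} → Fit (dir b) z → Fit (dir (not b)) (- z)
Fit-neg′ b {z} p = Fit-neg b (subst (Fit (dir b)) (sym (ℤₚ.neg-involutive z)) p)

Fit-conf : ∀ s {u z} → Conf u z → Fit s z → Fit s u
Fit-conf s c0 _ = Fit-0 s
Fit-conf bi c+ _ = tt
Fit-conf (dir true) c+ _ = ℤ.+≤+ ℕ.z≤n
Fit-conf (dir false) c+ (ℤ.+≤+ ())
Fit-conf bi c- _ = tt
Fit-conf (dir false) c- _ = ℤ.-≤+

-- A nonzero integer is at least one unit away from zero, so subtracting a unit of its own sign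
-- cannot cross zero.
Fit-rest : ∀ s {u z} → Conf u z → Fit s z → Fit s (z - u)
Fit-rest s (c0 {b}) p = subst (Fit s) (sym (ℤₚ.+-identityʳ b)) p
Fit-rest bi c+ _ = tt
Fit-rest (dir true) (c+ {n}) _ = ℤ.+≤+ ℕ.z≤n
Fit-rest (dir false) c+ (ℤ.+≤+ ())
Fit-rest bi c- _ = tt
Fit-rest (dir false) (c- {zero}) _ = ℤ.+≤+ ℕ.z≤n
Fit-rest (dir false) (c- {suc n}) _ = ℤ.-≤+

conf-≤ : ∀ {u z} → Conf u z → ∣ z - u ∣ ℕ.≤ ∣ z ∣
conf-≤ (c0 {b}) = ℕₚ.≤-reflexive (cong ∣_∣ (ℤₚ.+-identityʳ b))
conf-≤ (c+ {n}) = ℕₚ.n≤1+n n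
conf-≤ (c- {zero}) = ℕ.z≤n
conf-≤ (c- {suc n}) = ℕₚ.n≤1+n _

conf-< : ∀ {u z} → Conf u z → u ≢ 0ℤ → ∣ z - u ∣ ℕ.< ∣ z ∣
conf-< c0 p = ⊥-elim (p refl)
conf-< (c+ {n}) _ = ℕₚ.≤-refl
conf-< (c- {zero}) _ = ℕₚ.≤-refl
conf-< (c- {suc n}) _ = ℕₚ.≤-refl

conf-≢0 : ∀ {u z} → Conf u z → u ≢ 0ℤ → z ≢ 0ℤ
conf-≢0 c0 p = ⊥-elim (p refl)
conf-≢0 c+ _ ()
conf-≢0 c- _ ()

conf-unit : ∀ {u z} → Conf u z → Unit u
conf-unit c0 = u0
conf-unit c+ = u± true
conf-unit c- = u± false

sgn-conf : ∀ b {z} → Fit (dir b) z → z ≢ 0ℤ → Conf (sgn b) z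
sgn-conf true {+ zero} _ nz = ⊥-elim (nz refl)
sgn-conf true {+ suc n} _ _ = c+
sgn-conf false {+ zero} _ nz = ⊥-elim (nz refl)
sgn-conf false {+ suc n} (ℤ.+≤+ ()) _
sgn-conf false { -[1+ n ]} _ _ = c-

-- Dual states leave either one factor zero or two factors without opposite signs. Together with
-- orthogonality this makes every term of an inner product vanish.
Fit-prod : ∀ s {a b} → Fit s a → Fit (dual s) b → 0ℤ ℤ.≤ a * b
Fit-prod bi {a} _ refl = ℤₚ.≤-reflexive (sym (ℤₚ.*-zeroʳ a))
Fit-prod none refl _ = ℤₚ.≤-refl
Fit-prod (dir true) {+ a} {+ b} _ _ = subst (0ℤ ℤ.≤_) (ℤₚ.pos-* a b) (ℤ.+≤+ ℕ.z≤n)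
Fit-prod (dir false) {+ zero} _ _ = ℤₚ.≤-refl
Fit-prod (dir false) {+ suc n} (ℤ.+≤+ ()) _
Fit-prod (dir false) { -[1+ n ]} {+ zero} _ _ = ℤₚ.≤-reflexive (sym (ℤₚ.*-zeroʳ -[1+ n ]))
Fit-prod (dir false) { -[1+ n ]} {+ suc _} _ (ℤ.+≤+ ())
Fit-prod (dir false) { -[1+ n ]} { -[1+ k ]} _ _ = ℤ.+≤+ ℕ.z≤n

*-≢0 : ∀ {a b} → a ≢ 0ℤ → b ≢ 0ℤ → a * b ≢ 0ℤ
*-≢0 {a} {b} p q r with ℤₚ.i*j≡0⇒i≡0∨j≡0 a r
... | inj₁ x = p x
... | inj₂ y = q y

sum-nonneg : ∀ {k} (f : Fin k → ℤ) → (∀ i → 0ℤ ℤ.≤ f i) → 0ℤ ℤ.≤ sum f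
sum-nonneg {zero}  f p = ℤₚ.≤-refl
sum-nonneg {suc k} f p = ℤₚ.+-mono-≤ (p fzero) (sum-nonneg (λ i → f (fsuc i)) (λ i → p (fsuc i)))

sum-zero : ∀ {k} (f : Fin k → ℤ) → (∀ i → 0ℤ ℤ.≤ f i) → sum f ≡ 0ℤ → ∀ i → f i ≡ 0ℤ
sum-zero {suc k} f p q = λ { fzero → f0 ; (fsuc i) → sum-zero _ (λ i → p (fsuc i)) rest i }
  where
  r = sum (λ i → f (fsuc i))
  r≥0 : 0ℤ ℤ.≤ r
  r≥0 = sum-nonneg (λ i → f (fsuc i)) (λ i → p (fsuc i))
  f0 : f fzero ≡ 0ℤ
  f0 = ℤₚ.≤-antisym (ℤₚ.≤-trans (ℤₚ.≤-reflexive (sym (ℤₚ.+-identityʳ _)))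
         (ℤₚ.≤-trans (ℤₚ.+-monoʳ-≤ (f fzero) r≥0) (ℤₚ.≤-reflexive q))) (p fzero)
  rest : r ≡ 0ℤ
  rest = trans (sym (ℤₚ.+-identityˡ r)) (trans (cong (_+ r) (sym f0)) q)

sumℕ : ∀ {k} → (Fin k → ℕ) → ℕ
sumℕ {zero}  f = 0
sumℕ {suc k} f = f fzero ℕ.+ sumℕ (λ i → f (fsuc i))

sumℕ-≤ : ∀ {k} {f g : Fin k → ℕ} → (∀ i → f i ℕ.≤ g i) → sumℕ f ℕ.≤ sumℕ g
sumℕ-≤ {zero}  p = ℕ.z≤n
sumℕ-≤ {suc k} p = ℕₚ.+-mono-≤ (p fzero) (sumℕ-≤ (λ i → p (fsuc i)))

sumℕ-< : ∀ {k} {f g : Fin k → ℕ} → (∀ i → f i ℕ.≤ g i) → ∀ i → f i ℕ.< g i → sumℕ f ℕ.< sumℕ g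
sumℕ-< {suc k} p fzero    q = ℕₚ.+-mono-<-≤ q (sumℕ-≤ (λ i → p (fsuc i)))
sumℕ-< {suc k} p (fsuc i) q = ℕₚ.+-mono-≤-< (p fzero) (sumℕ-< (λ i → p (fsuc i)) i q)

-- Integer vectors, cones and signed lattices.

module _ {m : ℕ} where

  infixl 6 _+v_ _-v_
  _+v_ _-v_ : Vector m → Vector m → Vector m
  (v +v w) e = v e + w e
  (v -v w) e = v e - w e

  negv : Vector m → Vector m
  negv v e = - v e

  0v : Vector m
  0v _ = 0ℤ

  dot : Vector m → Vector m → ℤ
  dot v w = sum (λ e → v e * w e)

  Fits : (Fin m → State) → Vector m → Set
  Fits s v = ∀ e → Fit (s e) (v e)

  -- Coefficients are encoded by repetition. The constructors carry pointwise equations since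
  -- vectors are functions.
  data Cone (Pos : Vector m → Set) : Vector m → Set where
    nil  : ∀ {z} → z ≗v 0v → Cone Pos z
    cons : ∀ {z v w} → Pos v → Cone Pos w → z ≗v (v +v w) → Cone Pos z

  module _ {Pos : Vector m → Set} where

    cone-resp : ∀ {v w} → w ≗v v → Cone Pos v → Cone Pos w
    cone-resp p (nil q)      = nil (λ e → trans (p e) (q e))
    cone-resp p (cons a c q) = cons a c (λ e → trans (p e) (q e))

    cone-+ : ∀ {v w} → Cone Pos v → Cone Pos w → Cone Pos (v +v w)
    cone-+ {v} {w} (nil p) d = cone-resp (λ e → trans (cong (_+ w e) (p e)) (ℤₚ.+-identityˡ _)) d
    cone-+ {v} {w} (cons {v = a} {b} x c p) d =
      cons x (cone-+ c d) (λ e → trans (cong (_+ w e) (p e)) (ℤₚ.+-assoc (a e) (b e) (w e)))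

    cone-Pos : ∀ {v} → Pos v → Cone Pos v
    cone-Pos x = cons x (nil {z = 0v} (λ _ → refl)) (λ e → sym (ℤₚ.+-identityʳ _))

nonzero? : ∀ {m} (z : Vector m) → (Σ (Fin m) λ e → z e ≢ 0ℤ) ⊎ (z ≗v 0v)
nonzero? {m} z with Finₚ.all? (λ e → z e ℤ.≟ 0ℤ)
... | yes p = inj₂ p
... | no ¬p = inj₁ (Finₚ.¬∀⟶∃¬ _ _ (λ e → z e ℤ.≟ 0ℤ) ¬p)

-- The common frame for cycles and cocycles: a lattice L with its elementary vectors, one of
-- each opposite pair being declared positive by the signature.
record System (m : ℕ) : Set₁ where
  field
    L        : Vector m → Set
    L-resp   : ∀ {v w} → v ≗v w → L v → L w
    L-0      : L 0v
    L-+      : ∀ {v w} → L v → L w → L (v +v w)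
    L-neg    : ∀ {v} → L v → L (negv v)
    Pos      : Vector m → Set
    Pos-L    : ∀ {v} → Pos v → L v
    Pos-unit : ∀ {v} → Pos v → ∀ e → Unit (v e)
    Pos-nz   : ∀ {v} → Pos v → Σ (Fin m) λ e → v e ≢ 0ℤ
    extract  : ∀ {z} → L z → ∀ e → z e ≢ 0ℤ →
      Σ (Vector m) λ v → (Pos v ⊎ Pos (negv v)) × (∀ f → Conf (v f) (z f))
    -- Acyclicity of the signature: the cone spanned by the positive vectors contains no line.
    pointed  : ∀ {z} → Cone Pos z → Cone Pos (negv z) → z ≗v 0v
    -- Makes compatibility of a painting decidable; the choices made edge by edge depend on it.
    search   : ∀ s → Dec (Σ (Vector m) λ v → Pos v × Fits s (negv v))

  L-minus : ∀ {v w} → L v → L w → L (v -v w)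
  L-minus p q = L-+ p (L-neg q)

  cone-L : ∀ {z} → Cone Pos z → L z
  cone-L (nil p)      = L-resp (λ e → sym (p e)) L-0
  cone-L (cons p c q) = L-resp (λ e → sym (q e)) (L-+ (Pos-L p) (cone-L c))

  -- If every entry is `dir`, this is compatibility with the signature: the orientation contains no
  -- opposite of a positive vector. The form with `negv` makes sense for free and deleted edges too.
  Comp : (Fin m → State) → Set
  Comp s = ∀ v → Pos v → ¬ Fits s (negv v)

  -- For cycles it says that `T` is a forest. For cocycles, applied to the complement of `T`, it
  -- says that `T` connects all vertices.
  Indep : (Fin m → Bool) → Set
  Indep T = ∀ z → L z → (∀ e → T e ≡ false → z e ≡ 0ℤ) → z ≗v 0v

  -- The vector is the signature value of the fundamental cycle `C(T,e)` and `b` its direction at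
  -- `e`; for cocycles and the complement of `T` it is that of `C*(T,e)`.
  Fund : (Fin m → Bool) → Fin m → Bool → Set
  Fund T e b = Σ (Vector m) λ v → Pos v × v e ≡ sgn b × (∀ f → T f ≡ false → f ≢ e → v f ≡ 0ℤ)

  Orients : (Fin m → Bool) → (Fin m → Bool) → Set
  Orients T O = ∀ e → T e ≡ false → Fund T e (O e)

  Pos-L′ : ∀ {v} → Pos v ⊎ Pos (negv v) → L v
  Pos-L′ (inj₁ p) = Pos-L p
  Pos-L′ (inj₂ p) = L-resp (λ e → ℤₚ.neg-involutive _) (L-neg (Pos-L p))

  Pos-nz′ : ∀ {v} → Pos v ⊎ Pos (negv v) → Σ (Fin m) λ e → v e ≢ 0ℤ
  Pos-nz′ (inj₁ p) = Pos-nz p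
  Pos-nz′ (inj₂ p) with Pos-nz p
  ... | e , q = e , λ r → q (neg-cong r)

  private
    weight : (Fin m → Bool) → Vector m → Fin m → ℕ
    weight W z e = if W e then ∣ z e ∣ else 0

    peelFuel : (P : Vector m → Set) (W : Fin m → Bool) →
      (∀ z → P z → (z ≗v 0v) ⊎ Σ (Vector m) λ v → Pos v × P (z -v v) ×
        (∀ f → W f ≡ true → Conf (v f) (z f)) × Σ (Fin m) λ f → W f ≡ true × v f ≢ 0ℤ) →
      ∀ N z → sumℕ (weight W z) ℕ.< N → P z → Cone Pos z
    peelFuel P W next (suc N) z lt p with next z p
    ... | inj₁ q = nil q
    ... | inj₂ (v , pos , p′ , conf , f , Wf , vf) =
      cons pos (peelFuel P W next N (z -v v) (ℕₚ.<-≤-trans dec (ℕₚ.≤-pred lt)) p′)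
        (λ e → sym (trans (ℤₚ.+-comm (v e) _) (trans (ℤₚ.+-assoc (z e) _ _)
          (trans (cong (_+_ (z e)) (ℤₚ.+-inverseˡ (v e))) (ℤₚ.+-identityʳ _)))))
      where
      le : ∀ i → weight W (z -v v) i ℕ.≤ weight W z i
      le i with W i in eq
      ... | true  = conf-≤ (conf i eq)
      ... | false = ℕ.z≤n
      lf : weight W (z -v v) f ℕ.< weight W z f
      lf rewrite Wf = conf-< (conf f Wf) vf
      dec = sumℕ-< le f lf

  -- Writes z as a sum of positive vectors, each of which lowers the ℓ¹ norm on W.
  peel : (P : Vector m → Set) (W : Fin m → Bool) →
    (∀ z → P z → (z ≗v 0v) ⊎ Σ (Vector m) λ v → Pos v × P (z -v v) ×
      (∀ f → W f ≡ true → Conf (v f) (z f)) × Σ (Fin m) λ f → W f ≡ true × v f ≢ 0ℤ) →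
    ∀ z → P z → Cone Pos z
  peel P W next z = peelFuel P W next _ z ℕₚ.≤-refl

  -- An elementary vector conforming to `z` fits the painting, so its opposite cannot be positive
  -- and it is positive itself. Subtracting it leaves a smaller vector that still fits.
  comp-cone : ∀ {s z} → Comp s → L z → Fits s z → Cone Pos z
  comp-cone {s} {z} comp l fit = peel (λ z → L z × Fits s z) (λ _ → true) next z (l , fit)
    where
    next : ∀ z → L z × Fits s z → _
    next z (l , fit) with nonzero? z
    ... | inj₂ q = inj₁ q
    ... | inj₁ (e , q) with extract l e q
    ...   | v , inj₁ pos , conf = inj₂ (v , pos , (L-minus l (Pos-L pos) , λ f → Fit-rest (s f) (conf f)
          (fit f)) ,
              (λ f _ → conf f) , proj₁ (Pos-nz pos) , refl , proj₂ (Pos-nz pos))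
    ...   | v , inj₂ pos , conf = ⊥-elim (comp _ pos (λ f → Fit-conf (s f)
              (subst (λ x → Conf x (z f)) (sym (ℤₚ.neg-involutive (v f))) (conf f)) (fit f)))

  -- This is the expansion of `z` in fundamental vectors, with its entries off `T` as coefficients.
  -- A fundamental vector alters only one such entry; the entries on `T` have unknown sign and are
  -- left out of the norm. Once all entries off `T` are zero, independence finishes.
  tree-cone : ∀ {T O z} → Indep T → Orients T O → L z → (∀ e → T e ≡ false → Fit (dir (O e)) (z e)) → Cone Pos z
  tree-cone {T} {O} {z} ind ori l fit =
    peel (λ z → L z × (∀ e → T e ≡ false → Fit (dir (O e)) (z e))) (λ e → not (T e)) next z (l , fit)
    where
    notF : ∀ {b} → not b ≡ true → b ≡ false
    notF {false} _ = refl
    next : ∀ z → L z × (∀ e → T e ≡ false → Fit (dir (O e)) (z e)) → _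
    next z (l , fit) with nonzero? (λ e → if T e then 0ℤ else z e)
    ... | inj₂ q = inj₁ (ind z l (λ e Te → trans (sym (cong (λ b → if b then 0ℤ else z e) Te)) (q e)))
    ... | inj₁ (e , q) with T e in Te
    ...   | true = ⊥-elim (q refl)
    ...   | false with ori e Te
    ...     | v , pos , ve , off = inj₂ (v , pos , (L-minus l (Pos-L pos) , λ f Tf → Fit-rest (dir (O f))
          (conf f Tf) (fit f Tf)) ,
                (λ f nf → conf f (notF nf)) , e , cong not Te , λ r → sgn≢0 (O e) (trans (sym ve) r))
      where
      conf : ∀ f → T f ≡ false → Conf (v f) (z f)
      conf f Tf with f Finₚ.≟ e
      ... | yes refl = subst (λ x → Conf x (z f)) (sym ve) (sgn-conf (O e) (fit e Te) q)
      ... | no f≢e = subst (λ x → Conf x (z f)) (sym (off f Tf f≢e)) c0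

  -- Two fundamental vectors with opposite entries at `e` have a sum that vanishes off `T`, hence
  -- everywhere. Then a positive vector and its opposite both lie in the cone.
  fund-unique : ∀ {T e b c} → T e ≡ false → Indep T → Fund T e b → Fund T e c → b ≡ c
  fund-unique {T} {e} {b} {c} Te ind (v , pv , ve , voff) (w , pw , we , woff) with b Data.Bool.≟ c
    where import Data.Bool
  ... | yes p = p
  ... | no b≢c = ⊥-elim (sgn≢0 b (trans (sym ve) (pointed (cone-Pos pv) (cone-resp w≗ (cone-Pos pw)) e)))
    where
    opp : ∀ b c → b ≢ c → sgn b + sgn c ≡ 0ℤ
    opp true  true  n = ⊥-elim (n refl)
    opp true  false n = refl
    opp false true  n = refl
    opp false false n = ⊥-elim (n refl)
    zero-off : ∀ f → T f ≡ false → v f + w f ≡ 0ℤ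
    zero-off f Tf with f Finₚ.≟ e
    ... | yes refl = trans (cong₂ _+_ ve we) (opp b c b≢c)
    ... | no q = cong₂ _+_ (voff f Tf q) (woff f Tf q)
    w≗ : ∀ f → - v f ≡ w f
    w≗ f = trans (sym (ℤₚ.+-identityʳ _)) (trans (cong (_+_ (- v f))
        (sym (ind _ (L-+ (Pos-L pv) (Pos-L pw)) zero-off f)))
           (trans (sym (ℤₚ.+-assoc (- v f) (v f) (w f)))
               (trans (cong (_+ w f) (ℤₚ.+-inverseˡ (v f))) (ℤₚ.+-identityˡ _))))

  -- An elementary vector supported on free edges fits together with its opposite, and one of the
  -- two is positive, against compatibility.
  comp-indep : ∀ {s T} → Comp s → (∀ e → T e ≡ true → s e ≡ bi) → Indep T
  comp-indep {s} {T} comp Tbi z l off with nonzero? z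
  ... | inj₂ q = q
  ... | inj₁ (e , q) with extract l e q
  ...   | v , pv , conf = ⊥-elim (bad pv)
    where
    v-off : ∀ f → T f ≡ false → v f ≡ 0ℤ
    v-off f Tf with v f ℤ.≟ 0ℤ
    ... | yes p = p
    ... | no p = ⊥-elim (conf-≢0 (conf f) p (off f Tf))
    fit : ∀ f x → (v f ≡ 0ℤ → x ≡ 0ℤ) → Fit (s f) x
    fit f x x0 with T f in eq
    ... | true = subst (λ t → Fit t x) (sym (Tbi f eq)) tt
    ... | false = subst (Fit (s f)) (sym (x0 (v-off f eq))) (Fit-0 (s f))
    bad : ¬ (Pos v ⊎ Pos (negv v))
    bad (inj₁ p) = comp _ p (λ f → fit f _ neg-cong)
    bad (inj₂ p) = comp _ p (λ f → fit f _ (λ r → trans (ℤₚ.neg-involutive (v f)) r))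

open System public

-- Dual pairs and Minty's painting lemma.

record DualPair {m : ℕ} (H H* : System m) : Set where
  field
    orth  : ∀ {z w} → L H z → L H* w → dot z w ≡ 0ℤ
    -- The alternatives exclude each other by `orth` and `Fit-prod`; what has to be required is that
    -- one of them occurs.
    minty : ∀ s e b → s e ≡ dir b →
      (Σ (Vector m) λ z → L H z × Fits s z × z e ≢ 0ℤ) ⊎
      (Σ (Vector m) λ w → L H* w × Fits (λ f → dual (s f)) w × w e ≢ 0ℤ)
open DualPair public

dual-involutive : ∀ s → dual (dual s) ≡ s
dual-involutive bi      = refl
dual-involutive none    = refl
dual-involutive (dir b) = refl

swapPair : ∀ {m} {H H* : System m} → DualPair H H* → DualPair H* H
orth (swapPair D) {z} {w} lz lw = trans (sum-cong-≗ (λ e → ℤₚ.*-comm (z e) (w e))) (orth D lw lz)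
minty (swapPair D) s e b se with minty D (λ f → dual (s f)) e b (cong dual se)
... | inj₁ x = inj₂ x
... | inj₂ (w , lw , fit , we) = inj₁ (w , lw , (λ f → subst (λ t → Fit t (w f)) (dual-involutive (s f))
      (fit f)) , we)

-- Uniqueness: comparing trees and their orientations.

β : Bool → ℤ
β true  = +1ℤ
β false = 0ℤ

β-injective : ∀ {a b} → β a ≡ β b → a ≡ b
β-injective {true}  {true}  _ = refl
β-injective {false} {false} _ = refl

βv : ∀ {m} → (Fin m → Bool) → Vector m
βv O e = β (O e)

Fit-β : ∀ a b → Fit (dir a) (β a - β b)
Fit-β true  true  = ℤₚ.≤-refl
Fit-β true  false = ℤ.+≤+ ℕ.z≤n
Fit-β false true  = ℤ.-≤+
Fit-β false false = ℤₚ.≤-refl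

Fit-β′ : ∀ a b → Fit (dir b) (- (β a - β b))
Fit-β′ a b = subst (Fit (dir b)) (eq (β a) (β b)) (Fit-β b a)
  where
  eq : ∀ x y → y - x ≡ - (x - y)
  eq = solve-∀

-- If `p` and `o` differ, the first bracket is a unit of the sign of `p`, and the second, of size at
-- most one, cannot outweigh it. If they agree, both brackets vanish.
Fit-ββ : ∀ p o q r → (p ≡ o → q ≡ r) → Fit (dir p) ((β p - β o) - (β q - β r))
Fit-ββ true  false true  true  _ = ℤ.+≤+ ℕ.z≤n
Fit-ββ true  false true  false _ = ℤₚ.≤-refl
Fit-ββ true  false false true  _ = ℤ.+≤+ ℕ.z≤n
Fit-ββ true  false false false _ = ℤ.+≤+ ℕ.z≤n
Fit-ββ false true  true  true  _ = ℤ.-≤+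
Fit-ββ false true  true  false _ = ℤ.-≤+
Fit-ββ false true  false true  _ = ℤₚ.≤-refl
Fit-ββ false true  false false _ = ℤ.-≤+
Fit-ββ true  true  q r h with refl ← h refl = subst (0ℤ ℤ.≤_) (sym (eq (β q))) ℤₚ.≤-refl
  where
  eq : ∀ x → 0ℤ - (x - x) ≡ 0ℤ
  eq = solve-∀
Fit-ββ false false q r h with refl ← h refl = subst (ℤ._≤ 0ℤ) (sym (eq (β q))) ℤₚ.≤-refl
  where
  eq : ∀ x → 0ℤ - (x - x) ≡ 0ℤ
  eq = solve-∀

split : Bool → Bool → Bool → State
split true  true  _ = bi
split false false _ = none
split true  false o = dir o
split false true  o = dir (not o)

split-dir : ∀ s t o → s ≢ t → Σ Bool λ b → split s t o ≡ dir b
split-dir true  true  o n = ⊥-elim (n refl)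
split-dir false false o n = ⊥-elim (n refl)
split-dir true  false o n = o , refl
split-dir false true  o n = not o , refl

not-≡-false : ∀ {b} → not b ≡ false → b ≡ true
not-≡-false {true} _ = refl

Fit-un : ∀ b {z} → Fit (dir (not b)) z → Fit (dir b) (- z)
Fit-un b {z} p = subst (λ c → Fit (dir c) (- z)) (Boolₚ.not-involutive b) (Fit-neg′ (not b) p)

-- `split₁` and `split₂` give the signs off the two trees for a circulation fitting the painting and
-- for its opposite; `split₃` and `split₄` do the same on the trees for a potential difference.
split₁ : ∀ t₁ t₂ o₁ o₂ z → (t₁ ≢ t₂ → o₁ ≡ o₂) → t₂ ≡ false → Fit (split t₁ t₂ o₁) z → Fit (dir o₂) z
split₁ true  _ _ o₂ z h refl p = subst (λ o → Fit (dir o) z) (h (λ ())) p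
split₁ false _ _ o₂ z h refl p = subst (Fit (dir o₂)) (sym p) (Fit-0 (dir o₂))

split₂ : ∀ t₁ t₂ o z → t₁ ≡ false → Fit (split t₁ t₂ o) z → Fit (dir o) (- z)
split₂ _ true  o z refl p = Fit-un o p
split₂ _ false o z refl p = subst (Fit (dir o)) (sym (neg-cong p)) (Fit-0 (dir o))

split₃ : ∀ t₁ t₂ o z → t₁ ≡ true → Fit (dual (split t₁ t₂ o)) z → Fit (dir o) z
split₃ _ true  o z refl p = subst (Fit (dir o)) (sym p) (Fit-0 (dir o))
split₃ _ false o z refl p = p

split₄ : ∀ t₁ t₂ o₁ o₂ z → (t₁ ≢ t₂ → o₁ ≡ o₂) → t₂ ≡ true → Fit (dual (split t₁ t₂ o₁)) z → Fit (dir o₂) (- z)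
split₄ true  _ _ o₂ z h refl p = subst (Fit (dir o₂)) (sym (neg-cong p)) (Fit-0 (dir o₂))
split₄ false _ o₁ o₂ z h refl p = subst (λ o → Fit (dir o) (- z)) (h (λ ())) (Fit-un o₁ p)

module Trees {m : ℕ} (H H* : System m) where

  record Base (T : Fin m → Bool) : Set where
    field
      ind  : Indep H T
      ind* : Indep H* (λ e → not (T e))
  open Base public

  -- O is the orientation that σ and σ* attach to T.
  record Tree (T O : Fin m → Bool) : Set where
    field
      base : Base T
      ori  : Orients H T O
      ori* : Orients H* (λ e → not (T e)) O
  open Tree public

  tree-resp : ∀ {T O O′} → (∀ e → O e ≡ O′ e) → Tree T O → Tree T O′
  base (tree-resp p t) = base t
  ori  (tree-resp {T} p t) e Te = subst (Fund H T e) (p e) (ori t e Te)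
  ori* (tree-resp {T} p t) e Te = subst (Fund H* (λ e → not (T e)) e) (p e) (ori* t e Te)

  tree-transport : ∀ {T T′ O} → (∀ e → T e ≡ T′ e) → Tree T O → Tree T′ O
  tree-transport {T} {T′} {O} p t = record
    { base = record
      { ind  = λ z l off → ind (base t) z l (λ e Te → off e (trans (sym (p e)) Te))
      ; ind* = λ z l off → ind* (base t) z l (λ e Te → off e (trans (cong not (sym (p e))) Te)) }
    ; ori = λ e Te → let (v , pos , ve , off) = ori t e (trans (p e) Te)
                     in v , pos , ve , λ f Tf → off f (trans (p f) Tf)
    ; ori* = λ e Te → let (v , pos , ve , off) = ori* t e (trans (cong not (p e)) Te)
                      in v , pos , ve , λ f Tf → off f (trans (cong not (p f)) Tf) }

  tree-unique : ∀ {T O O′} → Tree T O → Tree T O′ → ∀ e → O e ≡ O′ e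
  tree-unique {T} t t′ e with T e in Te
  ... | false = fund-unique H Te (ind (base t)) (ori t e Te) (ori t′ e Te)
  ... | true  = fund-unique H* (cong not Te) (ind* (base t)) (ori* t e (cong not Te)) (ori* t′ e (cong not Te))

module _ {m : ℕ} {H H* : System m} (D : DualPair H H*) where
  open Trees H H*

  module _ {T₁ T₂ O₁ O₂ : Fin m → Bool} (t₁ : Tree T₁ O₁) (t₂ : Tree T₂ O₂) where

    -- Paint T₁ ∩ T₂ bi-directed, delete what lies outside T₁ ∪ T₂, orient T₁ ∖ T₂ by O₁ and
    -- T₂ ∖ T₁ against it: a circulation or potential difference fitting this painting
    -- lies with its opposite in the cone of positive vectors, hence vanishes.
    tree-injective : (∀ e → T₁ e ≢ T₂ e → O₁ e ≡ O₂ e) → ∀ e → T₁ e ≡ T₂ e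
    tree-injective agree e with T₁ e Boolₚ.≟ T₂ e
    ... | yes p = p
    ... | no p with minty D (λ f → split (T₁ f) (T₂ f) (O₁ f)) e _ (proj₂ (split-dir (T₁ e) (T₂ e) (O₁ e) p))
    ...   | inj₁ (z , lz , fit , ze) = ⊥-elim (ze (pointed H
              (tree-cone H (ind (base t₂)) (ori t₂) lz
                  (λ f Tf → split₁ (T₁ f) (T₂ f) (O₁ f) (O₂ f) (z f) (agree f) Tf (fit f)))
              (tree-cone H (ind (base t₁)) (ori t₁) (L-neg H lz)
                  (λ f Tf → split₂ (T₁ f) (T₂ f) (O₁ f) (z f) Tf (fit f))) e))
    ...   | inj₂ (w , lw , fit , we) = ⊥-elim (we (pointed H*
              (tree-cone H* (ind* (base t₁)) (ori* t₁) lw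
                  (λ f Tf → split₃ (T₁ f) (T₂ f) (O₁ f) (w f) (not-≡-false Tf) (fit f)))
              (tree-cone H* (ind* (base t₂)) (ori* t₂) (L-neg H* lw)
                  (λ f Tf → split₄ (T₁ f) (T₂ f) (O₁ f) (O₂ f) (w f) (agree f) (not-≡-false Tf) (fit f))) e))

    -- The difference runs along `O₁` wherever it is nonzero, and its opposite along `O₂`. Both
    -- therefore lie in the cocycle cone, which forces `O₁` and `O₂` to agree on all edges.
    tree-difference : L H* (βv O₁ -v βv O₂) → ∀ e → T₁ e ≡ T₂ e
    tree-difference l = tree-injective (λ e _ → β-injective (ℤₚ.i-j≡0⇒i≡j (β (O₁ e)) (β (O₂ e)) (vanish e)))
      where
      vanish : ∀ e → β (O₁ e) - β (O₂ e) ≡ 0ℤ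
      vanish = pointed H*
        (tree-cone H* (ind* (base t₁)) (ori* t₁) l (λ f _ → Fit-β (O₁ f) (O₂ f)))
        (tree-cone H* (ind* (base t₂)) (ori* t₂) (L-neg H* l) (λ f _ → Fit-β′ (O₁ f) (O₂ f)))

  -- Let c₁ and c₂ be the differences of tree direction and orientation. Equal generating sets make
  -- c₁ - c₂ run along `P₁` on `T₁` and its opposite along `P₂` on `T₂`. Hence c₁ and c₂ are equal,
  -- and it remains to see that the trees coincide.
  forest-injective : ∀ {T₁ T₂ P₁ P₂ O₁ O₂ : Fin m → Bool} → Tree T₁ P₁ → Tree T₂ P₂ →
    L H* (βv P₁ -v βv O₁) → L H* (βv P₂ -v βv O₂) →
    (∀ e → T₁ e ≡ true → P₁ e ≡ O₁ e → T₂ e ≡ true × P₂ e ≡ O₂ e) →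
    (∀ e → T₂ e ≡ true → P₂ e ≡ O₂ e → T₁ e ≡ true × P₁ e ≡ O₁ e) →
    ∀ e → O₁ e ≡ O₂ e
  forest-injective {T₁} {T₂} {P₁} {P₂} {O₁} {O₂} t₁ t₂ l₁ l₂ F₁ F₂ e =
    β-injective (trans (trans (eq′ (β (P₁ e)) (β (O₁ e))) (cong₂ _-_ (cong β (P≡ e)) (c≡ e)))
        (sym (eq′ (β (P₂ e)) (β (O₂ e)))))
    where
    eq′ : ∀ x y → y ≡ x - (x - y)
    eq′ = solve-∀
    neg : ∀ x y → y - x ≡ - (x - y)
    neg = solve-∀
    vanish : ∀ e → (β (P₁ e) - β (O₁ e)) - (β (P₂ e) - β (O₂ e)) ≡ 0ℤ
    vanish = pointed H*
      (tree-cone H* (ind* (base t₁)) (ori* t₁) (L-minus H* l₁ l₂)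
        (λ f Tf → Fit-ββ (P₁ f) (O₁ f) (P₂ f) (O₂ f) (λ p → proj₂ (F₁ f (not-≡-false Tf) p))))
      (tree-cone H* (ind* (base t₂)) (ori* t₂) (L-neg H* (L-minus H* l₁ l₂))
        (λ f Tf → subst (Fit (dir (P₂ f))) (neg (β (P₁ f) - β (O₁ f)) (β (P₂ f) - β (O₂ f)))
           (Fit-ββ (P₂ f) (O₂ f) (P₁ f) (O₁ f) (λ p → proj₂ (F₂ f (not-≡-false Tf) p)))))
    c≡ : ∀ e → β (P₁ e) - β (O₁ e) ≡ β (P₂ e) - β (O₂ e)
    c≡ e = ℤₚ.i-j≡0⇒i≡j _ _ (vanish e)
    moved : ∀ p o q r → p ≢ o → β p - β o ≡ β q - β r → p ≡ q
    moved true  true  _ _ n _ = ⊥-elim (n refl)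
    moved false false _ _ n _ = ⊥-elim (n refl)
    moved true  false true  false n _ = refl
    moved false true  false true  n _ = refl
    moved true  false true  true  n ()
    moved true  false false true  n ()
    moved true  false false false n ()
    moved false true  true  true  n ()
    moved false true  true  false n ()
    moved false true  false false n ()
    -- On an edge of only one of the trees, either the common difference is nonzero and fixes both
    -- directions, or the edge is unmoved on both sides and lies in just one of the two generating
    -- sets.
    agree : ∀ e → T₁ e ≢ T₂ e → P₁ e ≡ P₂ e
    agree e n with P₁ e Boolₚ.≟ O₁ e
    ... | no p = moved _ _ _ _ p (c≡ e)
    ... | yes p with P₂ e Boolₚ.≟ O₂ e
    ...   | no q = sym (moved _ _ _ _ q (sym (c≡ e)))
    ...   | yes q with T₁ e in a | T₂ e in b
    ...     | true  | true  = ⊥-elim (n refl)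
    ...     | false | false = ⊥-elim (n refl)
    ...     | true  | false = case′ (trans (sym b) (proj₁ (F₁ e a p)))
      where
      case′ : false ≡ true → _
      case′ ()
    ...     | false | true = case′ (trans (sym a) (proj₁ (F₂ e b q)))
      where
      case′ : false ≡ true → _
      case′ ()
    T≡ : ∀ e → T₁ e ≡ T₂ e
    T≡ = tree-injective t₁ t₂ agree
    P≡ : ∀ e → P₁ e ≡ P₂ e
    P≡ = tree-unique t₁ (tree-transport (λ e → sym (T≡ e)) t₂)

-- Deciding the entries of a painting one after another.

States : ℕ → Set
States m = Fin m → State

infixl 8 _[_≔_]
_[_≔_] : ∀ {m} → States m → Fin m → State → States m
(s [ e ≔ x ]) f with f Finₚ.≟ e
... | yes _ = x
... | no _  = s f

update-at : ∀ {m} (s : States m) e x → (s [ e ≔ x ]) e ≡ x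
update-at s e x with e Finₚ.≟ e
... | yes _ = refl
... | no p  = ⊥-elim (p refl)

update-off : ∀ {m} (s : States m) e x f → f ≢ e → (s [ e ≔ x ]) f ≡ s f
update-off s e x f p with f Finₚ.≟ e
... | yes q = ⊥-elim (p q)
... | no _  = refl

-- A choice of replacements for the entries of kind true, made one entry after another,
-- that is injective at each entry is injective.
module Process {m : ℕ} (kind : State → Bool) (I : States m → Set)
  (choose : ∀ s e → I s → kind (s e) ≡ true → Σ State λ x → kind x ≡ false × I (s [ e ≔ x ]))
  (choose-injective : ∀ s s′ e (i : I s) (i′ : I s′) (k : kind (s e) ≡ true) (k′ : kind (s′ e) ≡ true) →
     (∀ f → f ≢ e → s f ≡ s′ f) →
     proj₁ (choose s e i k) ≡ proj₁ (choose s′ e i′ k′) → s e ≡ s′ e)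
  where

  private
    replace : Fin m → Σ (States m) I → Bool → Set
    replace e (s , _) b = kind (s e) ≡ b

    -- The kind is a separate argument with its equation, so that two states of equal kind can be
    -- identified by matching on `refl`.
    move : ∀ e (si : Σ (States m) I) b → replace e si b → Σ (States m) I
    move e (s , i) true  k = s [ e ≔ proj₁ (choose s e i k) ] , proj₂ (proj₂ (choose s e i k))
    move e si      false _ = si

    moveAt : Fin m → Σ (States m) I → Σ (States m) I
    moveAt e si = move e si _ refl

    move-kind : ∀ e si b k f → (f ≡ e × kind (proj₁ (move e si b k) f) ≡ false) ⊎
                               (proj₁ (move e si b k) f ≡ proj₁ si f)
    move-kind e (s , i) false k f = inj₂ refl
    move-kind e (s , i) true  k f with f Finₚ.≟ e
    ... | yes p = inj₁ (p , proj₁ (proj₂ (choose s e i k)))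
    ... | no _  = inj₂ refl

    move-at : ∀ e si b k → kind (proj₁ (move e si b k) e) ≡ false
    move-at e (s , i) true k = trans (cong kind (update-at s e _)) (proj₁ (proj₂ (choose s e i k)))
    move-at e (s , i) false k = k

    Same : Σ (States m) I → Σ (States m) I → Set
    Same a b = ∀ f → kind (proj₁ a f) ≡ kind (proj₁ b f)

    -- Whether an entry is replaced depends on its kind alone, and afterwards its kind is `false`.
    -- Two states that start with equal kinds are thus altered at the same entries, as
    -- `choose-injective` requires.
    move-same : ∀ e a b → Same a b → Same (moveAt e a) (moveAt e b)
    move-same e a b same f with f Finₚ.≟ e
    ... | yes refl = trans (move-at e a _ refl) (sym (move-at e b _ refl))
    ... | no p with move-kind e a _ refl f | move-kind e b _ refl f
    ...   | inj₁ (q , _) | _ = ⊥-elim (p q)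
    ...   | _ | inj₁ (q , _) = ⊥-elim (p q)
    ...   | inj₂ q | inj₂ r = trans (cong kind q) (trans (same f) (sym (cong kind r)))

    move-injective : ∀ e a b x y k l → x ≡ y → (∀ f → proj₁ (move e a x k) f ≡ proj₁ (move e b y l) f) →
      ∀ f → proj₁ a f ≡ proj₁ b f
    move-injective e a b false .false k l refl p f = p f
    move-injective e (s , i) (s′ , i′) true .true k l refl p f with f Finₚ.≟ e
    ... | no q = off f q
      where
      off : ∀ f → f ≢ e → s f ≡ s′ f
      off f q = trans (sym (update-off s e _ f q)) (trans (p f) (update-off s′ e _ f q))
    ... | yes refl = choose-injective s s′ e i i′ k l off
                       (trans (sym (update-at s e _)) (trans (p e) (update-at s′ e _)))
      where
      off : ∀ f → f ≢ e → s f ≡ s′ f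
      off f q = trans (sym (update-off s e _ f q)) (trans (p f) (update-off s′ e _ f q))

    run : List (Fin m) → Σ (States m) I → Σ (States m) I
    run []       a = a
    run (e ∷ es) a = run es (moveAt e a)

    run-injective : ∀ es a b → Same a b → (∀ f → proj₁ (run es a) f ≡ proj₁ (run es b) f) →
      ∀ f → proj₁ a f ≡ proj₁ b f
    run-injective []       a b same p = p
    run-injective (e ∷ es) a b same p =
      move-injective e a b _ _ refl refl (same e) (run-injective es _ _ (move-same e a b same) p)

    run-keep : ∀ es a f → kind (proj₁ a f) ≡ false → kind (proj₁ (run es a) f) ≡ false
    run-keep []       a f k = k
    run-keep (e ∷ es) a f k = run-keep es (moveAt e a) f k′
      where
      k′ : kind (proj₁ (moveAt e a) f) ≡ false
      k′ with move-kind e a _ refl f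
      ... | inj₁ (_ , q) = q
      ... | inj₂ q = trans (cong kind q) k

    run-kind : ∀ es a f → f ∈ₗ es → kind (proj₁ (run es a) f) ≡ false
    run-kind (e ∷ es) a f (here refl) = run-keep es _ f (move-at f a _ refl)
    run-kind (e ∷ es) a f (there q)   = run-kind es _ f q

  process : Σ (States m) I → Σ (States m) I
  process = run (allFin m)

  process-kind : ∀ a f → kind (proj₁ (process a) f) ≡ false
  process-kind a f = run-kind (allFin m) a f (∈-allFin f)

  process-injective : ∀ a b → (∀ f → kind (proj₁ a f) ≡ kind (proj₁ b f)) →
    (∀ f → proj₁ (process a) f ≡ proj₁ (process b) f) → ∀ f → proj₁ a f ≡ proj₁ b f
  process-injective = run-injective (allFin m)

-- Injective self-maps of finite sets.

iter : {A : Set} → (A → A) → ℕ → A → A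
iter f zero    a = a
iter f (suc k) a = f (iter f k a)

module Finite {A : Set} {m : ℕ} (key : A → Fin m → Bool) (f : A → A) where

  private
    toFin2 : Bool → Fin 2
    toFin2 false = fzero
    toFin2 true  = fsuc fzero

    toFin2-injective : ∀ {a b} → toFin2 a ≡ toFin2 b → a ≡ b
    toFin2-injective {false} {false} _ = refl
    toFin2-injective {true}  {true}  _ = refl

    code : A → Fin (2 ℕ.^ m)
    code a = Fin.funToFin (λ i → toFin2 (key a i))

    code-key : ∀ {a b} → code a ≡ code b → ∀ i → key a i ≡ key b i
    code-key {a} {b} p i = toFin2-injective
      (trans (sym (Finₚ.finToFun-funToFin (λ i → toFin2 (key a i)) i))
      (trans (cong (λ c → Fin.finToFun c i) p) (Finₚ.finToFun-funToFin (λ i → toFin2 (key b i)) i)))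

  -- Among `2 ^ m + 1` iterates two have the same key; writing the second index as `d + suc i`
  -- records that it is strictly larger.
  recurrence : ∀ a → Σ ℕ λ i → Σ ℕ λ d → ∀ e → key (iter f i a) e ≡ key (iter f (d ℕ.+ suc i) a) e
  recurrence a with Finₚ.pigeonhole ℕₚ.≤-refl (λ (i : Fin (suc (2 ℕ.^ m))) → code (iter f (Fin.toℕ i) a))
  ... | i , j , i<j , p = Fin.toℕ i , Fin.toℕ j ℕ.∸ suc (Fin.toℕ i) ,
    code-key (trans p (cong (λ k → code (iter f k a)) (sym (ℕₚ.m∸n+n≡m i<j))))

  -- Cancelling `i` applications of `f` in the recurrence leaves `a` equal in key to iterate number
  -- `d + 1`, so iterate number `d` is a preimage. Only keys are compared, because elements of `A`
  -- may also carry proofs.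
  injective⇒surjective : (∀ a b → (∀ e → key (f a) e ≡ key (f b) e) → ∀ e → key a e ≡ key b e) →
    ∀ a → Σ A λ b → ∀ e → key (f b) e ≡ key a e
  injective⇒surjective inj a with recurrence a
  ... | i , d , p = iter f d a , λ e → sym (cancel i (λ e → trans (p e)
          (cong (λ k → key (iter f k a) e) (trans (ℕₚ.+-suc d i) (ℕₚ.+-comm (suc d) i)))) e)
    where
    cancel : ∀ i → (∀ e → key (iter f i a) e ≡ key (iter f (i ℕ.+ suc d) a) e) →
      ∀ e → key a e ≡ key (iter f (suc d) a) e
    cancel zero    p = p
    cancel (suc i) p = cancel i (inj _ _ p)

-- Changing one entry of a compatible painting.

module _ {m : ℕ} (H : System m) where

  comp-mono : ∀ {s s′} → (∀ f z → Fit (s f) z → Fit (s′ f) z) → Comp H s′ → Comp H s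
  comp-mono p c v pos fit = c v pos (λ f → p f _ (fit f))

  comp-resp : ∀ {s s′} → (∀ f → s f ≡ s′ f) → Comp H s′ → Comp H s
  comp-resp p = comp-mono (λ f z → subst (λ t → Fit t z) (p f))

  comp? : ∀ s → Dec (Comp H s)
  comp? s with search H s
  ... | yes (v , pos , fit) = no (λ c → c v pos fit)
  ... | no ¬bad = yes (λ v pos fit → ¬bad (v , pos , fit))

  ¬comp : ∀ s → ¬ Comp H s → Σ (Vector m) λ v → Pos H v × Fits s (negv v)
  ¬comp s ¬c with search H s
  ... | yes bad = bad
  ... | no ¬bad = ⊥-elim (¬c (λ v pos fit → ¬bad (v , pos , fit)))

fit-update⁻ : ∀ {m} {s : States m} {e x z} → Fits (s [ e ≔ x ]) z →
    Fit x (z e) × (∀ f → f ≢ e → Fit (s f) (z f))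
fit-update⁻ {s = s} {e} {x} {z} p = subst (λ t → Fit t (z e)) (update-at s e x) (p e) ,
  λ f q → subst (λ t → Fit t (z f)) (update-off s e x f q) (p f)

fit-restore : ∀ {m} {s : States m} {e x z} → Fit (s e) (z e) → Fits (s [ e ≔ x ]) z → Fits s z
fit-restore {s = s} {e} p q f with f Finₚ.≟ e
... | yes refl = p
... | no r     = proj₂ (fit-update⁻ {s = s} q) f r

Fit-none : ∀ s z → Fit none z → Fit s z
Fit-none s z refl = Fit-0 s

dual-update : ∀ {m} (s : States m) e x f → dual ((s [ e ≔ x ]) f) ≡ ((λ g → dual (s g)) [ e ≔ dual x ]) f
dual-update s e x f with f Finₚ.≟ e
... | yes _ = refl
... | no _  = refl

update-mono : ∀ {m} (s s′ : States m) e x x′ → (∀ f → f ≢ e → s f ≡ s′ f) → (∀ z → Fit x z → Fit x′ z) →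
  ∀ f z → Fit ((s [ e ≔ x ]) f) z → Fit ((s′ [ e ≔ x′ ]) f) z
update-mono s s′ e x x′ off p f z q with f Finₚ.≟ e
... | yes _ = p z q
... | no r  = subst (λ t → Fit t z) (off f r) q

isDir isBi isUndir : State → Bool
isDir (dir _) = true
isDir _       = false
isBi bi = true
isBi _  = false
isUndir s = not (isDir s)

Fit-either : ∀ b c z → b ≢ c → Fit (dir b) z ⊎ Fit (dir c) z
Fit-either true  true  z n = ⊥-elim (n refl)
Fit-either false false z n = ⊥-elim (n refl)
Fit-either true  false (+ k) _ = inj₁ (ℤ.+≤+ ℕ.z≤n)
Fit-either true  false -[1+ k ] _ = inj₂ ℤ.-≤+
Fit-either false true  (+ k) _ = inj₂ (ℤ.+≤+ ℕ.z≤n)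
Fit-either false true  -[1+ k ] _ = inj₁ ℤ.-≤+

≢⇒not : ∀ b c → b ≢ c → c ≡ not b
≢⇒not true  true  n = ⊥-elim (n refl)
≢⇒not true  false n = refl
≢⇒not false true  n = refl
≢⇒not false false n = ⊥-elim (n refl)

-- Embedding the forests into the compatible orientations.

module Forests {m : ℕ} (H : System m) where

  private
    pointed₂ : ∀ {v w} → Pos H v → Pos H w → (∀ e → v e + w e ≡ 0ℤ) → ⊥
    pointed₂ {v} {w} pv pw p = let (e , ve) = Pos-nz H pv in
      ve (pointed H (cone-Pos pv) (cone-resp (λ f → sym (neg-unique (v f) (w f) (p f))) (cone-Pos pw)) e)

    unit-opp : ∀ {x y} → Unit x → Unit y → Fit (dir true) (- x) → Fit (dir false) (- y) → x ≢ 0ℤ → y ≢ 0ℤ →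
        x + y ≡ 0ℤ
    unit-opp u0 _ _ _ p _ = ⊥-elim (p refl)
    unit-opp (u± _) u0 _ _ _ q = ⊥-elim (q refl)
    unit-opp (u± true) (u± _) () _ _ _
    unit-opp (u± false) (u± true) _ _ _ _ = refl
    unit-opp (u± false) (u± false) _ (ℤ.+≤+ ()) _ _

    bad-at : ∀ (s : States m) e x {v} → s e ≡ none → Comp H s → Pos H v → Fits (s [ e ≔ x ]) (negv v) → v e ≢ 0ℤ
    bad-at s e x {v} se c pos fit ve =
      c v pos (fit-restore {s = s} (subst (λ t → Fit t (- v e)) (sym se) (neg-cong ve)) fit)

  -- If both directions fail, the two positive witnesses have opposite entries at `e`. Their sum is
  -- in the cone and vanishes at `e`; its opposite fits `s` and is in the cone as well. So the sum
  -- is zero and the witnesses are opposite to each other, which acyclicity forbids.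
  none→dir : ∀ (s : States m) e → s e ≡ none → Comp H s →
    ¬ Comp H (s [ e ≔ dir true ]) → Comp H (s [ e ≔ dir false ])
  none→dir s e se c ¬c w pw fw with ¬comp H _ ¬c
  ... | v , pv , fv with cone
    where
    sum≡0 : v e + w e ≡ 0ℤ
    sum≡0 = unit-opp (Pos-unit H pv e) (Pos-unit H pw e)
              (proj₁ (fit-update⁻ {s = s} {z = negv v} fv)) (proj₁ (fit-update⁻ {s = s} {z = negv w} fw))
              (bad-at s e _ se c pv fv) (bad-at s e _ se c pw fw)
    fit : Fits s (negv (v +v w))
    fit f with f Finₚ.≟ e
    ... | yes refl = subst (λ t → Fit t _) (sym se) (neg-cong sum≡0)
    ... | no q = subst (Fit (s f)) (sym (ℤₚ.neg-distrib-+ (v f) (w f)))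
                   (Fit-+ (s f) (proj₂ (fit-update⁻ {s = s} fv) f q) (proj₂ (fit-update⁻ {s = s} fw) f q))
    cone : Cone (Pos H) (negv (v +v w))
    cone = comp-cone H c (L-neg H (L-+ H (Pos-L H pv) (Pos-L H pw))) fit
  ... | cone = pointed₂ pv pw (pointed H (cone-+ (cone-Pos pv) (cone-Pos pw)) cone)

  private
    -- A `none` entry becomes `dir false` only when `dir true` is impossible, whereas under a `bi`
    -- entry both directions are possible. Given the other entries, the result `dir false` therefore
    -- reveals where it came from.
    orientAs : ∀ s e x → s e ≡ x → Comp H s → isUndir x ≡ true → Σ State λ y →
        isUndir y ≡ false × Comp H (s [ e ≔ y ])
    orientAs s e bi se c k = dir false , refl , comp-mono H mono c
      where
      mono : ∀ f z → Fit ((s [ e ≔ dir false ]) f) z → Fit (s f) z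
      mono f z p with f Finₚ.≟ e
      ... | yes refl = subst (λ t → Fit t z) (sym se) tt
      ... | no _ = p
    orientAs s e none se c k with comp? H (s [ e ≔ dir true ])
    ... | yes c′ = dir true , refl , c′
    ... | no ¬c′ = dir false , refl , none→dir s e se c ¬c′

    orient-none : ∀ s e se c k → proj₁ (orientAs s e none se c k) ≡ dir false → ¬ Comp H (s [ e ≔ dir true ])
    orient-none s e se c k q with comp? H (s [ e ≔ dir true ])
    orient-none s e se c k () | yes _
    ... | no ¬c = ¬c

    absurd : ∀ s s′ e → Comp H s → s e ≡ bi → (∀ f → f ≢ e → s f ≡ s′ f) → ¬ Comp H (s′ [ e ≔ dir true ]) → ⊥
    absurd s s′ e c se off ¬c = ¬c (comp-mono H mono c)
      where
      mono : ∀ f z → Fit ((s′ [ e ≔ dir true ]) f) z → Fit (s f) z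
      mono f z p with f Finₚ.≟ e
      ... | yes refl = subst (λ t → Fit t z) (sym se) tt
      ... | no q = subst (λ t → Fit t z) (sym (off f q)) p

    orient : ∀ s e → Comp H s → isUndir (s e) ≡ true → Σ State λ x → isUndir x ≡ false × Comp H (s [ e ≔ x ])
    orient s e = orientAs s e (s e) refl

    orient-injective : ∀ s s′ e c c′ k k′ → (∀ f → f ≢ e → s f ≡ s′ f) →
      proj₁ (orient s e c k) ≡ proj₁ (orient s′ e c′ k′) → s e ≡ s′ e
    orient-injective s s′ e c c′ k k′ off = go (s e) (s′ e) refl refl k k′
      where
      go : ∀ x y (q : s e ≡ x) (r : s′ e ≡ y) k k′ →
        proj₁ (orientAs s e x q c k) ≡ proj₁ (orientAs s′ e y r c′ k′) → x ≡ y
      go bi   bi   q r k k′ p = refl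
      go none none q r k k′ p = refl
      go bi   none q r k k′ p = ⊥-elim (absurd s s′ e c q off (orient-none s′ e r c′ k′ (sym p)))
      go none bi   q r k k′ p = ⊥-elim (absurd s′ s e c′ r (λ f n → sym (off f n)) (orient-none s e q c k p))
      go (dir b) _ q r () k′ p
      go bi (dir b) q r k () p
      go none (dir b) q r k () p

    module P = Process isUndir (Comp H) orient orient-injective

    contracted : (Fin m → Bool) → States m
    contracted F e = if F e then bi else none

    contracted-injective : ∀ F F′ → (∀ e → contracted F e ≡ contracted F′ e) → ∀ e → F e ≡ F′ e
    contracted-injective F F′ p e with F e | F′ e | p e
    ... | true  | true  | _ = refl
    ... | false | false | _ = refl

    -- A positive vector whose opposite fits is supported on `F`, where independence leaves only
    -- zero.
    contracted-comp : ∀ F → Indep H F → Comp H (contracted F)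
    contracted-comp F ind v pos fit = let (e , ve) = Pos-nz H pos in ve (ind v (Pos-L H pos) off e)
      where
      off : ∀ f → F f ≡ false → v f ≡ 0ℤ
      off f Ff = trans (sym (ℤₚ.neg-involutive (v f)))
          (neg-cong (subst (λ t → Fit t (- v f)) (cong (λ b → if b then bi else none) Ff) (fit f)))

    isTrue : State → Bool
    isTrue (dir b) = b
    isTrue _       = false

    dir-isTrue : ∀ s → isUndir s ≡ false → s ≡ dir (isTrue s)
    dir-isTrue (dir b) _ = refl

    final : ∀ F → Indep H F → Σ (States m) (Comp H)
    final F ind = P.process (contracted F , contracted-comp F ind)

  -- It is not claimed to invert φ; it only supplies an injection in the direction opposite to φ.
  orientForest : ∀ F → Indep H F → Fin m → Bool
  orientForest F ind e = isTrue (proj₁ (final F ind) e)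

  private
    final-dir : ∀ F ind e → proj₁ (final F ind) e ≡ dir (orientForest F ind e)
    final-dir F ind e = dir-isTrue _ (P.process-kind (contracted F , contracted-comp F ind) e)

  orientForest-comp : ∀ F ind → Comp H (λ e → dir (orientForest F ind e))
  orientForest-comp F ind = comp-resp H (λ e → sym (final-dir F ind e)) (proj₂ (final F ind))

  orientForest-injective : ∀ F F′ ind ind′ → (∀ e → orientForest F ind e ≡ orientForest F′ ind′ e) → ∀ e →
      F e ≡ F′ e
  orientForest-injective F F′ ind ind′ p = contracted-injective F F′ (P.process-injective _ _ same
    (λ e → trans (final-dir F ind e) (trans (cong dir (p e)) (sym (final-dir F′ ind′ e)))))
    where
    undir : ∀ F e → isUndir (contracted F e) ≡ true
    undir F e with F e
    ... | true  = refl
    ... | false = refl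
    same : ∀ e → isUndir (contracted F e) ≡ isUndir (contracted F′ e)
    same e = trans (undir F e) (sym (undir F′ e))

-- Existence: trees for orientations and orientations for forests.

module Duality {m : ℕ} {H H* : System m} (D : DualPair H H*) where
  open Trees H H*

  dot-terms : ∀ {z w} → L H z → L H* w → (∀ e → 0ℤ ℤ.≤ z e * w e) → ∀ e → z e * w e ≡ 0ℤ
  dot-terms lz lw p = sum-zero _ p (orth D lz lw)

  Pos-L-neg : ∀ (K : System m) {v} → Pos K v → L K (negv v)
  Pos-L-neg K p = L-neg K (Pos-L K p)

  -- With all entries `dir` this is compatibility with both signatures; with no entry `dir` it makes
  -- the `bi` edges a spanning tree.
  OK : States m → Set
  OK s = Comp H s × Comp H* (λ f → dual (s f))

  private
    -- At `e` the vector `negv v` must run against `b`, since otherwise it would fit `s` and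
    -- contradict `Comp K s`.
    avoid : ∀ (K : System m) s e b {v} → s e ≡ dir b → Comp K s → Pos K v → Fits (s [ e ≔ bi ]) (negv v) →
      Fit (dir (not b)) (- v e) × - v e ≢ 0ℤ
    avoid K s e b {v} se c pos fit = dir-not , λ z → wrong (subst (Fit (dir b)) (sym z) (Fit-0 (dir b)))
      where
      wrong : ¬ Fit (dir b) (- v e)
      wrong p = c v pos (fit-restore {s = s} (subst (λ t → Fit t (- v e)) (sym se) p) fit)
      dir-not : Fit (dir (not b)) (- v e)
      dir-not with Fit-either b (not b) (- v e) (Boolₚ.not-¬ refl)
      ... | inj₁ p = ⊥-elim (wrong p)
      ... | inj₂ p = p

    -- The two witnesses against this would have an inner product with a single
    -- nonzero term, at e.
    bi-or-none : ∀ s e b → s e ≡ dir b → OK s →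
      ¬ Comp H (s [ e ≔ bi ]) → ¬ Comp H* ((λ f → dual (s f)) [ e ≔ bi ]) → ⊥
    bi-or-none s e b se (c , c*) ¬c ¬c* with ¬comp H _ ¬c | ¬comp H* _ ¬c*
    ... | v , pv , fv | w , pw , fw with avoid H s e b se c pv fv | avoid H* _ e b (cong dual se) c* pw fw
    ...   | dv , vnz | dw , wnz = *-≢0 vnz wnz (dot-terms (Pos-L-neg H pv) (Pos-L-neg H* pw) nonneg e)
      where
      nonneg : ∀ f → 0ℤ ℤ.≤ - v f * - w f
      nonneg f with f Finₚ.≟ e
      ... | yes refl = Fit-prod (dir (not b)) dv dw
      ... | no q = Fit-prod (s f) (proj₂ (fit-update⁻ {s = s} fv) f q)
            (proj₂ (fit-update⁻ {s = λ g → dual (s g)} fw) f q)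

    bi-OK : ∀ s e b → s e ≡ dir b → OK s → Comp H (s [ e ≔ bi ]) → OK (s [ e ≔ bi ])
    bi-OK s e b se (_ , c*) c = c , comp-mono H* mono c*
      where
      mono : ∀ f z → Fit (dual ((s [ e ≔ bi ]) f)) z → Fit (dual (s f)) z
      mono f z p with f Finₚ.≟ e
      ... | yes refl = Fit-none _ z p
      ... | no _ = p

    none-OK : ∀ s e b → s e ≡ dir b → OK s → Comp H* ((λ f → dual (s f)) [ e ≔ bi ]) → OK (s [ e ≔ none ])
    none-OK s e b se (c , _) c* = comp-mono H mono c , comp-resp H* (dual-update s e none) c*
      where
      mono : ∀ f z → Fit ((s [ e ≔ none ]) f) z → Fit (s f) z
      mono f z p with f Finₚ.≟ e
      ... | yes refl = Fit-none _ z p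
      ... | no _ = p

    -- When both replacements are possible the direction decides, which makes the choice injective.
    chooseDir : ∀ s e x → s e ≡ x → OK s → isDir x ≡ true → Σ State λ y → isDir y ≡ false × OK (s [ e ≔ y ])
    chooseDir s e (dir b) se ok k with comp? H (s [ e ≔ bi ]) | comp? H* ((λ f → dual (s f)) [ e ≔ bi ])
    ... | yes p | no _  = bi , refl , bi-OK s e b se ok p
    ... | no _  | yes q = none , refl , none-OK s e b se ok q
    ... | no ¬p | no ¬q = ⊥-elim (bi-or-none s e b se ok ¬p ¬q)
    chooseDir s e (dir true) se ok k | yes p | yes q = bi , refl , bi-OK s e true se ok p
    chooseDir s e (dir false) se ok k | yes p | yes q = none , refl , none-OK s e false se ok q

    -- An integer at `e` fits at least one of two opposite directions, so a witness against freeing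
    -- `e` contradicts one of the two paintings.
    combine : ∀ (K : System m) s s′ e b b′ → b ≢ b′ → s e ≡ dir b → s′ e ≡ dir b′ → (∀ f → f ≢ e → s f ≡ s′ f) →
      Comp K s → Comp K s′ → Comp K (s [ e ≔ bi ])
    combine K s s′ e b b′ n se se′ off c c′ v pos fit with Fit-either b b′ (- v e) n
    ... | inj₁ p = c v pos (fit-restore {s = s} (subst (λ t → Fit t (- v e)) (sym se) p) fit)
    ... | inj₂ p = c′ v pos (fit-restore {s = s′} (subst (λ t → Fit t (- v e)) (sym se′) p)
                     (λ f → update-mono s s′ e bi bi off (λ _ t → t) f (- v f) (fit f)))

    -- If the directions differ, both replacements are possible in both paintings by `combine`, used
    -- for either system; in that case the choice depends on the direction and takes different
    -- values.
    chooseDir-injective : ∀ s s′ e x x′ p p′ ok ok′ k k′ → (∀ f → f ≢ e → s f ≡ s′ f) →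
      proj₁ (chooseDir s e x p ok k) ≡ proj₁ (chooseDir s′ e x′ p′ ok′ k′) → x ≡ x′
    chooseDir-injective s s′ e (dir b) (dir b′) p p′ ok ok′ k k′ off q with b Boolₚ.≟ b′
    ... | yes r = cong dir r
    ... | no n = ⊥-elim (differ b b′ n p p′ k k′ q)
      where
      c : Comp H (s [ e ≔ bi ])
      c = combine H s s′ e b b′ n p p′ off (proj₁ ok) (proj₁ ok′)
      c* : Comp H* ((λ f → dual (s f)) [ e ≔ bi ])
      c* = combine H* _ _ e b b′ n (cong dual p) (cong dual p′) (λ f r → cong dual (off f r)) (proj₂ ok)
          (proj₂ ok′)
      c′ : Comp H (s′ [ e ≔ bi ])
      c′ = comp-mono H (update-mono s′ s e bi bi (λ f r → sym (off f r)) (λ _ t → t)) c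
      c*′ : Comp H* ((λ f → dual (s′ f)) [ e ≔ bi ])
      c*′ = comp-mono H* (update-mono _ _ e bi bi (λ f r → cong dual (sym (off f r))) (λ _ t → t)) c*
      chosen : ∀ s b p ok k → Comp H (s [ e ≔ bi ]) → Comp H* ((λ f → dual (s f)) [ e ≔ bi ]) →
        proj₁ (chooseDir s e (dir b) p ok k) ≡ (if b then bi else none)
      chosen s b p ok k c c* with comp? H (s [ e ≔ bi ]) | comp? H* ((λ f → dual (s f)) [ e ≔ bi ])
      chosen s b p ok k c c* | no ¬c | _ = ⊥-elim (¬c c)
      chosen s b p ok k c c* | yes _ | no ¬c = ⊥-elim (¬c c*)
      chosen s true p ok k c c* | yes _ | yes _ = refl
      chosen s false p ok k c c* | yes _ | yes _ = refl
      ite : ∀ b b′ → (if b then bi else none) ≡ (if b′ then bi else none) → b ≡ b′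
      ite true true _ = refl
      ite false false _ = refl
      differ : ∀ b b′ → b ≢ b′ → ∀ p p′ k k′ →
        proj₁ (chooseDir s e (dir b) p ok k) ≡ proj₁ (chooseDir s′ e (dir b′) p′ ok′ k′) → ⊥
      differ b b′ n p p′ k k′ q = n (ite b b′ (trans (sym (chosen s b p ok k c c*))
          (trans q (chosen s′ b′ p′ ok′ k′ c′ c*′))))

    module P = Process isDir OK (λ s e → chooseDir s e (s e) refl)
      (λ s s′ e ok ok′ k k′ off → chooseDir-injective s s′ e (s e) (s′ e) refl refl ok ok′ k k′ off)

  -- Paint `T` free, `e` directed and all else deleted. The dual alternative would be a nonzero
  -- vector of `K*` vanishing on `T`, which independence forbids; so `K` has a vector supported on
  -- `T` and `e` and nonzero at `e`.
  fundamental : ∀ (K K* : System m) → DualPair K K* → ∀ T → Indep K T → Indep K* (λ e → not (T e)) →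
    ∀ e → T e ≡ false → Σ Bool (Fund K T e)
  fundamental K K* D T ind ind* e Te with minty D (painting [ e ≔ dir true ]) e true (update-at painting e _)
    where
    painting : States m
    painting f = if T f then bi else none
  ... | inj₂ (w , lw , fit , we) = ⊥-elim (we (ind* w lw off e))
    where
    off : ∀ f → not (T f) ≡ false → w f ≡ 0ℤ
    off f p with f Finₚ.≟ e | fit f
    ... | yes refl | q = case (trans (sym (not-≡-false p)) Te)
      where
      case : true ≡ false → _
      case ()
    ... | no _ | q with T f
    ...   | true = q
  ... | inj₁ (z , lz , fit , ze) with extract K lz e ze
  ...   | v , pv , conf = result (v e) refl (conf-unit (conf e)) pv
    where
    off-z : ∀ f → T f ≡ false → f ≢ e → z f ≡ 0ℤ
    off-z f Tf q with f Finₚ.≟ e | fit f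
    ... | yes p | _ = ⊥-elim (q p)
    ... | no _ | r rewrite Tf = r
    off : ∀ f → T f ≡ false → f ≢ e → v f ≡ 0ℤ
    off f Tf q with v f ℤ.≟ 0ℤ
    ... | yes p = p
    ... | no p = ⊥-elim (conf-≢0 (conf f) p (off-z f Tf q))
    ve≢0 : v e ≢ 0ℤ
    -- Extraction does not promise a nonzero entry at `e`; it follows because a vector supported on
    -- `T` alone is zero.
    ve≢0 p = let (f , vf) = Pos-nz′ K pv in vf (ind v (Pos-L′ K pv) off′ f)
      where
      off′ : ∀ f → T f ≡ false → v f ≡ 0ℤ
      off′ f Tf with f Finₚ.≟ e
      ... | yes refl = p
      ... | no q = off f Tf q
    result : ∀ x → v e ≡ x → Unit x → Pos K v ⊎ Pos K (negv v) → Σ Bool (Fund K T e)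
    result _ p u0 _ = ⊥-elim (ve≢0 p)
    result _ p (u± b) (inj₁ pos) = b , v , pos , p , off
    result _ p (u± b) (inj₂ pos) =
      not b , negv v , pos , trans (neg-cong p) (sym (sgn-not b)) , λ f Tf q → neg-cong (off f Tf q)

  tree-of-base : ∀ {T} → Base T → Σ (Fin m → Bool) (Tree T)
  tree-of-base {T} B = (λ e → proj₁ (orientation e)) , record
    { base = B
    ; ori  = λ e → proj₁ (proj₂ (orientation e))
    ; ori* = λ e p → proj₂ (proj₂ (orientation e)) (not-≡-false p) }
    where
    T* : Fin m → Bool
    T* e = not (T e)
    orientation : ∀ e → Σ Bool λ b → (T e ≡ false → Fund H T e b) × (T e ≡ true → Fund H* T* e b)
    orientation e with T e in Te
    ... | false = let (b , φ) = fundamental H H* D T (ind B) (ind* B) e Te in b , (λ _ → φ) , λ ()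
    ... | true  = let (b , φ) = fundamental H* H (swapPair D) T* (ind* B)
                        (λ z l off → ind B z l (λ f Tf → off f (trans (Boolₚ.not-involutive (T f)) Tf))) e
                            (cong not Te)
                  in b , (λ ()) , λ _ → φ

  -- If the opposite of a positive vector ran along `O`, it would lie in the cone by `tree-cone`,
  -- against acyclicity.
  tree-OK : ∀ {T O} → Tree T O → OK (λ e → dir (O e))
  tree-OK t =
    (λ v p fit → let (e , ve) = Pos-nz H p in ve (pointed H (cone-Pos p)
      (tree-cone H (ind (base t)) (ori t) (Pos-L-neg H p) (λ f _ → fit f)) e)) ,
    (λ v p fit → let (e , ve) = Pos-nz H* p in ve (pointed H* (cone-Pos p)
      (tree-cone H* (ind* (base t)) (ori* t) (Pos-L-neg H* p) (λ f _ → fit f)) e))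

  -- Orientations compatible with both signatures embed into the trees by Process, and trees embed
  -- back by T ↦ O_T; the composite is an injection of a finite set into itself.
  private
    A : Set
    A = Σ (Fin m → Bool) λ O → OK (λ e → dir (O e))

    states : A → Σ (States m) OK
    states (O , ok) = P.process ((λ e → dir (O e)) , ok)

    treeOf : A → Fin m → Bool
    treeOf a e = isBi (proj₁ (states a) e)

    -- Every entry is now `bi` or `none`, so `comp-indep` turns the two compatibilities of the final
    -- painting into independence of the `bi` edges and of the `none` edges.
    treeOf-base : ∀ a → Base (treeOf a)
    treeOf-base (O , ok) = record
      { ind  = comp-indep H (proj₁ (proj₂ (states (O , ok)))) (λ e → bi-only (proj₁ (states (O , ok)) e))
      ; ind* = comp-indep H* (proj₂ (proj₂ (states (O , ok)))) (λ e → none-only (proj₁ (states (O , ok)) e)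
                 (P.process-kind ((λ e → dir (O e)) , ok) e)) }
      where
      bi-only : ∀ s → isBi s ≡ true → s ≡ bi
      bi-only bi _ = refl
      none-only : ∀ s → isDir s ≡ false → not (isBi s) ≡ true → dual s ≡ bi
      none-only none _ _ = refl

    treeOf-injective : ∀ a b → (∀ e → treeOf a e ≡ treeOf b e) → ∀ e → proj₁ a e ≡ proj₁ b e
    treeOf-injective (O , ok) (O′ , ok′) p e = dir-injective (P.process-injective _ _ (λ _ → refl) same e)
      where
      dir-injective : ∀ {a b} → dir a ≡ dir b → a ≡ b
      dir-injective refl = refl
      undir : ∀ s s′ → isDir s ≡ false → isDir s′ ≡ false → isBi s ≡ isBi s′ → s ≡ s′
      undir bi bi _ _ _ = refl
      undir none none _ _ _ = refl
      same : ∀ f → proj₁ (states (O , ok)) f ≡ proj₁ (states (O′ , ok′)) f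
      same f = undir _ _ (P.process-kind _ f) (P.process-kind _ f) (p f)

    reorient : A → A
    reorient a = let (O , t) = tree-of-base (treeOf-base a) in O , tree-OK t

    reorient-injective : ∀ a b → (∀ e → proj₁ (reorient a) e ≡ proj₁ (reorient b) e) → ∀ e →
        proj₁ a e ≡ proj₁ b e
    reorient-injective a b p = treeOf-injective a b
      (tree-injective D (proj₂ (tree-of-base (treeOf-base a))) (proj₂ (tree-of-base (treeOf-base b)))
          (λ e _ → p e))

  -- The tree is `treeOf` of a preimage of `O` under `reorient`, not `treeOf` of `O` itself.
  OK-tree : ∀ O → OK (λ e → dir (O e)) → Σ (Fin m → Bool) λ T → Tree T O
  OK-tree O ok = tree (Finite.injective⇒surjective proj₁ reorient reorient-injective (O , ok))
    where
    tree : (Σ A λ b → ∀ e → proj₁ (reorient b) e ≡ O e) → Σ (Fin m → Bool) λ T → Tree T O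
    tree (b , p) = treeOf b , tree-resp p (proj₂ (tree-of-base (treeOf-base b)))
  private
    -- Since `- x` points along `o`, the coordinate `β o + x` is again 0 or 1.
    flip : ∀ x → Unit x → ∀ o → Fit (dir o) (- x) →
      Σ Bool λ o′ → β o′ - β o ≡ x × Fit (dir o′) x × (x ≡ 0ℤ → o′ ≡ o)
    flip _ u0 o _ = o , ℤₚ.+-inverseʳ (β o) , Fit-0 (dir o) , λ _ → refl
    flip _ (u± true)  true  ()
    flip _ (u± true)  false _ = true , refl , Fit-sgn true , λ ()
    flip _ (u± false) true  _ = false , refl , Fit-sgn false , λ ()
    flip _ (u± false) false (ℤ.+≤+ ())

    Directed : Set
    Directed = Σ (Fin m → Bool) λ O → Comp H (λ e → dir (O e))

    Bad : Directed → Set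
    Bad (O , _) = Σ (Vector m) λ v → Pos H* v × Fits (λ e → dir (O e)) (negv v)

    -- Edges of directed cocycles lie on no directed cycle, so reversing the former does not create
    -- any of the latter.
    reverseBad : (a : Directed) → Bad a → Directed
    reverseBad (O , c) (v , pv , fit) = (λ e → proj₁ (flipped e)) , comp
      where
      flipped : ∀ e → _
      flipped e = flip (v e) (Pos-unit H* pv e) (O e) (fit e)
      comp : Comp H (λ e → dir (proj₁ (flipped e)))
      comp w pw fw = c w pw fit′
        where
        fit′ : ∀ e → Fit (dir (O e)) (- w e)
        fit′ e with ℤₚ.i*j≡0⇒i≡0∨j≡0 (- w e) (dot-terms (Pos-L-neg H pw) (Pos-L H* pv)
                      (λ f → Fit-prod (dir (proj₁ (flipped f))) (fw f) (proj₁ (proj₂ (proj₂ (flipped f))))) e)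
        ... | inj₁ p = subst (Fit (dir (O e))) (sym p) (Fit-0 (dir (O e)))
        ... | inj₂ p = subst (λ o → Fit (dir o) (- w e)) (proj₂ (proj₂ (proj₂ (flipped e))) p) (fw e)

    reverseDec : (a : Directed) → Dec (Bad a) → Directed
    reverseDec a (yes bad) = reverseBad a bad
    reverseDec a (no _)    = a

    reverse : Directed → Directed
    reverse a = reverseDec a (search H* _)

    change : Directed → Directed → Vector m
    change a b = βv (proj₁ b) -v βv (proj₁ a)

    reverse-cone : ∀ a d → Cone (Pos H*) (change a (reverseDec a d))
    reverse-cone a (no _) = nil (λ e → ℤₚ.+-inverseʳ (βv (proj₁ a) e))
    reverse-cone (O , c) (yes (v , pv , fit)) =
      cone-resp (λ e → proj₁ (proj₂ (flip (v e) (Pos-unit H* pv e) (O e) (fit e)))) (cone-Pos pv)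

    reverse-fixed : ∀ a d → (∀ e → change a (reverseDec a d) e ≡ 0ℤ) → Comp H* (λ e → dir (proj₁ a e))
    reverse-fixed a (no ¬bad) _ v pv fit = ¬bad (v , pv , fit)
    reverse-fixed (O , c) (yes (v , pv , fit)) p = let (e , ve) = Pos-nz H* pv in
      ⊥-elim (ve (trans (sym (proj₁ (proj₂ (flip (v e) (Pos-unit H* pv e) (O e) (fit e))))) (p e)))

    telescope : ∀ x y z → z - x ≡ (z - y) + (y - x)
    telescope = solve-∀

    iter-cone : ∀ a k i → Cone (Pos H*) (change (iter reverse i a) (iter reverse (k ℕ.+ i) a))
    iter-cone a zero    i = nil (λ e → ℤₚ.+-inverseʳ (βv (proj₁ (iter reverse i a)) e))
    iter-cone a (suc k) i = cone-resp (λ e → telescope (βv (proj₁ (iter reverse i a)) e)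
        (βv (proj₁ (iter reverse (k ℕ.+ i) a)) e)
        (βv (proj₁ (iter reverse (suc k ℕ.+ i) a)) e))
      (cone-+ (reverse-cone (iter reverse (k ℕ.+ i) a) (search H* _)) (iter-cone a k i))

  -- No termination measure is needed. Each reversal adds a positive vector. Once an orientation
  -- recurs, one step of the loop and the rest of the loop are opposite vectors of the cone, so the
  -- step was trivial and nothing was left to reverse.
  reversal-OK : ∀ O → Comp H (λ e → dir (O e)) →
    Σ (Fin m → Bool) λ O′ → OK (λ e → dir (O′ e)) × L H* (βv O′ -v βv O)
  reversal-OK O c with Finite.recurrence proj₁ reverse (O , c)
  ... | i , d , p = proj₁ b , (proj₂ b , reverse-fixed b (search H* _) fixed) ,
      subst (λ k → L H* (change (O , c) (iter reverse k (O , c)))) (ℕₚ.+-identityʳ i)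
          (cone-L H* (iter-cone (O , c) i 0))
    where
    b b′ : Directed
    b  = iter reverse i (O , c)
    b′ = iter reverse (d ℕ.+ suc i) (O , c)
    swap- : ∀ x y → x - y ≡ - (y - x)
    swap- = solve-∀
    fixed : ∀ e → change b (reverse b) e ≡ 0ℤ
    fixed = pointed H* (reverse-cone b (search H* _))
      (cone-resp (λ e → trans (sym (swap- (β (proj₁ b e)) (βv (proj₁ (reverse b)) e)))
                              (cong (λ o → β o - βv (proj₁ (reverse b)) e) (p e)))
        (iter-cone (O , c) d (suc i)))

  orientation-tree : ∀ O → Comp H (λ e → dir (O e)) →
    Σ (Fin m → Bool) λ T → Σ (Fin m → Bool) λ P → Tree T P × L H* (βv P -v βv O)
  orientation-tree O c =
    let (P , ok , l) = reversal-OK O c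
        (T , t) = OK-tree P ok
    in T , P , t , l

  private
    open Forests H

    Forest : Set
    Forest = Σ (Fin m → Bool) (Indep H)

    Image : Forest → Set
    Image (F , ind) = Σ (Fin m → Bool) λ T → Σ (Fin m → Bool) λ P →
      Tree T P × L H* (βv P -v βv (orientForest F ind))

    image : ∀ F → Image F
    image (F , ind) = orientation-tree (orientForest F ind) (orientForest-comp F ind)

    -- The generating set in Boolean form: the tree edges on which tree direction and orientation
    -- agree.
    fixedEdges : ∀ F → Image F → Fin m → Bool
    fixedEdges (F , ind) (T , P , _) e = T e ∧ not (P e xor orientForest F ind e)

    fixed⁺ : ∀ t p o → t ≡ true → p ≡ o → t ∧ not (p xor o) ≡ true
    fixed⁺ true true  true  _ _ = refl
    fixed⁺ true false false _ _ = refl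

    fixed⁻ : ∀ t p o → t ∧ not (p xor o) ≡ true → t ≡ true × p ≡ o
    fixed⁻ true true  true  _ = refl , refl
    fixed⁻ true false false _ = refl , refl

    fixed-indep : ∀ F i → Indep H (fixedEdges F i)
    fixed-indep (F , ind′) (T , P , t , _) z l off = ind (base t) z l (λ e Te → off e (cong (λ b → b ∧ _) Te))

    toForest : Forest → Forest
    toForest F = fixedEdges F (image F) , fixed-indep F (image F)

    toForest-injective : ∀ F F′ (i : Image F) (i′ : Image F′) → (∀ e → fixedEdges F i e ≡ fixedEdges F′ i′ e) →
      ∀ e → proj₁ F e ≡ proj₁ F′ e
    toForest-injective (F , ind) (F′ , ind′) (T , P , t , l) (T′ , P′ , t′ , l′) p =
      orientForest-injective F F′ ind ind′ (forest-injective D t t′ l l′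
        (λ e Te Pe → fixed⁻ _ _ _ (trans (sym (p e)) (fixed⁺ _ _ _ Te Pe)))
        (λ e Te Pe → fixed⁻ _ _ _ (trans (p e) (fixed⁺ _ _ _ Te Pe))))

  Preimage : (Fin m → Bool) → Set
  Preimage F = Σ (Fin m → Bool) λ O → Comp H (λ e → dir (O e)) ×
    Σ (Fin m → Bool) λ T → Σ (Fin m → Bool) λ P → Tree T P × L H* (βv P -v βv O) ×
    (∀ e → F e ≡ true → T e ≡ true × P e ≡ O e) × (∀ e → T e ≡ true → P e ≡ O e → F e ≡ true)

  -- Sending a forest to the generating set of its orientation is an injective self-map of the
  -- finite set of forests, hence onto.
  forest-surjective : ∀ F → Indep H F → Preimage F
  forest-surjective F ind = result (Finite.injective⇒surjective proj₁ toForest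
      (λ a b → toForest-injective a b (image a) (image b)) (F , ind))
    where
    unpack : ∀ G (i : Image G) → (∀ e → fixedEdges G i e ≡ F e) → Preimage F
    unpack (G , ind′) (T , P , t , l) p = orientForest G ind′ , orientForest-comp G ind′ , T , P , t , l ,
      (λ e Fe → fixed⁻ (T e) (P e) _ (trans (p e) Fe)) ,
      (λ e Te Pe → trans (sym (p e)) (fixed⁺ _ _ _ Te Pe))
    result : (Σ Forest λ G → ∀ e → proj₁ (toForest G) e ≡ F e) → Preimage F
    result (G , p) = unpack G (image G) p

-- Finite sums.

sum-const0 : ∀ {k} (f : Fin k → ℤ) → (∀ i → f i ≡ 0ℤ) → sum f ≡ 0ℤ
sum-const0 {zero}  f p = refl
sum-const0 {suc k} f p = cong₂ _+_ (p fzero) (sum-const0 (λ i → f (fsuc i)) (λ i → p (fsuc i)))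

sum-single : ∀ {k} (f : Fin k → ℤ) i → (∀ j → j ≢ i → f j ≡ 0ℤ) → sum f ≡ f i
sum-single {suc k} f fzero p =
  trans (cong (_+_ (f fzero)) (sum-const0 _ (λ j → p (fsuc j) (λ ())))) (ℤₚ.+-identityʳ _)
sum-single {suc k} f (fsuc i) p =
  trans (cong (_+ sum (λ j → f (fsuc j))) (p fzero (λ ())))
  (trans (ℤₚ.+-identityˡ _) (sum-single (λ j → f (fsuc j)) i
      (λ j q → p (fsuc j) (λ r → q (Finₚ.suc-injective r)))))

δᵢⱼ : ∀ {k} → Fin k → Fin k → ℤ
δᵢⱼ i j with i Finₚ.≟ j
... | yes _ = +1ℤ
... | no _  = 0ℤ

δᵢⱼ-same : ∀ {k} {i j : Fin k} → i ≡ j → δᵢⱼ i j ≡ +1ℤ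
δᵢⱼ-same {i = i} {j} p with i Finₚ.≟ j
... | yes _ = refl
... | no q  = ⊥-elim (q p)

δᵢⱼ-diff : ∀ {k} {i j : Fin k} → i ≢ j → δᵢⱼ i j ≡ 0ℤ
δᵢⱼ-diff {i = i} {j} p with i Finₚ.≟ j
... | yes q = ⊥-elim (p q)
... | no _  = refl

*-δ-same : ∀ {k} {i j : Fin k} x → i ≡ j → x * δᵢⱼ i j ≡ x
*-δ-same x p = trans (cong (x *_) (δᵢⱼ-same p)) (ℤₚ.*-identityʳ x)

*-δ-diff : ∀ {k} {i j : Fin k} x → i ≢ j → x * δᵢⱼ i j ≡ 0ℤ
*-δ-diff x p = trans (cong (x *_) (δᵢⱼ-diff p)) (ℤₚ.*-zeroʳ x)

sum-minus : ∀ {k} (f g : Fin k → ℤ) → sum f - sum g ≡ sum (λ x → f x - g x)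
sum-minus f g = trans (cong (_+_ (sum f)) (sym (sum-neg g))) (sym (∑-distrib-+ f (λ x → - g x)))
  where
  sum-neg : ∀ {k} (g : Fin k → ℤ) → sum (λ x → - g x) ≡ - sum g
  sum-neg {zero}  g = refl
  sum-neg {suc k} g = trans (cong (_+_ (- g fzero)) (sum-neg (λ i → g (fsuc i))))
      (sym (ℤₚ.neg-distrib-+ (g fzero) _))

-- Each term is written as a sum of Kronecker deltas and the order of summation exchanged;
-- injectivity of `ι` leaves at most one index for each position.
sum-reindex : ∀ {k l} (ι : Fin k → Fin l) → (∀ i j → ι i ≡ ι j → i ≡ j) → (f : Fin l → ℤ) →
  (∀ e → (∀ i → ι i ≢ e) → f e ≡ 0ℤ) → sum f ≡ sum (λ i → f (ι i))
sum-reindex {k} {l} ι inj f off = begin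
  sum f                                             ≡⟨ sum-cong-≗ expand ⟩
  sum (λ e → sum (λ i → f (ι i) * δᵢⱼ (ι i) e))     ≡⟨ ∑-comm (λ e i → f (ι i) * δᵢⱼ (ι i) e) ⟩
  sum (λ i → sum (λ e → f (ι i) * δᵢⱼ (ι i) e))     ≡⟨ sum-cong-≗ collapse ⟩
  sum (λ i → f (ι i))                               ∎
  where
  open ≡-Reasoning
  collapse : ∀ i → sum (λ e → f (ι i) * δᵢⱼ (ι i) e) ≡ f (ι i)
  collapse i = trans (sum-single _ (ι i) (λ e q → *-δ-diff (f (ι i)) (λ r → q (sym r))))
      (*-δ-same (f (ι i)) refl)
  expand : ∀ e → f e ≡ sum (λ i → f (ι i) * δᵢⱼ (ι i) e)
  expand e with Finₚ.any? (λ i → ι i Finₚ.≟ e)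
  ... | yes (i , refl) = sym (trans
          (sum-single _ i (λ j q → *-δ-diff (f (ι j)) (λ r → q (inj j i r)))) (*-δ-same (f (ι i)) refl))
  ... | no n = trans (off e (λ i p → n (i , p))) (sym
        (sum-const0 _ (λ i → *-δ-diff (f (ι i)) (λ p → n (i , p)))))

sum-telescope : ∀ len (f g : Fin (suc len) → ℤ) → (∀ i → f (Fin.inject₁ i) ≡ g (fsuc i)) →
  sum (λ i → f i - g i) ≡ f (Fin.fromℕ len) - g fzero
sum-telescope zero f g p = ℤₚ.+-identityʳ _
sum-telescope (suc len) f g p =
  trans (cong (_+_ (f fzero - g fzero)) (sum-telescope len (λ i → f (fsuc i)) (λ i → g (fsuc i))
      (λ i → p (fsuc i))))
  (trans (cong (λ x → f fzero - g fzero + (f (fsuc (Fin.fromℕ len)) - x)) (sym (p fzero)))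
         (arith (f fzero) (g fzero) (f (fsuc (Fin.fromℕ len)))))
  where
  arith : ∀ a b c → a - b + (c - a) ≡ c - b
  arith = solve-∀

module _ {m : ℕ} where

  dot-cong : ∀ {v v′ w w′ : Vector m} → v ≗v v′ → w ≗v w′ → dot v w ≡ dot v′ w′
  dot-cong p q = sum-cong-≗ (λ e → cong₂ _*_ (p e) (q e))

  dot-+ : ∀ (v v′ w : Vector m) → dot (v +v v′) w ≡ dot v w + dot v′ w
  dot-+ v v′ w = trans (sum-cong-≗ (λ e → ℤₚ.*-distribʳ-+ (w e) (v e) (v′ e)))
      (∑-distrib-+ (λ e → v e * w e) (λ e → v′ e * w e))

  dot-0 : ∀ (w : Vector m) → dot 0v w ≡ 0ℤ
  dot-0 w = sum-const0 (λ e → 0ℤ * w e) (λ e → refl)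

  dot-neg : ∀ (v w : Vector m) → dot (negv v) w ≡ - dot v w
  dot-neg v w = neg-unique _ _ (trans (sym (dot-+ v (negv v) w))
    (trans (dot-cong {v = v +v negv v} {0v} {w} {w} (λ e → ℤₚ.+-inverseʳ (v e)) (λ _ → refl)) (dot-0 w)))

-- Circulations, potential differences and reachability.

module GraphTheory {n m : ℕ} (G : Graph n m) where

  Arc : Set
  Arc = Fin m × Bool

  δ : (Fin n → ℤ) → Vector m
  δ p e = p (head G e) - p (tail G e)

  δ-arc : ∀ p e b → sgn b * δ p e ≡ p (end G (e , b)) - p (start G (e , b))
  δ-arc p e true  = ℤₚ.*-identityˡ _
  δ-arc p e false = arith (p (head G e)) (p (tail G e))
    where
    arith : ∀ x y → -1ℤ * (x - y) ≡ y - x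
    arith = solve-∀

  -- Orthogonality to all potential differences makes `orth` immediate; that conservation at the
  -- single vertices suffices is `circ-from-vertices`.
  Circ : Vector m → Set
  Circ z = ∀ p → dot z (δ p) ≡ 0ℤ

  Pot : Vector m → Set
  Pot w = Σ (Fin n → ℤ) λ p → w ≗v δ p

  unit : Arc → Vector m
  unit (e , b) f = sgn b * δᵢⱼ e f

  dot-unit : ∀ a p → dot (unit a) (δ p) ≡ p (end G a) - p (start G a)
  dot-unit (e , b) p = trans (sum-single _ e off) (trans (cong (_* δ p e) at) (δ-arc p e b))
    where
    at : sgn b * δᵢⱼ e e ≡ sgn b
    at = *-δ-same {i = e} (sgn b) refl
    off : ∀ f → f ≢ e → sgn b * δᵢⱼ e f * δ p f ≡ 0ℤ
    off f q = cong (_* δ p f) (*-δ-diff (sgn b) (λ r → q (sym r)))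

  data Walk (A : Arc → Set) (u : Fin n) : Fin n → Set where
    stay   : Walk A u u
    extend : ∀ {a} → Walk A u (start G a) → A a → Walk A u (end G a)

  walkVector : ∀ {A u v} → Walk A u v → Vector m
  walkVector stay = 0v
  walkVector (extend {a} w _) = walkVector w +v unit a

  dot-walk : ∀ {A u v} (w : Walk A u v) p → dot (walkVector w) (δ p) ≡ p v - p u
  dot-walk {u = u} stay p = trans (dot-0 (δ p)) (sym (ℤₚ.+-inverseʳ (p u)))
  dot-walk {u = u} (extend {a} w _) p = trans (dot-+ (walkVector w) (unit a) (δ p))
    (trans (cong₂ _+_ (dot-walk w p) (dot-unit a p)) (arith (p (start G a)) (p u) (p (end G a))))
    where
    arith : ∀ x y z → (x - y) + (z - x) ≡ z - y
    arith = solve-∀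

  anyArc? : ∀ {P : Arc → Set} → (∀ a → Dec (P a)) → Dec (Σ Arc P)
  anyArc? P? with Finₚ.any? (λ e → P? (e , true)) | Finₚ.any? (λ e → P? (e , false))
  ... | yes (e , p) | _ = yes ((e , true) , p)
  ... | no _ | yes (e , p) = yes ((e , false) , p)
  ... | no ¬p | no ¬q = no λ { ((e , true) , p) → ¬p (e , p) ; ((e , false) , p) → ¬q (e , p) }

  record Reachable (A : Arc → Set) (u : Fin n) : Set where
    field
      reached   : Fin n → Bool
      source    : reached u ≡ true
      walk      : ∀ v → reached v ≡ true → Walk A u v
      saturated : ∀ a → A a → reached (start G a) ≡ true → reached (end G a) ≡ true

  -- Vertices are added along one escaping arc at a time; the fuel exceeds the number of vertices
  -- still missing.
  reachable : ∀ {A} → (∀ a → Dec (A a)) → ∀ u → Reachable A u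
  reachable {A} A? u = grow _ (λ v → isYes (u Finₚ.≟ v)) u∈ single ℕₚ.≤-refl
    where
    missing : (Fin n → Bool) → Fin n → ℕ
    missing R v = if R v then 0 else 1
    u∈ : isYes (u Finₚ.≟ u) ≡ true
    u∈ with u Finₚ.≟ u
    ... | yes _ = refl
    ... | no q  = ⊥-elim (q refl)
    single : ∀ v → isYes (u Finₚ.≟ v) ≡ true → Walk A u v
    single v p with u Finₚ.≟ v
    ... | yes refl = stay
    escape : ∀ R a → Dec (A a × R (start G a) ≡ true × R (end G a) ≡ false)
    escape R a = A? a ×-dec (R (start G a) Boolₚ.≟ true) ×-dec (R (end G a) Boolₚ.≟ false)
    grow : ∀ N R → R u ≡ true → (∀ v → R v ≡ true → Walk A u v) → sumℕ (missing R) ℕ.< N → Reachable A u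
    grow (suc N) R Ru w lt with anyArc? (escape R)
    ... | no ¬a = record { reached = R ; source = Ru ; walk = w ; saturated = sat }
      where
      sat : ∀ a → A a → R (start G a) ≡ true → R (end G a) ≡ true
      sat a Aa s with R (end G a) in eq
      ... | true  = refl
      ... | false = ⊥-elim (¬a (a , Aa , s , eq))
    ... | yes (a , Aa , s , t) = grow N R′ (inj-R u Ru) w′
          (ℕₚ.<-≤-trans (sumℕ-< le (end G a) lt′) (ℕₚ.≤-pred lt))
      where
      R′ : Fin n → Bool
      R′ v = R v ∨ isYes (end G a Finₚ.≟ v)
      inj-R : ∀ v → R v ≡ true → R′ v ≡ true
      inj-R v p rewrite p = refl
      w′ : ∀ v → R′ v ≡ true → Walk A u v
      w′ v p with R v in eq | end G a Finₚ.≟ v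
      ... | true  | _ = w v eq
      ... | false | yes refl = extend (w _ s) Aa
      le : ∀ v → missing R′ v ℕ.≤ missing R v
      le v with R v
      ... | true = ℕ.z≤n
      ... | false with isYes (end G a Finₚ.≟ v)
      ...   | true = ℕ.z≤n
      ...   | false = ℕₚ.≤-refl
      lt′ : missing R′ (end G a) ℕ.< missing R (end G a)
      lt′ rewrite t with end G a Finₚ.≟ end G a
      ... | yes _ = ℕₚ.≤-refl
      ... | no q  = ⊥-elim (q refl)

  allowed : State → Bool → Bool
  allowed bi      _     = true
  allowed none    _     = false
  allowed (dir b) c     = not (b xor c)

  allowed-dir : ∀ b → allowed (dir b) b ≡ true
  allowed-dir true  = refl
  allowed-dir false = refl

  allowed-fit : ∀ s b → allowed s b ≡ true → Fit s (sgn b)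
  allowed-fit bi b _ = tt
  allowed-fit (dir true) true _ = Fit-sgn true
  allowed-fit (dir false) false _ = Fit-sgn false

  private
    Allowed : (Fin m → State) → Arc → Set
    Allowed s (e , b) = allowed (s e) b ≡ true

    unit-fits : ∀ s a → Allowed s a → Fits s (unit a)
    unit-fits s (e , b) p f with e Finₚ.≟ f
    ... | yes refl = subst (Fit (s f)) (sym (ℤₚ.*-identityʳ (sgn b))) (allowed-fit (s f) b p)
    ... | no _     = subst (Fit (s f)) (sym (ℤₚ.*-zeroʳ (sgn b))) (Fit-0 (s f))

    walk-fits : ∀ s {u v} (w : Walk (Allowed s) u v) → Fits s (walkVector w)
    walk-fits s stay f = Fit-0 (s f)
    walk-fits s (extend {a} w p) f = Fit-+ (s f) (walk-fits s w f) (unit-fits s a p f)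

    past-sgn : ∀ b x → Fit (dir b) x → x + sgn b ≢ 0ℤ
    past-sgn true (+ x) p q with trans (sym (cong ∣_∣ q)) (ℕₚ.+-comm x 1)
    ... | ()
    past-sgn false (+ zero) p ()
    past-sgn false (+ suc x) (ℤ.+≤+ ()) q
    past-sgn false -[1+ x ] p ()

    saturated-fit : ∀ s t h → (allowed s true ≡ true → t ≡ true → h ≡ true) →
        (allowed s false ≡ true → h ≡ true → t ≡ true) →
      Fit (dual s) (β h - β t)
    saturated-fit none _ _ _ _ = tt
    saturated-fit bi true true _ _ = refl
    saturated-fit bi false false _ _ = refl
    saturated-fit bi true false p _ with p refl refl
    ... | ()
    saturated-fit bi false true _ p with p refl refl
    ... | ()
    saturated-fit (dir true) true true _ _ = ℤₚ.≤-refl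
    saturated-fit (dir true) false false _ _ = ℤₚ.≤-refl
    saturated-fit (dir true) false true _ _ = ℤ.+≤+ ℕ.z≤n
    saturated-fit (dir true) true false p _ with p refl refl
    ... | ()
    saturated-fit (dir false) true true _ _ = ℤₚ.≤-refl
    saturated-fit (dir false) false false _ _ = ℤₚ.≤-refl
    saturated-fit (dir false) true false _ _ = ℤ.-≤+
    saturated-fit (dir false) false true _ p with p refl refl
    ... | ()

  -- Search from the end of the arc through allowed arcs. If its start is reached, the walk closes
  -- up to a circulation; if not, no allowed arc leaves the reached set, and the indicator of that
  -- set is the potential.
  minty-graph : ∀ s e b → s e ≡ dir b →
    (Σ (Vector m) λ z → Circ z × Fits s z × z e ≢ 0ℤ) ⊎
    (Σ (Vector m) λ w → Pot w × Fits (λ f → dual (s f)) w × w e ≢ 0ℤ)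
  minty-graph s e b se with reachable {Allowed s} (λ a → allowed (s (proj₁ a)) (proj₂ a) Boolₚ.≟ true)
      (end G (e , b))
  ... | R with Reachable.reached R (start G (e , b)) in eq
  ...   | true = inj₁ (walkVector cycle , circ , walk-fits s cycle , nz)
    where
    ok : Allowed s (e , b)
    ok rewrite se = allowed-dir b
    path : Walk (Allowed s) (end G (e , b)) (start G (e , b))
    path = Reachable.walk R _ eq
    cycle : Walk (Allowed s) (end G (e , b)) (end G (e , b))
    cycle = extend path ok
    circ : Circ (walkVector cycle)
    circ p = trans (dot-walk cycle p) (ℤₚ.+-inverseʳ (p (end G (e , b))))
    -- The path may use `e` itself, but only in direction `b`, so adding the closing arc cannot
    -- cancel it.
    nz : walkVector cycle e ≢ 0ℤ
    nz = subst (λ x → walkVector path e + x ≢ 0ℤ) (sym (*-δ-same {i = e} (sgn b) refl))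
           (past-sgn b _ (subst (λ t → Fit t (walkVector path e)) se (walk-fits s path e)))
  ...   | false = inj₂ (δ p , (p , λ _ → refl) , fits , nz b eq (Reachable.source R))
    where
    r : Fin n → Bool
    r = Reachable.reached R
    p : Fin n → ℤ
    p v = β (r v)
    fits : Fits (λ f → dual (s f)) (δ p)
    fits f = saturated-fit (s f) (r (tail G f)) (r (head G f))
      (λ q → Reachable.saturated R (f , true) q) (λ q → Reachable.saturated R (f , false) q)
    nz : ∀ b → r (start G (e , b)) ≡ false → r (end G (e , b)) ≡ true → δ p e ≢ 0ℤ
    nz true  x y z with trans (sym (cong₂ (λ a c → β a - β c) y x)) z
    ... | ()
    nz false x y z with trans (sym (cong₂ (λ a c → β a - β c) x y)) z
    ... | ()

-- Directed cycles as circulations.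

module Cycles {n m : ℕ} (G : Graph n m) where
  open GraphTheory G

  circ-resp : ∀ {v w} → v ≗v w → Circ v → Circ w
  circ-resp q c p = trans (dot-cong {w = δ p} {δ p} (λ e → sym (q e)) (λ _ → refl)) (c p)

  circ-0 : Circ 0v
  circ-0 p = dot-0 (δ p)

  circ-+ : ∀ {v w} → Circ v → Circ w → Circ (v +v w)
  circ-+ {v} {w} c d p = trans (dot-+ v w (δ p)) (cong₂ _+_ (c p) (d p))

  circ-neg : ∀ {v} → Circ v → Circ (negv v)
  circ-neg {v} c p = trans (dot-neg v (δ p)) (neg-cong (c p))

  at-vertex : Fin n → Fin n → ℤ
  at-vertex x v = δᵢⱼ v x

  -- Every potential is a combination of vertex indicators with its own values as coefficients. This
  -- leaves finitely many equations to check.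
  circ-from-vertices : ∀ z → (∀ x → dot z (δ (at-vertex x)) ≡ 0ℤ) → Circ z
  circ-from-vertices z c p = begin
    sum (λ e → z e * δ p e)                                     ≡⟨ sum-cong-≗ expand ⟩
    sum (λ e → sum (λ x → p x * (z e * δ (at-vertex x) e)))     ≡⟨ ∑-comm
        (λ e x → p x * (z e * δ (at-vertex x) e)) ⟩
    sum (λ x → sum (λ e → p x * (z e * δ (at-vertex x) e)))     ≡⟨ sum-const0
        (λ x → sum (λ e → p x * (z e * δ (at-vertex x) e))) vanish ⟩
    0ℤ                                                          ∎
    where
    open ≡-Reasoning
    vanish : ∀ x → sum (λ e → p x * (z e * δ (at-vertex x) e)) ≡ 0ℤ
    vanish x = trans (sym (*-distribˡ-sum (p x) (λ e → z e * δ (at-vertex x) e)))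
      (trans (cong (p x *_) (c x)) (ℤₚ.*-zeroʳ (p x)))
    p-sum : ∀ v → p v ≡ sum (λ x → p x * at-vertex x v)
    p-sum v = sym (trans (sum-single (λ x → p x * δᵢⱼ v x) v (λ x q → *-δ-diff (p x) (λ r → q (sym r))))
        (*-δ-same (p v) refl))
    arith : ∀ a b c → a * b - a * c ≡ a * (b - c)
    arith = solve-∀
    arith′ : ∀ a b c → a * (b * c) ≡ b * (a * c)
    arith′ = solve-∀
    expand : ∀ e → z e * δ p e ≡ sum (λ x → p x * (z e * δ (at-vertex x) e))
    expand e = begin
      z e * δ p e ≡⟨ cong (z e *_) (trans (cong₂ _-_ (p-sum (head G e)) (p-sum (tail G e)))
          (trans (sum-minus (λ x → p x * at-vertex x (head G e)) (λ x → p x * at-vertex x (tail G e)))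
                 (sum-cong-≗ (λ x → arith (p x) (at-vertex x (head G e)) (at-vertex x (tail G e)))))) ⟩
      z e * sum (λ x → p x * δ (at-vertex x) e) ≡⟨ *-distribˡ-sum (z e) (λ x → p x * δ (at-vertex x) e) ⟩
      sum (λ x → z e * (p x * δ (at-vertex x) e)) ≡⟨ sum-cong-≗ (λ x → arith′ (z e) (p x) (δ (at-vertex x) e)) ⟩
      sum (λ x → p x * (z e * δ (at-vertex x) e)) ∎

  circ? : ∀ z → Dec (Circ z)
  circ? z with Finₚ.all? (λ x → dot z (δ (at-vertex x)) ℤ.≟ 0ℤ)
  ... | yes p = yes (circ-from-vertices z p)
  ... | no ¬p = no (λ c → ¬p (λ x → c (at-vertex x)))

  module _ (w : DirCycleWalk G) where

    edge : Fin (suc (len w)) → Fin m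
    edge i = proj₁ (step w i)

    side : Fin (suc (len w)) → Bool
    side i = proj₂ (step w i)

    vecOf : Vector m
    vecOf e with Finₚ.any? (λ i → edge i Finₚ.≟ e)
    ... | yes (i , _) = sgn (side i)
    ... | no _        = 0ℤ

    vecOf-represents : Represents G w vecOf
    vecOf-represents e with Finₚ.any? (λ i → edge i Finₚ.≟ e)
    ... | no ¬p = inj₂ (inj₂ (refl , λ i q → ¬p (i , q)))
    ... | yes (i , p) with step w i in eq
    ...   | (f , true)  = inj₁ (refl , i , trans eq (cong (_, true) p))
    ...   | (f , false) = inj₂ (inj₁ (refl , i , trans eq (cong (_, false) p)))

    -- The end of a step is the start of the cyclically next one; the last step is treated apart,
    -- since it is followed by step zero.
    end-injective : ∀ i j → end G (step w i) ≡ end G (step w j) → i ≡ j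
    end-injective i j p with view i | view j
    ... | ‵fromℕ | ‵fromℕ = refl
    ... | ‵inject₁ a | ‵inject₁ b = cong Fin.inject₁ (Finₚ.suc-injective
            (vertInj w _ _ (trans (sym (consec w a)) (trans p (consec w b)))))
    ... | ‵fromℕ | ‵inject₁ b with vertInj w _ _ (trans (sym (closed w)) (trans p (consec w b)))
    ...   | ()
    end-injective i j p | ‵inject₁ a | ‵fromℕ with vertInj w _ _ (trans (sym (consec w a)) (trans p (closed w)))
    ...   | ()

    module _ {v : Vector m} (r : Represents G w v) where

      rep-at : ∀ i → v (edge i) ≡ sgn (side i)
      rep-at i with r (edge i)
      ... | inj₁ (p , j , q) = trans p (cong sgn (trans (sym (cong proj₂ q))
              (cong side (edgeInj w j i (cong proj₁ q)))))
      ... | inj₂ (inj₁ (p , j , q)) = trans p (cong sgn (trans (sym (cong proj₂ q))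
              (cong side (edgeInj w j i (cong proj₁ q)))))
      ... | inj₂ (inj₂ (_ , q)) = ⊥-elim (q i refl)

      rep-off : ∀ e → (∀ i → edge i ≢ e) → v e ≡ 0ℤ
      rep-off e q with r e
      ... | inj₁ (_ , j , p) = ⊥-elim (q j (cong proj₁ p))
      ... | inj₂ (inj₁ (_ , j , p)) = ⊥-elim (q j (cong proj₁ p))
      ... | inj₂ (inj₂ (p , _)) = p

      rep-unit : ∀ e → Unit (v e)
      rep-unit e with r e
      ... | inj₁ (p , _) = subst Unit (sym p) (u± true)
      ... | inj₂ (inj₁ (p , _)) = subst Unit (sym p) (u± false)
      ... | inj₂ (inj₂ (p , _)) = subst Unit (sym p) u0

      rep-nz : Σ (Fin m) λ e → v e ≢ 0ℤ
      rep-nz = edge fzero , λ p → sgn≢0 (side fzero) (trans (sym (rep-at fzero)) p)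

    private
      flow : Vector m → Fin (suc (len w)) → ℤ
      flow z i = sgn (side i) * z (edge i)

      sgn² : ∀ b → sgn b * sgn b ≡ +1ℤ
      sgn² true  = refl
      sgn² false = refl

    dot-cycle : ∀ {z} → (∀ e → (∀ i → edge i ≢ e) → z e ≡ 0ℤ) → ∀ p →
      dot z (δ p) ≡ sum (λ i → flow z i * p (end G (step w i)) - flow z i * p (start G (step w i)))
    dot-cycle {z} off p = trans
      (sum-reindex edge (edgeInj w) (λ e → z e * δ p e) (λ e q → cong (_* δ p e) (off e q)))
      (sum-cong-≗ term)
      where
      arith : ∀ s z a b → s * z * a - s * z * b ≡ s * z * (a - b)
      arith = solve-∀
      arith′ : ∀ s z d → s * z * (s * d) ≡ s * s * (z * d)
      arith′ = solve-∀
      term : ∀ i → z (edge i) * δ p (edge i) ≡ flow z i * p (end G (step w i)) - flow z i * p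
          (start G (step w i))
      term i = sym (begin
        s * x * p (end G (step w i)) - s * x * p (start G (step w i))  ≡⟨ arith s x _ _ ⟩
        s * x * (p (end G (step w i)) - p (start G (step w i)))        ≡⟨ cong (s * x *_)
            (sym (δ-arc p (edge i) (side i))) ⟩
        s * x * (s * δ p (edge i))                                     ≡⟨ arith′ s x _ ⟩
        s * s * (x * δ p (edge i))                                     ≡⟨ cong (_* (x * δ p (edge i)))
            (sgn² (side i)) ⟩
        +1ℤ * (x * δ p (edge i))                                       ≡⟨ ℤₚ.*-identityˡ _ ⟩
        x * δ p (edge i)                                               ∎)
        where
        open ≡-Reasoning
        s = sgn (side i)
        x = z (edge i)

    rep-circ : ∀ {v} → Represents G w v → Circ v
    rep-circ {v} r p = trans (dot-cycle (rep-off r) p) (trans (sum-cong-≗ term)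
      (trans (sum-telescope (len w) (λ i → p (end G (step w i))) (λ i → p (start G (step w i)))
          (λ i → cong p (consec w i)))
      (trans (cong (λ x → p x - p (start G (step w fzero))) (closed w))
          (ℤₚ.+-inverseʳ (p (start G (step w fzero)))))))
      where
      one : ∀ i → flow v i ≡ +1ℤ
      one i = trans (cong (sgn (side i) *_) (rep-at r i)) (sgn² (side i))
      term : ∀ i → flow v i * p (end G (step w i)) - flow v i * p (start G (step w i)) ≡ p (end G (step w i)) -
          p (start G (step w i))
      term i = cong₂ _-_ (trans (cong (_* _) (one i)) (ℤₚ.*-identityˡ _))
          (trans (cong (_* _) (one i)) (ℤₚ.*-identityˡ _))

    -- Conservation at the vertex between two consecutive edges of the cycle, the only ones there.
    flow-step : ∀ {z} → Circ z → (∀ e → (∀ i → edge i ≢ e) → z e ≡ 0ℤ) → ∀ j →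
        flow z (Fin.inject₁ j) ≡ flow z (fsuc j)
    flow-step {z} c off j = ℤₚ.i-j≡0⇒i≡j _ _ (begin
      flow z (Fin.inject₁ j) - flow z (fsuc j)  ≡⟨ cong₂ _-_ (sym in-sum) (sym out-sum) ⟩
      sum inflow - sum outflow                  ≡⟨ sum-minus inflow outflow ⟩
      sum (λ i → inflow i - outflow i)          ≡⟨ sym (dot-cycle off (at-vertex x)) ⟩
      dot z (δ (at-vertex x))                   ≡⟨ c (at-vertex x) ⟩
      0ℤ                                        ∎)
      where
      open ≡-Reasoning
      x = start G (step w (fsuc j))
      inflow outflow : Fin (suc (len w)) → ℤ
      inflow i = flow z i * δᵢⱼ (end G (step w i)) x
      outflow i = flow z i * δᵢⱼ (start G (step w i)) x
      in-sum : sum inflow ≡ flow z (Fin.inject₁ j)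
      in-sum = trans (sum-single inflow (Fin.inject₁ j) (λ i q → *-δ-diff (flow z i)
          (λ r → q (end-injective i _ (trans r (sym (consec w j)))))))
        (*-δ-same (flow z (Fin.inject₁ j)) (consec w j))
      out-sum : sum outflow ≡ flow z (fsuc j)
      out-sum = trans (sum-single outflow (fsuc j) (λ i q → *-δ-diff (flow z i) (λ r → q (vertInj w i _ r))))
        (*-δ-same (flow z (fsuc j)) refl)

    flow-constant : ∀ {z} → Circ z → (∀ e → (∀ i → edge i ≢ e) → z e ≡ 0ℤ) → ∀ i → flow z i ≡ flow z fzero
    flow-constant {z} c off = <-weakInduction (λ i → flow z i ≡ flow z fzero) refl
      (λ j p → trans (sym (flow-step c off j)) p)

    -- Conservation makes the flow along the cycle constant, and that constant is the factor.
    cycle-multiple : ∀ {v z} → Represents G w v → Circ z → (∀ e → v e ≡ 0ℤ → z e ≡ 0ℤ) → ∀ e →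
        z e ≡ v e * flow z fzero
    cycle-multiple {v} {z} r c supp e with Finₚ.any? (λ i → edge i Finₚ.≟ e)
    ... | no ¬p = trans (supp e ve) (sym (cong (_* flow z fzero) ve))
      where
      ve : v e ≡ 0ℤ
      ve = rep-off r e (λ i q → ¬p (i , q))
    ... | yes (i , refl) = begin
      z (edge i)                                ≡⟨ sym (ℤₚ.*-identityˡ _) ⟩
      +1ℤ * z (edge i)                          ≡⟨ cong (_* z (edge i)) (sym (sgn² (side i))) ⟩
      sgn (side i) * sgn (side i) * z (edge i)  ≡⟨ ℤₚ.*-assoc (sgn (side i)) (sgn (side i)) (z (edge i)) ⟩
      sgn (side i) * flow z i                   ≡⟨ cong₂ _*_ (sym (rep-at r i)) (flow-constant c off i) ⟩
      v (edge i) * flow z fzero                 ∎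
      where
      open ≡-Reasoning
      off : ∀ e → (∀ i → edge i ≢ e) → z e ≡ 0ℤ
      off e q = supp e (rep-off r e q)

    cycle-dichotomy : ∀ {v z} → Represents G w v → Circ z → (∀ e → Unit (z e)) → (∀ e → v e ≡ 0ℤ → z e ≡ 0ℤ) →
      (z ≗v 0v) ⊎ (z ≗v v) ⊎ (z ≗v negv v)
    cycle-dichotomy {v} {z} r c unit supp = by (flow z fzero) refl (unit-flow (side fzero) (unit (edge fzero)))
      where
      unit-flow : ∀ b {x} → Unit x → Unit (sgn b * x)
      unit-flow b u0 = subst Unit (sym (ℤₚ.*-zeroʳ (sgn b))) u0
      unit-flow true (u± true) = u± true
      unit-flow true (u± false) = u± false
      unit-flow false (u± true) = u± false
      unit-flow false (u± false) = u± true
      all : ∀ e → z e ≡ v e * flow z fzero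
      all = cycle-multiple r c supp
      by : ∀ k → flow z fzero ≡ k → Unit k → _
      by _ p u0 = inj₁ (λ e → trans (all e) (trans (cong (v e *_) p) (ℤₚ.*-zeroʳ (v e))))
      by _ p (u± true) = inj₂ (inj₁ (λ e → trans (all e) (trans (cong (v e *_) p) (ℤₚ.*-identityʳ (v e)))))
      by _ p (u± false) = inj₂ (inj₂ (λ e → trans (all e) (trans (cong (v e *_) p) (arith (v e)))))
        where
        arith : ∀ x → x * -1ℤ ≡ - x
        arith = solve-∀

-- Tracing a cycle inside a circulation.

module _ {n : ℕ} (h : ℕ → Fin n) where

  -- The period is written `suc l` to match `DirCycleWalk`, whose steps are indexed by
  -- `Fin (suc len)`.
  FirstRepeat : Set
  FirstRepeat = Σ ℕ λ i → Σ ℕ λ l → h i ≡ h (i ℕ.+ suc l) ×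
    (∀ a b → a ℕ.< suc l → b ℕ.< suc l → h (i ℕ.+ a) ≡ h (i ℕ.+ b) → a ≡ b)

  -- The range of injectivity is extended until a value repeats, which pigeonhole enforces. The
  -- stretch from the earlier occurrence up to the repetition is then injective.
  firstRepeat : FirstRepeat
  firstRepeat = from (suc n) 0 (ℕₚ.+-identityʳ (suc n)) (λ a b ())
    where
    InjectiveBelow : ℕ → Set
    InjectiveBelow J = ∀ a b → a ℕ.< J → b ℕ.< J → h a ≡ h b → a ≡ b
    from : ∀ fuel J → fuel ℕ.+ J ≡ suc n → InjectiveBelow J → FirstRepeat
    from zero J refl inj = ⊥-elim (ℕₚ.1+n≰n (Finₚ.injective⇒≤ {f = λ (i : Fin (suc n)) → h (Fin.toℕ i)}
      (λ {i} {j} p → Finₚ.toℕ-injective (inj _ _ (Finₚ.toℕ<n i) (Finₚ.toℕ<n j) p))))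
    from (suc fuel) J p inj with Finₚ.any? (λ (a : Fin J) → h (Fin.toℕ a) Finₚ.≟ h J)
    ... | yes (a , q) = i , J ℕ.∸ suc i , trans q (cong h (sym (trans (ℕₚ.+-suc i _) (ℕₚ.m+[n∸m]≡n i<J)))) ,
        λ x y x< y< r → ℕₚ.+-cancelˡ-≡ i x y (inj _ _ (below x x<) (below y y<) r)
      where
      i = Fin.toℕ a
      i<J : i ℕ.< J
      i<J = Finₚ.toℕ<n a
      below : ∀ x → x ℕ.< suc (J ℕ.∸ suc i) → i ℕ.+ x ℕ.< J
      below x x< = ℕₚ.≤-trans (ℕₚ.≤-reflexive (sym (ℕₚ.+-suc i x)))
        (ℕₚ.≤-trans (ℕₚ.+-monoʳ-≤ i x<) (ℕₚ.≤-reflexive (trans (ℕₚ.+-suc i _) (ℕₚ.m+[n∸m]≡n i<J))))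
    ... | no ¬q = from fuel (suc J) (trans (ℕₚ.+-suc fuel J) p) inj′
      where
      inj′ : InjectiveBelow (suc J)
      inj′ a b a< b< r with ℕₚ.m<1+n⇒m<n∨m≡n a< | ℕₚ.m<1+n⇒m<n∨m≡n b<
      ... | inj₁ x | inj₁ y = inj a b x y r
      ... | inj₂ refl | inj₂ refl = refl
      ... | inj₁ x | inj₂ refl = ⊥-elim (¬q (Fin.fromℕ< x , trans (cong h (Finₚ.toℕ-fromℕ< x)) r))
      ... | inj₂ refl | inj₁ y = ⊥-elim (¬q (Fin.fromℕ< y , trans (cong h (Finₚ.toℕ-fromℕ< y)) (sym r)))

conf? : ∀ b z → Dec (Conf (sgn b) z)
conf? true  (+ zero)  = no λ ()
conf? true  (+ suc n) = yes c+
conf? true  -[1+ n ]  = no λ ()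
conf? false (+ n)     = no λ ()
conf? false -[1+ n ]  = yes c-

conf-fit : ∀ b {z} → Conf (sgn b) z → Fit (dir b) z
conf-fit true  c+ = ℤ.+≤+ ℕ.z≤n
conf-fit false c- = ℤ.-≤+

conf-side : ∀ {b c z} → Conf (sgn b) z → Conf (sgn c) z → b ≡ c
conf-side {true}  {true}  _ _ = refl
conf-side {false} {false} _ _ = refl
conf-side {true}  {false} c+ ()
conf-side {false} {true}  c- ()

conf-exists : ∀ {z} → z ≢ 0ℤ → Σ Bool λ b → Conf (sgn b) z
conf-exists {+ zero}   p = ⊥-elim (p refl)
conf-exists {+ suc n}  p = true , c+
conf-exists { -[1+ n ]} p = false , c-

module _ {n m : ℕ} (G : Graph n m) where
  open GraphTheory G
  open Cycles G

  module _ {z : Vector m} (c : Circ z) where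

    private
      Along : Arc → Set
      Along (e , b) = Conf (sgn b) (z e)

      -- If no arc along `z` left the end of `a`, every arc along `z` would contribute a nonnegative
      -- amount at that vertex and `a` a nonzero one, against conservation.
      successor : ∀ a → Along a → Σ Arc λ a′ → Along a′ × start G a′ ≡ end G a
      successor (e , b) pos with anyArc? (λ a′ → conf? (proj₂ a′) (z (proj₁ a′)) ×-dec
          (start G a′ Finₚ.≟ end G (e , b)))
      ... | yes p = p
      ... | no none-out = ⊥-elim (*-≢0 z≢0 δ≢0 (sum-zero (λ f → z f * δ p f) nonneg (c p) e))
        where
        x = end G (e , b)
        p = at-vertex x
        z≢0 : z e ≢ 0ℤ
        z≢0 = conf-≢0 pos (sgn≢0 b)
        out≡0 : ∀ a → Along a → p (start G a) ≡ 0ℤ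
        out≡0 a al = δᵢⱼ-diff (λ q → none-out (a , al , q))
        δ-along : ∀ a → Along a → sgn (proj₂ a) * δ p (proj₁ a) ≡ p (end G a)
        δ-along (f , d) al = trans (δ-arc p f d) (trans (cong (λ t → p (end G (f , d)) - t) (out≡0 (f , d) al))
            (ℤₚ.+-identityʳ _))
        δ≢0 : δ p e ≢ 0ℤ
        δ≢0 q with trans (sym (δᵢⱼ-same {i = x} refl))
            (trans (sym (δ-along (e , b) pos)) (trans (cong (sgn b *_) q) (ℤₚ.*-zeroʳ (sgn b))))
        ... | ()
        p≥0 : ∀ v → 0ℤ ℤ.≤ p v
        p≥0 v with v Finₚ.≟ x
        ... | yes _ = ℤ.+≤+ ℕ.z≤n
        ... | no _  = ℤₚ.≤-refl
        unsign : ∀ d y → 0ℤ ℤ.≤ sgn d * y → Fit (dir d) y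
        unsign true y q = subst (0ℤ ℤ.≤_) (ℤₚ.*-identityˡ y) q
        unsign false (+ zero) q = ℤₚ.≤-refl
        unsign false (+ suc k) ()
        unsign false -[1+ k ] q = ℤ.-≤+
        nonneg : ∀ f → 0ℤ ℤ.≤ z f * δ p f
        nonneg f with z f ℤ.≟ 0ℤ
        ... | yes q = ℤₚ.≤-reflexive (sym (cong (_* δ p f) q))
        ... | no q with conf-exists q
        ...   | d , al = Fit-prod (dir d) (conf-fit d al)
                  (unsign d _ (subst (0ℤ ℤ.≤_) (sym (δ-along (f , d) al)) (p≥0 (end G (f , d)))))

    -- Following arcs along z until a vertex recurs traces a cycle.
    circ-extract : ∀ e → z e ≢ 0ℤ → Σ (Vector m) λ v → IsDirCycle G v × (∀ f → Conf (v f) (z f))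
    circ-extract e ze = vecOf cycle , (cycle , vecOf-represents cycle) , conf
      where
      trail : ℕ → Σ Arc Along
      trail zero    = let (b , p) = conf-exists ze in (e , b) , p
      trail (suc k) = let (a , p) = trail k ; (a′ , p′ , _) = successor a p in a′ , p′
      arc : ℕ → Arc
      arc k = proj₁ (trail k)
      along : ∀ k → Along (arc k)
      along k = proj₂ (trail k)
      linked : ∀ k → start G (arc (suc k)) ≡ end G (arc k)
      linked k = proj₂ (proj₂ (successor (arc k) (along k)))
      rep : FirstRepeat (λ k → start G (arc k))
      rep = firstRepeat (λ k → start G (arc k))
      i l : ℕ
      i = proj₁ rep
      l = proj₁ (proj₂ rep)
      at : ℕ → Arc
      at k = arc (i ℕ.+ k)
      at-linked : ∀ k → start G (at (suc k)) ≡ end G (at k)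
      at-linked k = trans (cong (λ j → start G (arc j)) (ℕₚ.+-suc i k)) (linked (i ℕ.+ k))
      vert : ∀ (a b : Fin (suc l)) → start G (at (Fin.toℕ a)) ≡ start G (at (Fin.toℕ b)) → a ≡ b
      vert a b p = Finₚ.toℕ-injective (proj₂ (proj₂ (proj₂ rep)) _ _ (Finₚ.toℕ<n a) (Finₚ.toℕ<n b) p)
      -- An edge met twice is traversed both times along the sign of `z`, hence as the same arc with
      -- the same start.
      same-arc : ∀ a b → Along a → Along b → proj₁ a ≡ proj₁ b → a ≡ b
      same-arc (e , b) (.e , d) p q refl = cong (e ,_) (conf-side p q)
      cycle : DirCycleWalk G
      cycle = record
        { len = l
        ; step = λ k → at (Fin.toℕ k)
        ; consec = λ k → trans (cong (λ j → end G (at j)) (Finₚ.toℕ-inject₁ k)) (sym (at-linked (Fin.toℕ k)))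
        ; closed = trans (cong (λ j → end G (at j)) (Finₚ.toℕ-fromℕ l))
            (trans (sym (at-linked l)) (trans (sym (proj₁ (proj₂ (proj₂ rep))))
                (cong (λ j → start G (arc j)) (sym (ℕₚ.+-identityʳ i)))))
        ; edgeInj = λ a b p → vert a b (cong (start G)
            (same-arc (at (Fin.toℕ a)) (at (Fin.toℕ b)) (along (i ℕ.+ Fin.toℕ a)) (along (i ℕ.+ Fin.toℕ b)) p))
        ; vertInj = vert }
      conf : ∀ f → Conf (vecOf cycle f) (z f)
      conf f with Finₚ.any? (λ k → edge cycle k Finₚ.≟ f)
      ... | yes (k , refl) = along (i ℕ.+ Fin.toℕ k)
      ... | no _ = c0

  dirCycle-circ : ∀ {v} → IsDirCycle G v → Circ v
  dirCycle-circ (w , r) = rep-circ w r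

  conf-0 : ∀ {u z} → Conf u z → z ≡ 0ℤ → u ≡ 0ℤ
  conf-0 c0 _ = refl

  -- By the dichotomy, the only directed cycle conforming to a directed cycle is itself. So it is
  -- enough to trace any cycle inside `v` and compare it with `v`.
  isDirCycle? : ∀ v → Dec (IsDirCycle G v)
  isDirCycle? v with circ? v
  ... | no ¬c = no (λ d → ¬c (dirCycle-circ d))
  ... | yes c with nonzero? v
  ...   | inj₂ v≗0 = no (λ (w , r) → let (e , ve) = rep-nz w r in ve (v≗0 e))
  ...   | inj₁ (e , ve) with circ-extract c e ve
  ...     | u , (w , r) , conf with Finₚ.all? (λ f → v f ℤ.≟ u f)
  ...       | yes v≗u = yes (w , λ f → subst (λ x → (x ≡ +1ℤ × _) ⊎ (x ≡ -1ℤ × _) ⊎ (x ≡ 0ℤ × _)) (sym (v≗u f))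
        (r f))
  ...       | no ¬v≗u = no λ (w′ , r′) → ¬v≗u (λ f → sym
        (same (cycle-dichotomy w′ r′ (rep-circ w r) (rep-unit w r) (λ f → conf-0 (conf f))) f))
    where
    conf-neg : ∀ {u x} → Conf u x → u ≡ - x → u ≡ 0ℤ
    conf-neg c0 _ = refl
    conf-neg c+ ()
    conf-neg (c- {zero}) ()
    same : (u ≗v 0v) ⊎ (u ≗v v) ⊎ (u ≗v negv v) → u ≗v v
    same (inj₁ p) = let (f , uf) = rep-nz w r in ⊥-elim (uf (p f))
    same (inj₂ (inj₁ p)) = p
    same (inj₂ (inj₂ p)) = let (f , uf) = rep-nz w r in ⊥-elim (uf (conf-neg (conf f) (p f)))

-- Supports, acyclic signatures and the system of cycles.

∈⇒true : ∀ {k e} {C : Subset k} → e ∈ C → lookup C e ≡ true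
∈⇒true = Vecₚ.[]=⇒lookup

true⇒∈ : ∀ {k e} {C : Subset k} → lookup C e ≡ true → e ∈ C
true⇒∈ {e = e} {C} = Vecₚ.lookup⇒[]= e C

support : ∀ {m} → Vector m → Subset m
support v = tabulate (λ e → not (isYes (v e ℤ.≟ 0ℤ)))

∈-support⁺ : ∀ {m} (v : Vector m) e → v e ≢ 0ℤ → e ∈ support v
∈-support⁺ v e p = true⇒∈ (trans (Vecₚ.lookup∘tabulate _ e) nz)
  where
  nz : not (isYes (v e ℤ.≟ 0ℤ)) ≡ true
  nz with v e ℤ.≟ 0ℤ
  ... | yes q = ⊥-elim (p q)
  ... | no _  = refl

∈-support⁻ : ∀ {m} (v : Vector m) e → e ∈ support v → v e ≢ 0ℤ
∈-support⁻ v e p with v e ℤ.≟ 0ℤ | trans (sym (Vecₚ.lookup∘tabulate (λ e → not (isYes (v e ℤ.≟ 0ℤ))) e))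
    (∈⇒true p)
... | no q | _ = q

module Signed {n m : ℕ} (G : Graph n m) (IsSet : Subset m → Set) (σ : Subset m → Vector m) where

  Positive : Vector m → Set
  Positive v = Σ (Subset m) λ C → IsSet C × v ≗v σ C

  private
    Unital : List (Subset m × ℕ) → Set
    Unital = All (λ p → proj₂ p ≡ 1)

    combination : ∀ {z} → Cone Positive z → Σ (List (Subset m × ℕ)) λ cs →
      All (λ p → IsSet (proj₁ p)) cs × Unital cs × lincomb G σ cs ≗v z
    combination (nil p) = [] , [] , [] , λ e → sym (p e)
    combination (cons (C , isC , p) c q) = let (cs , sets , ones , r) = combination c in
      (C , 1) ∷ cs , isC ∷ sets , refl ∷ ones ,
      λ e → trans (cong₂ _+_ (trans (ℤₚ.*-identityˡ (σ C e)) (sym (p e))) (r e)) (sym (q e))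

    lincomb-++ : ∀ cs ds e → lincomb G σ (cs ++ ds) e ≡ lincomb G σ cs e + lincomb G σ ds e
    lincomb-++ [] ds e = sym (ℤₚ.+-identityˡ _)
    lincomb-++ ((C , a) ∷ cs) ds e = trans (cong (_+_ (+ a * σ C e)) (lincomb-++ cs ds e))
      (sym (ℤₚ.+-assoc (+ a * σ C e) (lincomb G σ cs e) (lincomb G σ ds e)))

    zero-unital : ∀ cs → Unital cs → All (λ p → proj₂ p ≡ 0) cs → cs ≡ []
    zero-unital [] _ _ = refl
    zero-unital ((C , a) ∷ cs) (p ∷ _) (q ∷ _) with trans (sym p) q
    ... | ()

  -- The two cone expressions together form a vanishing combination with all coefficients equal to
  -- 1. Acyclicity makes the coefficients 0, so there are no terms.
  acyclic-pointed : IsAcyclic G IsSet σ → ∀ {z} → Cone Positive z → Cone Positive (negv z) → z ≗v 0v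
  acyclic-pointed acyclic {z} c d e = let
      (cs , setsc , onesc , rc) = combination c
      (ds , setsd , onesd , rd) = combination d
      zeros = acyclic (cs ++ ds) (Allₚ.++⁺ setsc setsd)
        (λ e → trans (lincomb-++ cs ds e) (trans (cong₂ _+_ (rc e) (rd e)) (ℤₚ.+-inverseʳ (z e))))
      empty = zero-unital cs onesc (Allₚ.++⁻ˡ cs zeros)
    in trans (sym (rc e)) (cong (λ xs → lincomb G σ xs e) empty)

module _ {n m : ℕ} (G : Graph n m) where
  open GraphTheory G
  open Cycles G

  suppEq? : ∀ v C → Dec (SuppEq G v C)
  suppEq? v C = Finₚ.all? (λ e → ((e Subsetₚ.∈? C) →-dec ¬? (v e ℤ.≟ 0ℤ)) ×-dec
      (¬? (v e ℤ.≟ 0ℤ) →-dec (e Subsetₚ.∈? C)))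

  suppEq-0 : ∀ {u v C} → SuppEq G u C → SuppEq G v C → ∀ e → u e ≡ 0ℤ → v e ≡ 0ℤ
  suppEq-0 {u} {v} p q e ue with v e ℤ.≟ 0ℤ
  ... | yes r = r
  ... | no r  = ⊥-elim (proj₁ (p e) (proj₂ (q e) r) ue)

  support-suppEq : ∀ v → SuppEq G v (support v)
  support-suppEq v e = ∈-support⁻ v e , ∈-support⁺ v e

  dirCycle-dichotomy : ∀ {v z} → IsDirCycle G v → IsDirCycle G z → (∀ e → v e ≡ 0ℤ → z e ≡ 0ℤ) → (z ≗v v) ⊎
      (z ≗v negv v)
  dirCycle-dichotomy {v} {z} (w , r) (w′ , r′) supp = nonzero
      (cycle-dichotomy w r (rep-circ w′ r′) (rep-unit w′ r′) supp)
    where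
    nonzero : (z ≗v 0v) ⊎ (z ≗v v) ⊎ (z ≗v negv v) → (z ≗v v) ⊎ (z ≗v negv v)
    nonzero (inj₁ p) = let (f , zf) = rep-nz w′ r′ in ⊥-elim (zf (p f))
    nonzero (inj₂ p) = p

  module _ (σ : Subset m → Vector m) (sig : CycleSignature G σ) where
    open Signed G (IsCycle G) σ

    -- No search over walks is involved: a cycle `C` is recognised by its own signature value, which
    -- must be a directed cycle with support `C`.
    isCycle? : ∀ C → Dec (IsCycle G C)
    isCycle? C with isDirCycle? G (σ C) ×-dec suppEq? (σ C) C
    ... | yes p = yes (σ C , p)
    ... | no ¬p = no (λ c → ¬p (proj₁ sig C c))

    -- `v` and the signature value of its support are directed cycles with the same support, hence
    -- equal or opposite.
    dirCycle-signed : ∀ {v} → IsDirCycle G v → Positive v ⊎ Positive (negv v)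
    dirCycle-signed {v} d = sign (dirCycle-dichotomy d (proj₁ signed)
        (suppEq-0 (support-suppEq v) (proj₂ signed)))
      where
      C : Subset m
      C = support v
      isC : IsCycle G C
      isC = v , d , support-suppEq v
      signed : IsDirCycle G (σ C) × SuppEq G (σ C) C
      signed = proj₁ sig C isC
      sign : (σ C ≗v v) ⊎ (σ C ≗v negv v) → Positive v ⊎ Positive (negv v)
      sign (inj₁ p) = inj₁ (C , isC , λ e → sym (p e))
      sign (inj₂ p) = inj₂ (C , isC , λ e → sym (p e))

    cycleSystem : System m
    cycleSystem = record
      { L = Circ
      ; L-resp = circ-resp
      ; L-0 = circ-0
      ; L-+ = λ {v} {w} → circ-+ {v} {w}
      ; L-neg = λ {v} → circ-neg {v}
      ; Pos = Positive
      ; Pos-L = λ (C , c , p) → circ-resp (λ e → sym (p e)) (dirCycle-circ G (proj₁ (proj₁ sig C c)))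
      ; Pos-unit = λ (C , c , p) e → let (w , r) = proj₁ (proj₁ sig C c) in subst Unit (sym (p e)) (rep-unit w r e)
      ; Pos-nz = λ (C , c , p) → let (w , r) = proj₁ (proj₁ sig C c) ; (e , q) = rep-nz w r in e , λ x → q (trans (sym (p e)) x)
      ; extract = λ c e ze → let (v , d , conf) = circ-extract G c e ze in v , dirCycle-signed d , conf
      ; pointed = acyclic-pointed (proj₂ sig)
      ; search = search′ }
      where
      search′ : ∀ s → Dec (Σ (Vector m) λ v → Positive v × Fits s (negv v))
      search′ s with Subsetₚ.anySubset? (λ C → isCycle? C ×-dec Finₚ.all? (λ e → Fit? (s e) (- σ C e)))
      ... | yes (C , c , fit) = yes (σ C , (C , c , λ _ → refl) , fit)
      ... | no ¬p = no λ (v , (C , c , p) , fit) → ¬p (C , c , λ e → subst (Fit (s e)) (neg-cong (p e)) (fit e))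

conf-trans : ∀ {a b c} → Conf a b → Conf b c → Conf a c
conf-trans c0 _ = c0
conf-trans c+ c+ = c+
conf-trans c- c- = c-

conf-∣∣ : ∀ {a b} → Conf a b → ∣ a ∣ ℕ.≤ ∣ b ∣
conf-∣∣ c0 = ℕ.z≤n
conf-∣∣ c+ = ℕ.s≤s ℕ.z≤n
conf-∣∣ c- = ℕ.s≤s ℕ.z≤n

-- Cuts, cocycles and potential differences.

module Cuts {n m : ℕ} (G : Graph n m) where
  open GraphTheory G

  pot-resp : ∀ {v w} → v ≗v w → Pot v → Pot w
  pot-resp q (p , r) = p , λ e → trans (sym (q e)) (r e)

  pot-0 : Pot 0v
  pot-0 = (λ _ → 0ℤ) , λ _ → refl

  pot-+ : ∀ {v w} → Pot v → Pot w → Pot (v +v w)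
  pot-+ (p , r) (q , s) = (λ x → p x + q x) , λ e → trans (cong₂ _+_ (r e) (s e))
      (arith (p (head G e)) (p (tail G e)) (q (head G e)) (q (tail G e)))
    where
    arith : ∀ a b c d → a - b + (c - d) ≡ a + c - (b + d)
    arith = solve-∀

  pot-neg : ∀ {v} → Pot v → Pot (negv v)
  pot-neg (p , r) = (λ x → - p x) , λ e → trans (neg-cong (r e)) (arith (p (head G e)) (p (tail G e)))
    where
    arith : ∀ a b → - (a - b) ≡ - a - - b
    arith = solve-∀

  -- A cut vector points out of `S`, so its potential is lower on `S`; hence the minus sign before
  -- the indicator.
  cutvec-pot : ∀ S → Pot (cutvec G S)
  cutvec-pot S = (λ v → - β (lookup S v)) , λ e → eq (lookup S (tail G e)) (lookup S (head G e))
    where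
    eq : ∀ a b → cutvecAux G a b ≡ - β b - - β a
    eq true  true  = refl
    eq true  false = refl
    eq false true  = refl
    eq false false = refl

  cutvec-unit : ∀ S e → Unit (cutvec G S e)
  cutvec-unit S e with lookup S (tail G e) | lookup S (head G e)
  ... | true  | true  = u0
  ... | true  | false = u± true
  ... | false | true  = u± false
  ... | false | false = u0

  ∈-cutset⁺ : ∀ S e → cutvec G S e ≢ 0ℤ → e ∈ cutset G S
  ∈-cutset⁺ S e p = true⇒∈ (trans (Vecₚ.lookup∘tabulate _ e)
      (bool (lookup S (tail G e)) (lookup S (head G e)) p))
    where
    bool : ∀ a b → cutvecAux G a b ≢ 0ℤ → a xor b ≡ true
    bool true  true  q = ⊥-elim (q refl)
    bool true  false q = refl
    bool false true  q = refl
    bool false false q = ⊥-elim (q refl)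

  ∈-cutset⁻ : ∀ S e → e ∈ cutset G S → cutvec G S e ≢ 0ℤ
  ∈-cutset⁻ S e p = bool (lookup S (tail G e)) (lookup S (head G e))
      (trans (sym (Vecₚ.lookup∘tabulate _ e)) (∈⇒true p))
    where
    bool : ∀ a b → a xor b ≡ true → cutvecAux G a b ≢ 0ℤ
    bool true  false _ ()
    bool false true  _ ()

  cut-suppEq : ∀ S → SuppEq G (cutvec G S) (cutset G S)
  cut-suppEq S e = ∈-cutset⁻ S e , ∈-cutset⁺ S e

  isCut? : ∀ C → Dec (IsCut G C)
  isCut? C = Subsetₚ.anySubset? (λ S → Vecₚ.≡-dec Boolₚ._≟_ C (cutset G S)) ×-dec Finₚ.any?
      (λ e → e Subsetₚ.∈? C)

  private
    Smaller : Subset m → Subset m → Set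
    Smaller C C′ = IsCut G C′ × C′ ⊆ C × Σ (Fin m) λ e → e ∈ C × e ∉ C′

    smaller? : ∀ C → Dec (Σ (Subset m) (Smaller C))
    smaller? C = Subsetₚ.anySubset? (λ C′ → isCut? C′ ×-dec (C′ Subsetₚ.⊆? C) ×-dec
      Finₚ.any? (λ e → (e Subsetₚ.∈? C) ×-dec ¬? (e Subsetₚ.∈? C′)))

    no-smaller : ∀ {C} → IsCut G C → ¬ Σ (Subset m) (Smaller C) → IsCocycle G C
    no-smaller cut ¬p = cut , λ C′ cut′ sub {e} e∈C → inside C′ cut′ sub e e∈C
      where
      inside : ∀ C′ → IsCut G C′ → C′ ⊆ _ → ∀ e → e ∈ _ → e ∈ C′
      inside C′ cut′ sub e e∈C with e Subsetₚ.∈? C′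
      ... | yes q = q
      ... | no q  = ⊥-elim (¬p (C′ , cut′ , (λ {x} → sub {x}) , e , e∈C , q))

  isCocycle? : ∀ C → Dec (IsCocycle G C)
  isCocycle? C with isCut? C | smaller? C
  ... | no ¬p | _ = no (λ c → ¬p (proj₁ c))
  ... | yes _ | yes (C′ , cut′ , sub , e , e∈ , e∉) = no (λ c → e∉ (proj₂ c C′ cut′ sub e∈))
  ... | yes p | no q = yes (no-smaller p q)

  private
    -- The premise says that an edge crossing `S′` also crosses `S`. Intersecting with `S′` can then
    -- only remove edges from the cut of `S` and keeps the direction of the others; `conf-∨` is the
    -- same for the union.
    conf-∧ : ∀ s t s′ t′ → (s′ xor t′ ≡ true → s xor t ≡ true) →
        Conf (cutvecAux G (s ∧ s′) (t ∧ t′)) (cutvecAux G s t)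
    conf-∧ true  true  true  true  _ = c0
    conf-∧ true  true  false false _ = c0
    conf-∧ true  true  true  false h with h refl
    ... | ()
    conf-∧ true  true  false true  h with h refl
    ... | ()
    conf-∧ true  false true  _     _ = c+
    conf-∧ true  false false _     _ = c0
    conf-∧ false true  _     true  _ = c-
    conf-∧ false true  _     false _ = c0
    conf-∧ false false _     _     _ = c0

    conf-∨ : ∀ s t s′ t′ → (s′ xor t′ ≡ true → s xor t ≡ true) →
        Conf (cutvecAux G (s ∨ s′) (t ∨ t′)) (cutvecAux G s t)
    conf-∨ true  true  _     _     _ = c0
    conf-∨ true  false _     true  _ = c0
    conf-∨ true  false _     false _ = c+
    conf-∨ false true  true  _     _ = c0
    conf-∨ false true  false _     _ = c-
    conf-∨ false false true  true  _ = c0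
    conf-∨ false false false false _ = c0
    conf-∨ false false true  false h with h refl
    ... | ()
    conf-∨ false false false true  h with h refl
    ... | ()

    Finer : Subset n → Fin m → Fin m → Set
    Finer S e f = Σ (Subset n) λ S₁ → (∀ g → Conf (cutvec G S₁ g) (cutvec G S g)) ×
      cutvec G S₁ e ≢ 0ℤ × cutvec G S₁ f ≡ 0ℤ

    cutvec-tabulate : ∀ (f : Fin n → Bool) e → cutvecAux G (f (tail G e)) (f (head G e)) ≡ cutvec G
        (tabulate f) e
    cutvec-tabulate f e = sym (cong₂ (cutvecAux G) (Vecₚ.lookup∘tabulate f (tail G e))
        (Vecₚ.lookup∘tabulate f (head G e)))

    module _ (S : Subset n) (S′ : Fin n → Bool) (e f : Fin m)
      (sub : ∀ g → S′ (tail G g) xor S′ (head G g) ≡ true → lookup S (tail G g) xor lookup S (head G g) ≡ true)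
      (e∈S : lookup S (tail G e) xor lookup S (head G e) ≡ true)
      (tail≡ : lookup S (tail G e) ≡ S′ (tail G e)) (e∈S′ : S′ (tail G e) xor S′ (head G e) ≡ true) where

      private
        xor-cancel : ∀ a b c → a xor b ≡ true → a xor c ≡ true → b ≡ c
        xor-cancel true  false false _ _ = refl
        xor-cancel false true  true  _ _ = refl
        head≡ : lookup S (head G e) ≡ S′ (head G e)
        head≡ = xor-cancel (lookup S (tail G e)) _ _ e∈S (trans (cong (_xor S′ (head G e)) tail≡) e∈S′)
        ∧-same : ∀ a b a′ b′ → a ≡ a′ → b ≡ b′ → a xor b ≡ true → cutvecAux G (a ∧ a′) (b ∧ b′) ≢ 0ℤ
        ∧-same true false _ _ refl refl _ ()
        ∧-same false true _ _ refl refl _ ()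
        ∨-same : ∀ a b a′ b′ → a ≡ a′ → b ≡ b′ → a xor b ≡ true → cutvecAux G (a ∨ a′) (b ∨ b′) ≢ 0ℤ
        ∨-same true false _ _ refl refl _ ()
        ∨-same false true _ _ refl refl _ ()
        ∧-false : ∀ a b a′ b′ → a′ ≡ false → b′ ≡ false → cutvecAux G (a ∧ a′) (b ∧ b′) ≡ 0ℤ
        ∧-false a b _ _ refl refl rewrite Boolₚ.∧-zeroʳ a | Boolₚ.∧-zeroʳ b = refl
        ∨-true : ∀ a b a′ b′ → a′ ≡ true → b′ ≡ true → cutvecAux G (a ∨ a′) (b ∨ b′) ≡ 0ℤ
        ∨-true a b _ _ refl refl rewrite Boolₚ.∨-zeroʳ a | Boolₚ.∨-zeroʳ b = refl

      -- `S` and `S′` agree at both ends of `e`, so intersection and union both keep `e` in the cut.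
      -- The edge `f` lies on one side of `S′`: the intersection loses it if that is the outside,
      -- the union if it is the inside.
      finer : ∀ b → S′ (tail G f) ≡ b → S′ (head G f) ≡ b → Finer S e f
      finer false p q = tabulate g , (λ h → subst (λ x → Conf x _) (cutvec-tabulate g h)
          (conf-∧ _ _ _ _ (sub h))) ,
        subst (_≢ 0ℤ) (cutvec-tabulate g e) (∧-same _ _ _ _ tail≡ head≡ e∈S) ,
        trans (sym (cutvec-tabulate g f)) (∧-false (lookup S (tail G f)) (lookup S (head G f)) _ _ p q)
        where
        g : Fin n → Bool
        g v = lookup S v ∧ S′ v
      finer true p q = tabulate g , (λ h → subst (λ x → Conf x _) (cutvec-tabulate g h)
          (conf-∨ _ _ _ _ (sub h))) ,
        subst (_≢ 0ℤ) (cutvec-tabulate g e) (∨-same _ _ _ _ tail≡ head≡ e∈S) ,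
        trans (sym (cutvec-tabulate g f)) (∨-true (lookup S (tail G f)) (lookup S (head G f)) _ _ p q)
        where
        g : Fin n → Bool
        g v = lookup S v ∨ S′ v

  -- Split V by S and S′. No edge crosses S′ alone, so among the four cells or their
  -- complements one directed cut conforms to that of S, contains e and misses f.
  refine : ∀ S → Σ (Subset m) (Smaller (cutset G S)) → Σ (Fin m) λ e → Σ (Fin m) λ f →
      cutvec G S f ≢ 0ℤ × Finer S e f
  refine S (_ , ((S′ , refl) , e , e∈S′) , sub , f , f∈S , f∉S′) = e , f , ∈-cutset⁻ S f f∈S , result
    where
    crosses : Subset n → Fin m → Bool
    crosses R g = lookup R (tail G g) xor lookup R (head G g)
    cross⁻ : ∀ R {g} → g ∈ cutset G R → crosses R g ≡ true
    cross⁻ R {g} p = trans (sym (Vecₚ.lookup∘tabulate _ g)) (∈⇒true p)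
    cross⁺ : ∀ R {g} → crosses R g ≡ true → g ∈ cutset G R
    cross⁺ R {g} p = true⇒∈ (trans (Vecₚ.lookup∘tabulate _ g) p)
    sub′ : ∀ g → crosses S′ g ≡ true → crosses S g ≡ true
    sub′ g p = cross⁻ S (sub (cross⁺ S′ p))
    xor-not : ∀ a b → not a xor not b ≡ a xor b
    xor-not true  b = refl
    xor-not false b = Boolₚ.not-involutive b
    same : ∀ a b → (a xor b ≢ true) → b ≡ a
    same true  true  _ = refl
    same false false _ = refl
    same true  false n = ⊥-elim (n refl)
    same false true  n = ⊥-elim (n refl)
    f-same : lookup S′ (head G f) ≡ lookup S′ (tail G f)
    f-same = same _ _ (λ p → f∉S′ (cross⁺ S′ p))
    e∈S : crosses S e ≡ true
    e∈S = sub′ e (cross⁻ S′ e∈S′)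
    result : Finer S e f
    -- Replacing `S′` by its complement changes no crossing and makes it agree with `S` at the tail
    -- of `e`.
    result with lookup S (tail G e) Boolₚ.≟ lookup S′ (tail G e)
    ... | yes p = finer S (lookup S′) e f sub′ e∈S p (cross⁻ S′ e∈S′) _ refl f-same
    ... | no p = finer S (λ v → not (lookup S′ v)) e f
          (λ g q → sub′ g (trans (sym (xor-not (lookup S′ (tail G g)) (lookup S′ (head G g)))) q)) e∈S
            (trans (≢⇒not _ _ (λ q → p (sym q))) refl)
                (trans (xor-not (lookup S′ (tail G e)) (lookup S′ (head G e))) (cross⁻ S′ e∈S′)) _ refl
                (cong not f-same)

  private
    -- Each refinement passes to a conforming cut without `f`, so the number of edges drops;
    -- conformity is transitive.
    minimal : ∀ N S → sumℕ (λ e → ∣ cutvec G S e ∣) ℕ.< N → Σ (Fin m) (λ e → cutvec G S e ≢ 0ℤ) →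
      Σ (Subset n) λ S₁ → IsCocycle G (cutset G S₁) × ∀ g → Conf (cutvec G S₁ g) (cutvec G S g)
    minimal (suc N) S lt (e , se) with smaller? (cutset G S)
    ... | no ¬p = S , no-smaller ((S , refl) , e , ∈-cutset⁺ S e se) ¬p ,
        λ g → conf-refl (cutvec-unit S g)
      where
      conf-refl : ∀ {x} → Unit x → Conf x x
      conf-refl u0 = c0
      conf-refl (u± true) = c+
      conf-refl (u± false) = c-
    ... | yes p with refine S p
    ...   | e′ , f , Sf , S₁ , conf , S₁e , S₁f with minimal N S₁
              (ℕₚ.<-≤-trans (sumℕ-< (λ g → conf-∣∣ (conf g)) f
                  (ℕₚ.≤-trans (ℕ.s≤s (ℕₚ.≤-reflexive (cong ∣_∣ S₁f))) (pos (cutvec-unit S f) Sf)))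
                  (ℕₚ.≤-pred lt))
              (e′ , S₁e)
      where
      pos : ∀ {x} → Unit x → x ≢ 0ℤ → 1 ℕ.≤ ∣ x ∣
      pos u0 p = ⊥-elim (p refl)
      pos (u± true) _ = ℕₚ.≤-refl
      pos (u± false) _ = ℕₚ.≤-refl
    ...     | S₂ , coc , conf₂ = S₂ , coc , λ g → conf-trans (conf₂ g) (conf g)

  -- Let `S` collect the vertices with potential at most that of the start of the arc following `w`
  -- at `e`. The potential rises along every edge out of `S`, so the cut conforms to `w`, and `e`
  -- crosses it. A cocycle conforming to this cut is then taken.
  pot-extract : ∀ {w} → Pot w → ∀ e → w e ≢ 0ℤ → Σ (Subset n) λ S → IsCocycle G (cutset G S) × ∀ g →
      Conf (cutvec G S g) (w g)
  pot-extract {w} (p , w≗) e we with conf-exists (λ q → we (trans (w≗ e) q))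
  ... | b , conf = let (S₁ , coc , conf₁) = minimal _ S ℕₚ.≤-refl (e , nz b conf)
                   in S₁ , coc , λ g → subst (Conf _) (sym (w≗ g)) (conf-trans (conf₁ g) (level-conf g))
    where
    t : ℤ
    t = p (start G (e , b))
    S : Subset n
    S = tabulate (λ v → isYes (p v ℤ.≤? t))
    pos-diff : ∀ x y → ¬ x ℤ.≤ y → Conf +1ℤ (x - y)
    pos-diff x y n with x - y in eq
    ... | + suc k = c+
    ... | + zero = ⊥-elim (n (ℤₚ.≤-reflexive (ℤₚ.i-j≡0⇒i≡j x y eq)))
    ... | -[1+ k ] = ⊥-elim (n (ℤₚ.i-j≤0⇒i≤j (subst (ℤ._≤ 0ℤ) (sym eq) ℤ.-≤+)))
    neg-diff : ∀ x y → ¬ y ℤ.≤ x → Conf -1ℤ (x - y)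
    neg-diff x y n with pos-diff y x n
    ... | c = subst (Conf -1ℤ) (arith x y) (flipc c)
      where
      arith : ∀ x y → - (y - x) ≡ x - y
      arith = solve-∀
      flipc : ∀ {z} → Conf +1ℤ z → Conf -1ℤ (- z)
      flipc c+ = c-
    level : ∀ x y → Conf (cutvecAux G (isYes (x ℤ.≤? t)) (isYes (y ℤ.≤? t))) (y - x)
    level x y with x ℤ.≤? t | y ℤ.≤? t
    ... | yes _ | yes _ = c0
    ... | no _  | no _  = c0
    ... | yes x≤ | no y≰ = pos-diff y x (λ q → y≰ (ℤₚ.≤-trans q x≤))
    ... | no x≰ | yes y≤ = neg-diff y x (λ q → x≰ (ℤₚ.≤-trans q y≤))
    level-conf : ∀ g → Conf (cutvec G S g) (δ p g)
    level-conf g = subst (λ x → Conf x (δ p g)) (cutvec-tabulate (λ v → isYes (p v ℤ.≤? t)) g)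
        (level (p (tail G g)) (p (head G g)))
    strict : ∀ {x y} → Conf +1ℤ (y - x) → ¬ y ℤ.≤ x
    strict {x} {y} c q with y - x | c | ℤₚ.i≤j⇒i-j≤0 q
    ... | _ | c+ | ℤ.+≤+ ()
    strict′ : ∀ {x y} → Conf -1ℤ (y - x) → ¬ x ℤ.≤ y
    strict′ {x} {y} c q with y - x | c | ℤₚ.i≤j⇒0≤j-i q
    ... | _ | c- | ()
    nz : ∀ b → Conf (sgn b) (δ p e) → cutvec G (tabulate (λ v → isYes (p v ℤ.≤? p (start G (e , b))))) e ≢ 0ℤ
    nz b conf = subst (_≢ 0ℤ) (cutvec-tabulate (λ v → isYes (p v ℤ.≤? p (start G (e , b)))) e) (at b conf)
      where
      at : ∀ b → Conf (sgn b) (δ p e) → cutvecAux G (isYes (p (tail G e) ℤ.≤? p (start G (e , b))))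
          (isYes (p (head G e) ℤ.≤? p (start G (e , b)))) ≢ 0ℤ
      at true c with p (tail G e) ℤ.≤? p (tail G e) | p (head G e) ℤ.≤? p (tail G e)
      ... | no q | _ = ⊥-elim (q ℤₚ.≤-refl)
      ... | yes _ | yes q = ⊥-elim (strict c q)
      ... | yes _ | no _ = λ ()
      at false c with p (tail G e) ℤ.≤? p (head G e) | p (head G e) ℤ.≤? p (head G e)
      ... | _ | no q = ⊥-elim (q ℤₚ.≤-refl)
      ... | yes q | yes _ = ⊥-elim (strict′ c q)
      ... | no _ | yes _ = λ ()

-- The system of cocycles of a connected graph.

module _ {n m : ℕ} (G : Graph n m) (conn : Connected G) where
  open GraphTheory G
  open Cuts G

  connected-constant : ∀ {A : Set} (f : Fin n → A) → (∀ e → f (tail G e) ≡ f (head G e)) → ∀ u v → f v ≡ f u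
  connected-constant f p u v = along (conn u v)
    where
    along : ∀ {v} → Reach G _ u v → f v ≡ f u
    along here = refl
    along (fwd {e} _ r) = trans (sym (p e)) (along r)
    along (bwd {e} _ r) = trans (p e) (along r)

  -- Two vertex sets with the same cut have a symmetric difference that no edge leaves.
  cut-dichotomy : ∀ S S′ e → cutvec G S e ≢ 0ℤ → (∀ f → cutvec G S f ≡ 0ℤ → cutvec G S′ f ≡ 0ℤ) →
      (∀ f → cutvec G S′ f ≡ 0ℤ → cutvec G S f ≡ 0ℤ) →
    (cutvec G S′ ≗v cutvec G S) ⊎ (cutvec G S′ ≗v negv (cutvec G S))
  cut-dichotomy S S′ e se p q = by (r (tail G e)) refl
    where
    r : Fin n → Bool
    r v = lookup S v xor lookup S′ v
    same : ∀ a b a′ b′ → (cutvecAux G a b ≡ 0ℤ → cutvecAux G a′ b′ ≡ 0ℤ) →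
        (cutvecAux G a′ b′ ≡ 0ℤ → cutvecAux G a b ≡ 0ℤ) → a xor a′ ≡ b xor b′
    same true  true  true  true  _ _ = refl
    same true  true  false false _ _ = refl
    same false false true  true  _ _ = refl
    same false false false false _ _ = refl
    same true  false true  false _ _ = refl
    same true  false false true  _ _ = refl
    same false true  true  false _ _ = refl
    same false true  false true  _ _ = refl
    same true  true  true  false f _ with f refl
    ... | ()
    same true  true  false true  f _ with f refl
    ... | ()
    same false false true  false f _ with f refl
    ... | ()
    same false false false true  f _ with f refl
    ... | ()
    same true  false true  true  _ g with g refl
    ... | ()
    same true  false false false _ g with g refl
    ... | ()
    same false true  true  true  _ g with g refl
    ... | ()
    same false true  false false _ g with g refl
    ... | ()
    const : ∀ v → r v ≡ r (tail G e)
    const = connected-constant r (λ f → same _ _ (lookup S′ (tail G f)) _ (p f) (q f)) (tail G e)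
    equal : ∀ a b a′ b′ → a xor a′ ≡ false → b xor b′ ≡ false → cutvecAux G a′ b′ ≡ cutvecAux G a b
    equal true  true  true  true  _ _ = refl
    equal true  false true  false _ _ = refl
    equal false true  false true  _ _ = refl
    equal false false false false _ _ = refl
    opposite : ∀ a b a′ b′ → a xor a′ ≡ true → b xor b′ ≡ true → cutvecAux G a′ b′ ≡ - cutvecAux G a b
    opposite true  true  false false _ _ = refl
    opposite true  false false true  _ _ = refl
    opposite false true  true  false _ _ = refl
    opposite false false true  true  _ _ = refl
    by : ∀ b → r (tail G e) ≡ b → (cutvec G S′ ≗v cutvec G S) ⊎ (cutvec G S′ ≗v negv (cutvec G S))
    by false x = inj₁ (λ f → equal (lookup S (tail G f)) (lookup S (head G f)) (lookup S′ (tail G f))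
        (lookup S′ (head G f))
      (trans (const (tail G f)) x) (trans (const (head G f)) x))
    by true x = inj₂ (λ f → opposite (lookup S (tail G f)) (lookup S (head G f)) (lookup S′ (tail G f))
        (lookup S′ (head G f))
      (trans (const (tail G f)) x) (trans (const (head G f)) x))

  module _ (σ* : Subset m → Vector m) (sig : CocycleSignature G σ*) where
    open Signed G (IsCocycle G) σ*

    cocycle-signed : ∀ S → IsCocycle G (cutset G S) → Positive (cutvec G S) ⊎ Positive (negv (cutvec G S))
    cocycle-signed S coc@((_ , e , e∈) , _) = sign (proj₁ signed)
      where
      C : Subset m
      C = cutset G S
      signed : IsDirCocycle G (σ* C) × SuppEq G (σ* C) C
      signed = proj₁ sig C coc
      sign : IsDirCocycle G (σ* C) → Positive (cutvec G S) ⊎ Positive (negv (cutvec G S))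
      sign (S′ , _ , p) = sign′ (cut-dichotomy S S′ e (∈-cutset⁻ S e e∈)
          (λ f x → trans (sym (p f)) (suppEq-0 G (cut-suppEq S) (proj₂ signed) f x))
          (λ f x → suppEq-0 G (proj₂ signed) (cut-suppEq S) f (trans (p f) x)))
        where
        sign′ : (cutvec G S′ ≗v cutvec G S) ⊎ (cutvec G S′ ≗v negv (cutvec G S)) → Positive (cutvec G S) ⊎
            Positive (negv (cutvec G S))
        sign′ (inj₁ q) = inj₁ (C , coc , λ f → trans (sym (q f)) (sym (p f)))
        sign′ (inj₂ q) = inj₂ (C , coc , λ f → trans (sym (q f)) (sym (p f)))

    cutSystem : System m
    cutSystem = record
      { L = Pot
      ; L-resp = pot-resp
      ; L-0 = pot-0
      ; L-+ = pot-+
      ; L-neg = pot-neg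
      ; Pos = Positive
      ; Pos-L = λ (C , c , p) → let (S , _ , q) = proj₁ (proj₁ sig C c) in
          pot-resp (λ e → sym (trans (p e) (q e))) (cutvec-pot S)
      ; Pos-unit = λ (C , c , p) e → let (S , _ , q) = proj₁ (proj₁ sig C c) in
          subst Unit (sym (trans (p e) (q e))) (cutvec-unit S e)
      ; Pos-nz = λ (C , c , p) → let (e , e∈) = proj₂ (proj₁ c) in
          e , λ x → proj₁ (proj₂ (proj₁ sig C c) e) e∈ (trans (sym (p e)) x)
      ; extract = λ c e we → let (S , coc , conf) = pot-extract c e we in cutvec G S , cocycle-signed S coc , conf
      ; pointed = acyclic-pointed (proj₂ sig)
      ; search = search′ }
      where
      search′ : ∀ s → Dec (Σ (Vector m) λ v → Positive v × Fits s (negv v))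
      search′ s with Subsetₚ.anySubset? (λ C → isCocycle? C ×-dec Finₚ.all? (λ e → Fit? (s e) (- σ* C e)))
      ... | yes (C , c , fit) = yes (σ* C , (C , c , λ _ → refl) , fit)
      ... | no ¬p = no λ (v , (C , c , p) , fit) → ¬p (C , c , λ e → subst (Fit (s e)) (neg-cong (p e)) (fit e))

-- Spanning trees and compatible orientations in terms of the two systems.

module Signatures {n m : ℕ} (G : Graph n m) (conn : Connected G)
  (σ : Subset m → Vector m) (sig : CycleSignature G σ) (σ* : Subset m → Vector m) (sig* : CocycleSignature G σ*) where
  open GraphTheory G

  cycles cuts : System m
  cycles = cycleSystem G σ sig
  cuts   = cutSystem G conn σ* sig*

  duality : DualPair cycles cuts
  duality = record
    { orth  = λ { {z} {w} c (p , q) → trans (dot-cong {v = z} {z} {w} {δ p} (λ _ → refl) q) (c p) }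
    ; minty = minty-graph }

  forest-indep : ∀ {T} → SpanningForest G T → Indep cycles (lookup T)
  forest-indep {T} forest z c off with nonzero? z
  ... | inj₂ p = p
  ... | inj₁ (e , ze) = acyclic (circ-extract G c e ze)
    where
    acyclic : (Σ (Vector m) λ v → IsDirCycle G v × (∀ f → Conf (v f) (z f))) → z ≗v 0v
    acyclic (v , d , conf) = ⊥-elim (forest (support v) (v , d , support-suppEq G v) inside)
      where
      inside : support v ⊆ T
      inside {f} f∈ with lookup T f in eq
      ... | true  = true⇒∈ eq
      ... | false = ⊥-elim (∈-support⁻ v f f∈ (conf-0 G (conf f) (off f eq)))

  indep-forest : ∀ {T} → Indep cycles (lookup T) → SpanningForest G T
  indep-forest {T} ind C (v , d , supp) C⊆T = let (e , ve) = Cycles.rep-nz G (proj₁ d) (proj₂ d) in ve (ind v (dirCycle-circ G d) off e)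
    where
    off : ∀ e → lookup T e ≡ false → v e ≡ 0ℤ
    off e Te with v e ℤ.≟ 0ℤ
    ... | yes p = p
    ... | no p with trans (sym Te) (∈⇒true (C⊆T (proj₂ (supp e) p)))
    ...   | ()

  spanning-indep : ∀ {T} → (∀ u v → Reach G T u v) → Indep cuts (λ e → not (lookup T e))
  spanning-indep {T} reach w (p , w≗) off e = trans (w≗ e)
      (trans (cong (_- p (tail G e)) (constant (reach (tail G e) (head G e)))) (ℤₚ.+-inverseʳ (p (tail G e))))
    where
    level : ∀ {e} → e ∈ T → p (head G e) ≡ p (tail G e)
    level {e} e∈ = ℤₚ.i-j≡0⇒i≡j _ _ (trans (sym (w≗ e)) (off e (cong not (∈⇒true e∈))))
    constant : ∀ {u v} → Reach G T u v → p v ≡ p u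
    constant here = refl
    constant (fwd e∈ r) = trans (level e∈) (constant r)
    constant (bwd e∈ r) = trans (sym (level e∈)) (constant r)

  -- The indicator of the set reachable within `T` has a coboundary vanishing on `T`, hence
  -- everywhere; as `G` is connected, the set contains all vertices.
  indep-spanning : ∀ {T} → Indep cuts (λ e → not (lookup T e)) → ∀ u v → Reach G T u v
  indep-spanning {T} ind u v = toReach (Reachable.walk R v
      (trans (connected-constant G conn r level u v) (Reachable.source R)))
    where
    A : Arc → Set
    A a = lookup T (proj₁ a) ≡ true
    R : Reachable A u
    R = reachable (λ a → lookup T (proj₁ a) Boolₚ.≟ true) u
    r : Fin n → Bool
    r = Reachable.reached R
    toReach : ∀ {v} → Walk A u v → Reach G T u v
    toReach stay = here
    toReach (extend {e , true}  w p) = fwd (true⇒∈ p) (toReach w)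
    toReach (extend {e , false} w p) = bwd (true⇒∈ p) (toReach w)
    w : Vector m
    w = δ (λ v → β (r v))
    both : ∀ a b → (a ≡ true → b ≡ true) → (b ≡ true → a ≡ true) → β b - β a ≡ 0ℤ
    both true  true  _ _ = refl
    both false false _ _ = refl
    both true  false f _ with f refl
    ... | ()
    both false true  _ g with g refl
    ... | ()
    level : ∀ e → r (tail G e) ≡ r (head G e)
    level e = sym (β-injective (ℤₚ.i-j≡0⇒i≡j _ _ (ind w ((λ v → β (r v)) , λ _ → refl) off e)))
      where
      off : ∀ f → not (lookup T f) ≡ false → w f ≡ 0ℤ
      off f Tf = both (r (tail G f)) (r (head G f)) (Reachable.saturated R (f , true) (not-≡-false Tf))
          (Reachable.saturated R (f , false) (not-≡-false Tf))

  open Trees cycles cuts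

  base-of-tree : ∀ {T} → SpanningTree G T → Base (lookup T)
  base-of-tree (forest , reach) = record { ind = forest-indep forest ; ind* = spanning-indep reach }

  tree-from-base : ∀ {T} → Base (lookup T) → SpanningTree G T
  tree-from-base B = indep-forest (ind B) , indep-spanning (ind* B)

  private
    fit-sgn : ∀ o b → Fit (dir o) (sgn b) → o ≡ b
    fit-sgn true  true  _ = refl
    fit-sgn false false _ = refl
    fit-sgn true  false ()
    fit-sgn false true  (ℤ.+≤+ ())

    contained : ∀ {v O} → Fits (λ e → dir (O e)) v → ContainedIn G v O
    contained {v} {O} fit e = (λ p → fit-sgn (O e) true (subst (Fit (dir (O e))) p (fit e))) ,
                              (λ p → fit-sgn (O e) false (subst (Fit (dir (O e))) p (fit e)))

    contained⁻ : ∀ {v O} → (∀ e → Unit (v e)) → ContainedIn G v O → Fits (λ e → dir (O e)) v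
    contained⁻ {v} {O} unital c e = by (v e) refl (unital e)
      where
      by : ∀ x → v e ≡ x → Unit x → Fit (dir (O e)) (v e)
      by _ p u0 = subst (Fit (dir (O e))) (sym p) (Fit-0 (dir (O e)))
      by _ p (u± true) = subst₂ (λ o x → Fit (dir o) x) (sym (proj₁ (c e) p)) (sym p) (Fit-sgn true)
      by _ p (u± false) = subst₂ (λ o x → Fit (dir o) x) (sym (proj₂ (c e) p)) (sym p) (Fit-sgn false)

    conf-opposite : ∀ {u x} → Conf u (- x) → u ≡ x → u ≡ 0ℤ
    conf-opposite {x = x} c refl = self x c
      where
      self : ∀ x → Conf x (- x) → x ≡ 0ℤ
      self (+ zero) _ = refl
      self (+ suc zero) ()
      self (+ suc (suc _)) ()
      self -[1+ zero ] ()
      self -[1+ suc _ ] ()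

  -- Rather than reversing the walk of `σ C`, a cycle `u` is traced inside `negv v`. It is contained
  -- in `O`, hence positive, and supported on `C`, hence plus or minus `σ C`. The sign of `negv v`
  -- excludes plus, acyclicity excludes minus.
  compatible-comp : ∀ O → Compatible G σ O → Comp cycles (λ e → dir (O e))
  compatible-comp O compat v pv@(C , c , v≗) fit = traced
      (circ-extract G (L-neg cycles {v} (Pos-L cycles pv)) _ (neg-≢0 (proj₂ (Pos-nz cycles pv))))
    where
    traced : (Σ (Vector m) λ u → IsDirCycle G u × (∀ f → Conf (u f) (- v f))) → ⊥
    traced (u , d , conf) = contra (compat u d (contained {u} (λ e → Fit-conf (dir (O e)) (conf e) (fit e))))
      (dirCycle-dichotomy G (proj₁ (proj₁ sig C c)) d
        (λ e p → conf-0 G (conf e) (neg-cong (trans (v≗ e) p))))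
      where
      nz : Σ (Fin m) λ e → u e ≢ 0ℤ
      nz = Cycles.rep-nz G (proj₁ d) (proj₂ d)
      contra : (Σ (Subset m) λ C′ → IsCycle G C′ × u ≗v σ C′) → (u ≗v σ C) ⊎ (u ≗v negv (σ C)) → ⊥
      contra _ (inj₁ p) = proj₂ nz (conf-opposite (conf _) (trans (p _) (sym (v≗ _))))
      contra pu (inj₂ p) = proj₂ (Pos-nz cycles pv) (pointed cycles (cone-Pos pv)
        (cone-resp (λ e → trans (neg-cong (v≗ e)) (sym (p e))) (cone-Pos pu)) _)

  comp-compatible : ∀ O → Comp cycles (λ e → dir (O e)) → Compatible G σ O
  comp-compatible O comp v d cont = signed (dirCycle-signed G σ sig d)
    where
    signed : Pos cycles v ⊎ Pos cycles (negv v) → Pos cycles v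
    signed (inj₁ p) = p
    signed (inj₂ p) = ⊥-elim (comp _ p (λ e → subst (Fit (dir (O e))) (sym (ℤₚ.neg-involutive (v e)))
      (contained⁻ {v} (Cycles.rep-unit G (proj₁ d) (proj₂ d)) cont e)))

-- Rational coordinates and half-open intervals.

fromℤ-+ : ∀ a b → fromℤ (a + b) ≡ fromℤ a ℚ.+ fromℤ b
fromℤ-+ a b = ℚₚ.toℚᵘ-injective (begin
  ℚ.toℚᵘ (fromℤ (a + b))                      ≈⟨ ℚₚ.toℚᵘ-fromℚᵘ (ℚᵘ.mkℚᵘ (a + b) 0) ⟩
  ℚᵘ.mkℚᵘ (a + b) 0                           ≈⟨ ℚᵘ.*≡* (arith a b) ⟩
  ℚᵘ.mkℚᵘ a 0 ℚᵘ.+ ℚᵘ.mkℚᵘ b 0                ≈⟨ ℚᵘₚ.+-cong (ℚₚ.toℚᵘ-fromℚᵘ (ℚᵘ.mkℚᵘ a 0))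
      (ℚₚ.toℚᵘ-fromℚᵘ (ℚᵘ.mkℚᵘ b 0)) ⟨
  ℚ.toℚᵘ (fromℤ a) ℚᵘ.+ ℚ.toℚᵘ (fromℤ b)      ≈⟨ ℚₚ.toℚᵘ-homo-+ (fromℤ a) (fromℤ b) ⟨
  ℚ.toℚᵘ (fromℤ a ℚ.+ fromℤ b)                ∎)
  where
  open ℚᵘₚ.≃-Reasoning
  arith : ∀ a b → (a + b) * +1ℤ ≡ (a * +1ℤ + b * +1ℤ) * +1ℤ
  arith = solve-∀

fromℤ-injective : ∀ {a b} → fromℤ a ≡ fromℤ b → a ≡ b
fromℤ-injective {a} {b} p = trans (sym (ℤₚ.*-identityʳ a)) (trans (ℚᵘₚ.drop-*≡* (ℚᵘₚ.≃-trans
  (ℚᵘₚ.≃-sym (ℚₚ.toℚᵘ-fromℚᵘ (ℚᵘ.mkℚᵘ a 0))) (ℚᵘₚ.≃-trans (ℚᵘₚ.≃-reflexive (cong ℚ.toℚᵘ p))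
      (ℚₚ.toℚᵘ-fromℚᵘ (ℚᵘ.mkℚᵘ b 0))))) (ℤₚ.*-identityʳ b))

fromℤ-minus : ∀ a b → fromℤ (a - b) ≡ fromℤ a ℚ.- fromℤ b
fromℤ-minus a b = ℚGroup.∙-cancelʳ (fromℤ b) _ _ (begin
  fromℤ (a - b) ℚ.+ fromℤ b              ≡⟨ sym (fromℤ-+ (a - b) b) ⟩
  fromℤ (a - b + b)                      ≡⟨ cong fromℤ (arith a b) ⟩
  fromℤ a                                ≡⟨ sym (ℚₚ.+-identityʳ _) ⟩
  fromℤ a ℚ.+ 0ℚ                         ≡⟨ cong (fromℤ a ℚ.+_) (sym (ℚₚ.+-inverseˡ (fromℤ b))) ⟩
  fromℤ a ℚ.+ (ℚ.- fromℤ b ℚ.+ fromℤ b)  ≡⟨ sym (ℚₚ.+-assoc (fromℤ a) _ _) ⟩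
  fromℤ a ℚ.- fromℤ b ℚ.+ fromℤ b        ∎)
  where
  open ≡-Reasoning
  arith : ∀ a b → a - b + b ≡ a
  arith = solve-∀

βℚ : Bool → ℚ
βℚ true  = 1ℚ
βℚ false = 0ℚ

fromℤ-β : ∀ b → fromℤ (β b) ≡ βℚ b
fromℤ-β true  = refl
fromℤ-β false = refl

βℚ-shift : ∀ p o → βℚ o ℚ.+ fromℤ (β p - β o) ≡ βℚ p
βℚ-shift true  true  = refl
βℚ-shift true  false = refl
βℚ-shift false true  = refl
βℚ-shift false false = refl

βℚ-unshift : ∀ p o {q} → q ℚ.+ fromℤ (β p - β o) ≡ βℚ p → q ≡ βℚ o
βℚ-unshift p o {q} eq = ℚGroup.∙-cancelʳ (fromℤ (β p - β o)) q (βℚ o) (trans eq (sym (βℚ-shift p o)))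

0≤1 : 0ℚ ℚ.≤ 1ℚ
0≤1 = ℚ.*≤* (ℤ.+≤+ ℕ.z≤n)

0<1 : 0ℚ ℚ.< 1ℚ
0<1 = ℚ.*<* (ℤ.+<+ (ℕ.s≤s ℕ.z≤n))

Within : ℚ → Set
Within q = 0ℚ ℚ.≤ q × q ℚ.≤ 1ℚ

βℚ-within : ∀ b → Within (βℚ b)
βℚ-within true  = 0≤1 , ℚₚ.≤-refl
βℚ-within false = ℚₚ.≤-refl , 0≤1

Bi : ℚ → Set
Bi q = 0ℚ ℚ.< q × q ℚ.< 1ℚ

-- The condition that InHoc places on one coordinate: t tells whether the edge is in the
-- tree and p is the direction that the signatures give it.
Hoc₁ : Bool → Bool → ℚ → Set
Hoc₁ false p x = x ≡ βℚ p
Hoc₁ true  p x = x ≡ βℚ p ⊎ Bi x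

-- No integer lies strictly between 0 and 1, so an integral coordinate is not bi-oriented and has
-- the value prescribed by the tree.
hoc-integral : ∀ t p {x} z → x ≡ fromℤ z → Within x → Hoc₁ t p x → z ≡ β p
hoc-integral false p z eq _ h = fromℤ-injective (trans (sym eq) (trans h (sym (fromℤ-β p))))
hoc-integral true  p z eq _ (inj₁ h) = fromℤ-injective (trans (sym eq) (trans h (sym (fromℤ-β p))))
hoc-integral true  p z refl _ (inj₂ (a , b)) = ⊥-elim (between z (pos z a) (below z b))
  where
  pos : ∀ z → 0ℚ ℚ.< fromℤ z → 0ℤ ℤ.< z
  pos z q = subst₂ ℤ._<_ refl (ℤₚ.*-identityʳ z)
    (ℚᵘₚ.drop-*<* (ℚᵘₚ.<-respʳ-≃ (ℚₚ.toℚᵘ-fromℚᵘ (ℚᵘ.mkℚᵘ z 0)) (ℚₚ.toℚᵘ-mono-< q)))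
  below : ∀ z → fromℤ z ℚ.< 1ℚ → z ℤ.< +1ℤ
  below z q = subst₂ ℤ._<_ (ℤₚ.*-identityʳ z) refl
    (ℚᵘₚ.drop-*<* (ℚᵘₚ.<-respˡ-≃ (ℚₚ.toℚᵘ-fromℚᵘ (ℚᵘ.mkℚᵘ z 0)) (ℚₚ.toℚᵘ-mono-< q)))
  between : ∀ z → 0ℤ ℤ.< z → z ℤ.< +1ℤ → ⊥
  between (+ zero) (ℤ.+<+ ()) _
  between (+ suc n) _ (ℤ.+<+ (ℕ.s≤s ()))

cell : Bool → Bool → Bool → HInterval
cell true true  true  = lopen +1ℤ
cell true false false = ropen 0ℤ
cell _    _     o     = point (β o)

cell-nonpoint⁺ : ∀ t p o → t ≡ true → p ≡ o → NonPoint (cell t p o)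
cell-nonpoint⁺ true true  true  _ _ = tt
cell-nonpoint⁺ true false false _ _ = tt

cell-nonpoint⁻ : ∀ t p o → NonPoint (cell t p o) → t ≡ true × p ≡ o
cell-nonpoint⁻ true true  true  _ = refl , refl
cell-nonpoint⁻ true false false _ = refl , refl

private
  split-≤ : ∀ {p q} → p ℚ.≤ q → p ≡ q ⊎ p ℚ.< q
  split-≤ {p} {q} le with ℚₚ.<-cmp p q
  ... | tri< l _ _ = inj₂ l
  ... | tri≈ _ e _ = inj₁ e
  ... | tri> _ _ g = ⊥-elim (ℚₚ.<-irrefl refl (ℚₚ.<-≤-trans g le))

  q+0 : ∀ {q} → q ℚ.+ 0ℚ ≡ q
  q+0 {q} = ℚₚ.+-identityʳ q

  at-point : ∀ p o {q} → q ≡ βℚ o → Within q × Within (q ℚ.+ fromℤ (β p - β o)) × q ℚ.+ fromℤ (β p - β o) ≡ βℚ p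
  at-point p o refl = βℚ-within o , subst Within (sym (βℚ-shift p o)) (βℚ-within p) , βℚ-shift p o

cell-from-hoc : ∀ t p o q → Within q → Hoc₁ t p (q ℚ.+ fromℤ (β p - β o)) → q ∈I cell t p o
cell-from-hoc false p     o     q _ h = trans (βℚ-unshift p o h) (sym (fromℤ-β o))
cell-from-hoc true  true  false q _ (inj₁ h) = βℚ-unshift true false h
cell-from-hoc true  true  false q (q≥0 , _) (inj₂ (_ , h)) =
  ⊥-elim (ℚₚ.<-irrefl refl (ℚₚ.<-≤-trans h (ℚₚ.+-monoˡ-≤ 1ℚ q≥0)))
cell-from-hoc true  false true  q _ (inj₁ h) = βℚ-unshift false true h
cell-from-hoc true  false true  q (_ , q≤1) (inj₂ (h , _)) =
  ⊥-elim (ℚₚ.<-irrefl refl (ℚₚ.<-≤-trans h (ℚₚ.+-monoˡ-≤ (ℚ.- 1ℚ) q≤1)))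
cell-from-hoc true  true  true  q w (inj₁ h) = subst (0ℚ ℚ.<_) (sym (βℚ-unshift true true h)) 0<1 , proj₂ w
cell-from-hoc true  true  true  q w (inj₂ (h , _)) = subst (0ℚ ℚ.<_) q+0 h , proj₂ w
cell-from-hoc true  false false q w (inj₁ h) = proj₁ w , subst (ℚ._< 1ℚ) (sym (βℚ-unshift false false h)) 0<1
cell-from-hoc true  false false q w (inj₂ (_ , h)) = proj₁ w , subst (ℚ._< 1ℚ) q+0 h

hoc-from-cell : ∀ t p o q → q ∈I cell t p o →
  Within q × Within (q ℚ.+ fromℤ (β p - β o)) × Hoc₁ t p (q ℚ.+ fromℤ (β p - β o))
hoc-from-cell false p o q h = at-point p o (trans h (fromℤ-β o))
hoc-from-cell true  true  false q h = let (a , b , c) = at-point true false h in a , b , inj₁ c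
hoc-from-cell true  false true  q h = let (a , b , c) = at-point false true h in a , b , inj₁ c
hoc-from-cell true  true  true  q (h , k) = (ℚₚ.<⇒≤ h , k) , subst Within (sym q+0) (ℚₚ.<⇒≤ h , k) , last
    (split-≤ k)
  where
  last : q ≡ 1ℚ ⊎ q ℚ.< 1ℚ → _
  last (inj₁ e) = inj₁ (trans q+0 e)
  last (inj₂ l) = inj₂ (subst Bi (sym q+0) (h , l))
hoc-from-cell true  false false q (h , k) = (h , ℚₚ.<⇒≤ k) , subst Within (sym q+0) (h , ℚₚ.<⇒≤ k) , last
    (split-≤ h)
  where
  last : 0ℚ ≡ q ⊎ 0ℚ ℚ.< q → _
  last (inj₁ e) = inj₁ (trans q+0 (sym e))
  last (inj₂ l) = inj₂ (subst Bi (sym q+0) (l , k))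

private
  ½ : ℚ
  ½ = + 1 ℚ./ 2

  -1<-½ : ℚ.- 1ℚ ℚ.< ℚ.- ½
  -1<-½ = ℚ.*<* (ℤ.-<- (ℕ.s≤s ℕ.z≤n))

  shift-< : ∀ a {x y} → x ℚ.< y → a ℚ.+ x ℚ.< a ℚ.+ y
  shift-< a = ℚₚ.+-monoʳ-< a

-- The closed endpoint and the midpoint serve.
two-points : ∀ I → NonPoint I → Σ ℚ λ a → Σ ℚ λ b → a ∈I I × b ∈I I × a ≢ b
two-points (lopen z) _ = fromℤ z , fromℤ z ℚ.- ½ ,
  (subst₂ ℚ._<_ (sym (fromℤ-minus z +1ℤ)) (ℚₚ.+-identityʳ (fromℤ z))
      (shift-< (fromℤ z) (ℚₚ.<-trans -1<-½ -½<0)) , ℚₚ.≤-refl) ,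
  (subst (ℚ._< fromℤ z ℚ.- ½) (sym (fromℤ-minus z +1ℤ)) (shift-< (fromℤ z) -1<-½) , ℚₚ.<⇒≤ lt) ,
  λ e → ℚₚ.<-irrefl (sym e) lt
  where
  -½<0 : ℚ.- ½ ℚ.< 0ℚ
  -½<0 = ℚ.*<* ℤ.-<+
  lt : fromℤ z ℚ.- ½ ℚ.< fromℤ z
  lt = subst (fromℤ z ℚ.- ½ ℚ.<_) (ℚₚ.+-identityʳ (fromℤ z)) (shift-< (fromℤ z) -½<0)
two-points (ropen z) _ = fromℤ z , fromℤ z ℚ.+ ½ ,
  (ℚₚ.≤-refl , subst₂ ℚ._<_ (ℚₚ.+-identityʳ (fromℤ z)) (sym (fromℤ-+ z +1ℤ)) (shift-< (fromℤ z) 0<1)) ,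
  (ℚₚ.<⇒≤ lt , subst (fromℤ z ℚ.+ ½ ℚ.<_) (sym (fromℤ-+ z +1ℤ)) (shift-< (fromℤ z) ½<1)) ,
  λ e → ℚₚ.<-irrefl e lt
  where
  0<½ : 0ℚ ℚ.< ½
  0<½ = ℚ.*<* (ℤ.+<+ (ℕ.s≤s ℕ.z≤n))
  ½<1 : ½ ℚ.< 1ℚ
  ½<1 = ℚ.*<* (ℤ.+<+ (ℕ.s≤s (ℕ.s≤s ℕ.z≤n)))
  lt : fromℤ z ℚ.< fromℤ z ℚ.+ ½
  lt = subst (ℚ._< fromℤ z ℚ.+ ½) (ℚₚ.+-identityʳ (fromℤ z)) (shift-< (fromℤ z) 0<½)

-- `Phi` admits any cell representation, so the generating set must not depend on it. Moving a point
-- of `X` in coordinate `e` to two values of `I e` stays in `X`, which a point interval `J e` would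
-- not allow.
nonpoint-transfer : ∀ {m} {X : (Fin m → ℚ) → Set} {I J} → IsCellRep X I → IsCellRep X J → ∀ y → X y →
  ∀ e → NonPoint (I e) → NonPoint (J e)
nonpoint-transfer {m} {X} {I} {J} repI repJ y Xy e np = distinct (two-points (I e) np)
  where
  put : ℚ → Fin m → ℚ
  put a f with f Finₚ.≟ e
  ... | yes _ = a
  ... | no _  = y f
  put-at : ∀ a → put a e ≡ a
  put-at a with e Finₚ.≟ e
  ... | yes _ = refl
  ... | no q  = ⊥-elim (q refl)
  put-in : ∀ a → a ∈I I e → ∀ f → put a f ∈I I f
  put-in a h f with f Finₚ.≟ e
  ... | yes refl = h
  ... | no _     = proj₁ (repI y) Xy f
  in-J : ∀ a → a ∈I I e → a ∈I J e
  in-J a h = subst (_∈I J e) (put-at a) (proj₁ (repJ (put a)) (proj₂ (repI (put a)) (put-in a h)) e)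
  distinct : (Σ ℚ λ a → Σ ℚ λ b → a ∈I I e × b ∈I I e × a ≢ b) → NonPoint (J e)
  distinct (a , b , a∈ , b∈ , a≢b) = by (J e) (in-J a a∈) (in-J b b∈)
    where
    by : ∀ K → a ∈I K → b ∈I K → NonPoint K
    by (point z) p q = a≢b (trans p (sym q))
    by (lopen _) _ _ = tt
    by (ropen _) _ _ = tt

-- Half-open cells of trees and the bijection.

module Main {k m : ℕ} (G : Graph (suc (suc k)) m) (conn : Connected G)
  (σ : Subset m → Vector m) (sig : CycleSignature G σ) (σ* : Subset m → Vector m) (sig* : CocycleSignature G σ*) where
  open GraphTheory G
  open Signatures G conn σ sig σ* sig*
  open Trees cycles cuts
  open Duality duality

  private
    oriented : ∀ b {q} → OrientedAs G (sgn b) q → q ≡ βℚ b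
    oriented true  h = proj₁ h refl
    oriented false h = proj₂ h refl

    ∈-or : ∀ {T : Subset m} {e f} → f ∈ T ∪ ⁅ e ⁆ → f ∈ T ⊎ f ≡ e
    ∈-or {T} {e} f∈ with Subsetₚ.x∈p∪q⁻ T ⁅ e ⁆ f∈
    ... | inj₁ p = inj₁ p
    ... | inj₂ p = inj₂ (Subsetₚ.x∈⁅y⁆⇒x≡y e p)

    ∉⇒false : ∀ {T : Subset m} {e} → e ∉ T → lookup T e ≡ false
    ∉⇒false {T} {e} e∉ with lookup T e in eq
    ... | true  = ⊥-elim (e∉ (true⇒∈ eq))
    ... | false = refl

    false⇒∉ : ∀ {T : Subset m} {e} → lookup T e ≡ false → e ∉ T
    false⇒∉ Te e∈ with trans (sym Te) (∈⇒true e∈)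
    ... | ()

    within : ∀ {T : Subset m} {v C e} → SuppEq G v C → (∀ f → lookup T f ≡ false → f ≢ e → v f ≡ 0ℤ) →
        C ⊆ T ∪ ⁅ e ⁆
    within {T} {v} {C} {e} supp off {f} f∈ with lookup T f in eq | f Finₚ.≟ e
    ... | true  | _ = Subsetₚ.x∈p∪q⁺ (inj₁ (true⇒∈ eq))
    ... | false | yes refl = Subsetₚ.x∈p∪q⁺ {p = T} (inj₂ (Subsetₚ.x∈⁅x⁆ e))
    ... | false | no f≢e = ⊥-elim (proj₁ (supp f) f∈ (off f eq f≢e))

    within⁻ : ∀ {T : Subset m} {v C e} → SuppEq G v C → C ⊆ T ∪ ⁅ e ⁆ → ∀ f → lookup T f ≡ false → f ≢ e →
        v f ≡ 0ℤ
    within⁻ {T} {v} {C} {e} supp sub f Tf f≢e with v f ℤ.≟ 0ℤ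
    ... | yes p = p
    ... | no p with ∈-or {T} {e} (sub (proj₂ (supp f) p))
    ...   | inj₁ q = ⊥-elim (false⇒∉ Tf q)
    ...   | inj₂ q = ⊥-elim (f≢e q)

    lookup-∁ : ∀ (T : Subset m) e → lookup (∁ T) e ≡ not (lookup T e)
    lookup-∁ T e = Vecₚ.lookup-map e not T

  module _ {T : Subset m} {P : Fin m → Bool} (t : Tree (lookup T) P) where

    -- Of all the cycles and cocycles that `InHoc` quantifies over, the fundamental one supplies the
    -- condition.
    hoc-sound : ∀ {x} → InHoc G σ σ* T x → ∀ e → Within (x e) × Hoc₁ (lookup T e) (P e) (x e)
    hoc-sound {x} (unit , h) e = unit e , coordinate (lookup T e) refl
      where
      coordinate : ∀ b → lookup T e ≡ b → Hoc₁ b (P e) (x e)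
      coordinate false Te with ori t e Te
      ... | v , (C , c , v≗) , ve , off = oriented (P e)
            (subst (λ s → OrientedAs G s (x e)) (trans (sym (v≗ e)) ve)
              (proj₁ (h e) (false⇒∉ Te) C c (within (proj₂ (proj₁ sig C c))
                  (λ f Tf f≢e → trans (sym (v≗ f)) (off f Tf f≢e)))))
      coordinate true Te with ori* t e (cong not Te)
      ... | v , (C , c , v≗) , ve , off with proj₂ (h e) (true⇒∈ Te) C c
              (within (proj₂ (proj₁ sig* C c)) (λ f Tf f≢e → trans (sym (v≗ f))
                  (off f (trans (sym (lookup-∁ T f)) Tf) f≢e)))
      ...   | inj₁ o = inj₁ (oriented (P e) (subst (λ s → OrientedAs G s (x e)) (trans (sym (v≗ e)) ve) o))
      ...   | inj₂ b = inj₂ b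

    -- Uniqueness of the fundamental direction lets the one condition at `e` answer for every cycle
    -- or cocycle that `InHoc` quantifies over.
    hoc-complete : ∀ {x} → (∀ e → Within (x e) × Hoc₁ (lookup T e) (P e) (x e)) → InHoc G σ σ* T x
    hoc-complete {x} h = (λ e → proj₁ (h e)) , λ e → outside e , inside e
      where
      outside : ∀ e → e ∉ T → ∀ C → IsCycle G C → C ⊆ T ∪ ⁅ e ⁆ → OrientedAs G (σ C e) (x e)
      outside e e∉ C c sub = (λ p → by true p) , (λ p → by false p)
        where
        Te : lookup T e ≡ false
        Te = ∉⇒false e∉
        by : ∀ b → σ C e ≡ sgn b → x e ≡ βℚ b
        by b p = trans (subst (λ s → Hoc₁ s (P e) (x e)) Te (proj₂ (h e)))
          (cong βℚ (fund-unique cycles Te (ind (base t)) (ori t e Te)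
              (σ C , (C , c , λ _ → refl) , p , within⁻ (proj₂ (proj₁ sig C c)) sub)))
      inside : ∀ e → e ∈ T → ∀ C → IsCocycle G C → C ⊆ ∁ T ∪ ⁅ e ⁆ → OrientedAs G (σ* C e) (x e) ⊎
          BiOriented G (x e)
      inside e e∈ C c sub = by (subst (λ s → Hoc₁ s (P e) (x e)) (∈⇒true e∈) (proj₂ (h e)))
        where
        Te : not (lookup T e) ≡ false
        Te = cong not (∈⇒true e∈)
        dir-P : ∀ b → σ* C e ≡ sgn b → P e ≡ b
        dir-P b p = fund-unique cuts Te (ind* (base t)) (ori* t e Te) (σ* C , (C , c , λ _ → refl) , p ,
          λ f Tf → within⁻ (proj₂ (proj₁ sig* C c)) sub f (trans (lookup-∁ T f) Tf))
        by : Hoc₁ true (P e) (x e) → OrientedAs G (σ* C e) (x e) ⊎ BiOriented G (x e)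
        by (inj₁ q) = inj₁ ((λ p → trans q (cong βℚ (dir-P true p))) ,
            (λ p → trans q (cong βℚ (dir-P false p))))
        by (inj₂ q) = inj₂ q

  toCont-β : ∀ O e → toCont G O e ≡ βℚ (O e)
  toCont-β O e with O e
  ... | true  = refl
  ... | false = refl

  last : Fin (suc (suc k))
  last = Fin.fromℕ (suc k)

  pot-im : ∀ {c} → Pot c → InImZDT G c
  pot-im {c} (p , c≗) = (λ v → fromℤ (p v - p last)) , cong fromℤ (ℤₚ.+-inverseʳ (p last)) ,
    λ e → trans (cong fromℤ (trans (c≗ e) (arith (p (head G e)) (p (tail G e)) (p last))))
        (fromℤ-minus (p (head G e) - p last) (p (tail G e) - p last))
    where
    arith : ∀ a b c → a - b ≡ (a - c) - (b - c)
    arith = solve-∀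

  -- The rational potential is zero at the last vertex and changes by integers along edges, so
  -- connectedness makes it integral.
  im-pot : ∀ {c} → InImZDT G c → Pot c
  im-pot {c} (p , p-last , c≗) = (λ v → proj₁ (potential v)) , λ e → fromℤ-injective (trans (c≗ e)
    (trans (cong₂ ℚ._-_ (sym (proj₂ (potential (head G e)))) (sym (proj₂ (potential (tail G e)))))
        (sym (fromℤ-minus (proj₁ (potential (head G e))) (proj₁ (potential (tail G e)))))))
    where
    difference : ∀ x y → x ≡ (x ℚ.- y) ℚ.+ y
    difference x y = sym (trans (ℚₚ.+-assoc x _ y) (trans (cong (x ℚ.+_) (ℚₚ.+-inverseˡ y)) (ℚₚ.+-identityʳ x)))
    integral : ∀ {v} → Reach G (tabulate (λ _ → true)) last v → Σ ℤ λ z → fromℤ z ≡ p v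
    integral here = 0ℤ , sym p-last
    integral (fwd {e} _ r) = let (z , q) = integral r in c e + z ,
      trans (fromℤ-+ (c e) z) (trans (cong₂ ℚ._+_ (c≗ e) q) (sym (difference (p (head G e)) (p (tail G e)))))
    integral (bwd {e} _ r) = let (z , q) = integral r in z - c e ,
      trans (fromℤ-minus z (c e)) (trans (cong₂ ℚ._-_ q (c≗ e)) (cancel (p (head G e)) (p (tail G e))))
      where
      cancel : ∀ x y → x ℚ.- (x ℚ.- y) ≡ y
      cancel x y = ℚGroup.∙-cancelʳ (x ℚ.- y) _ _ (trans (sym (difference x (x ℚ.- y)))
          (trans (difference x y) (ℚₚ.+-comm (x ℚ.- y) y)))
    potential : ∀ v → Σ ℤ λ z → fromℤ z ≡ p v
    potential v = integral (conn last v)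

  record Shift (O : Orientation G) (T : Subset m) (c : Vector m) : Set where
    field
      treeDir : Fin m → Bool
      isTree  : Tree (lookup T) treeDir
      isPot   : Pot (βv treeDir -v βv O)
      shift   : c ≗v (βv treeDir -v βv O)
  open Shift

  good-shift : ∀ {O T c} → GoodPair G σ σ* O T c → Shift O T c
  good-shift {O} {T} {c} (spanning , im , _ , hoc) = record
    { treeDir = P ; isTree = t ; isPot = L-resp cuts shift′ (im-pot im) ; shift = shift′ }
    where
    P : Fin m → Bool
    P = proj₁ (tree-of-base (base-of-tree spanning))
    t : Tree (lookup T) P
    t = proj₂ (tree-of-base (base-of-tree spanning))
    integral : ∀ e → toCont G O e ℚ.+ fromℤ (c e) ≡ fromℤ (β (O e) + c e)
    integral e = trans (cong (ℚ._+ fromℤ (c e)) (trans (toCont-β O e) (sym (fromℤ-β (O e)))))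
        (sym (fromℤ-+ (β (O e)) (c e)))
    arith : ∀ a b → b ≡ (a + b) - a
    arith = solve-∀
    shift′ : ∀ e → c e ≡ β (P e) - β (O e)
    shift′ e = let (w , h) = hoc-sound t hoc e in trans (arith (β (O e)) (c e))
      (cong (_- β (O e)) (hoc-integral (lookup T e) (P e) (β (O e) + c e) (integral e) w h))

  module _ {O T c} (s : Shift O T c) where

    private
      P : Fin m → Bool
      P = treeDir s

    cells : Fin m → HInterval
    cells e = cell (lookup T e) (P e) (O e)

    cells-rep : IsCellRep (ShiftedHoc G σ σ* T c) cells
    cells-rep y = to , from
      where
      coerce : ∀ {Q : ℚ → Set} e → Q (y e ℚ.+ fromℤ (c e)) → Q (y e ℚ.+ fromℤ (β (P e) - β (O e)))
      coerce {Q} e = subst (λ z → Q (y e ℚ.+ fromℤ z)) (shift s e)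
      to : ShiftedHoc G σ σ* T c y → ∀ e → y e ∈I cells e
      to (unit , hoc) e = cell-from-hoc (lookup T e) (P e) (O e) (y e) (unit e)
        (coerce {Hoc₁ (lookup T e) (P e)} e (proj₂ (hoc-sound (isTree s) hoc e)))
      coordinate : ∀ e → y e ∈I cells e → _
      coordinate e h = hoc-from-cell (lookup T e) (P e) (O e) (y e) h
      from : (∀ e → y e ∈I cells e) → ShiftedHoc G σ σ* T c y
      from h = (λ e → proj₁ (coordinate e (h e))) , hoc-complete (isTree s) (λ e →
        subst (λ z → Within (y e ℚ.+ fromℤ z) × Hoc₁ (lookup T e) (P e) (y e ℚ.+ fromℤ z)) (sym (shift s e))
            (proj₂ (coordinate e (h e))))

    shift-good : GoodPair G σ σ* O T c
    shift-good = tree-from-base (base (isTree s)) , pot-im (L-resp cuts (λ e → sym (shift s e)) (isPot s)) ,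
      (λ e → subst Within (sym (toCont-β O e)) (βℚ-within (O e))) ,
      hoc-complete (isTree s) (λ e → subst (λ x → Within x × Hoc₁ (lookup T e) (P e) x) (sym (value e))
        (βℚ-within (P e) , on (lookup T e) (P e)))
      where
      value : ∀ e → toCont G O e ℚ.+ fromℤ (c e) ≡ βℚ (P e)
      value e = trans (cong₂ (λ q z → q ℚ.+ fromℤ z) (toCont-β O e) (shift s e)) (βℚ-shift (P e) (O e))
      on : ∀ b p → Hoc₁ b p (βℚ p)
      on false p = refl
      on true  p = inj₁ refl

    Active : Fin m → Set
    Active e = lookup T e ≡ true × P e ≡ O e

    generating⁺ : ∀ {I F} → IsCellRep (ShiftedHoc G σ σ* T c) I → GeneratingSet I F → ∀ e → Active e → e ∈ F
    generating⁺ {I} rep gen e (Te , Pe) = proj₂ (gen e)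
        (nonpoint-transfer {I = cells} {J = I} cells-rep rep (toCont G O)
      (proj₂ (proj₂ shift-good)) e (cell-nonpoint⁺ (lookup T e) (P e) (O e) Te Pe))

    generating⁻ : ∀ {I F} → IsCellRep (ShiftedHoc G σ σ* T c) I → GeneratingSet I F → ∀ e → e ∈ F → Active e
    generating⁻ {I} rep gen e e∈ = cell-nonpoint⁻ (lookup T e) (P e) (O e)
      (nonpoint-transfer {I = I} {J = cells} rep cells-rep (toCont G O) (proj₂ (proj₂ shift-good)) e
          (proj₁ (gen e) e∈))

  -- Both shifts start from the same `O`, which cancels in their difference and leaves the
  -- difference of the two tree directions as a potential difference.
  shift-unique-tree : ∀ {O T c T′ c′} (s : Shift O T c) (s′ : Shift O T′ c′) → ∀ e → lookup T′ e ≡ lookup T e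
  shift-unique-tree {O} s s′ = tree-difference duality (isTree s′) (isTree s)
    (L-resp cuts (λ e → arith (β (treeDir s′ e)) (β (treeDir s e)) (β (O e)))
        (L-minus cuts (isPot s′) (isPot s)))
    where
    arith : ∀ a b c → (a - c) - (b - c) ≡ a - b
    arith = solve-∀

  shift-unique-dir : ∀ {O T c T′ c′} (s : Shift O T c) (s′ : Shift O T′ c′) → ∀ e → treeDir s′ e ≡ treeDir s e
  shift-unique-dir s s′ = tree-unique (isTree s′) (tree-transport (λ e → sym (shift-unique-tree s s′ e))
      (isTree s))

  shift-unique : ∀ {O T c T′ c′} → Shift O T c → Shift O T′ c′ → T′ ≡ T × c′ ≗v c
  shift-unique {O} {T} {c} {T′} s s′ =
    trans (sym (Vecₚ.tabulate∘lookup T′)) (trans (Vecₚ.tabulate-cong (shift-unique-tree s s′))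
        (Vecₚ.tabulate∘lookup T)) ,
    λ e → trans (shift s′ e) (trans (cong (λ p → β p - β (O e)) (shift-unique-dir s s′ e)) (sym (shift s e)))

  tabulated : ∀ {O T P} → Tree T P → Pot (βv P -v βv O) → Shift O (tabulate T) (βv P -v βv O)
  tabulated {T = T} {P} t l = record
    { treeDir = P ; isTree = tree-transport (λ e → sym (Vecₚ.lookup∘tabulate T e)) t ; isPot = l ; shift =
        λ _ → refl }

  private
    φ : Orientation G → Subset m → Set
    φ = Phi G σ σ*

  -- Frees `Phi` from the chosen intervals: by `nonpoint-transfer` the generating set consists of
  -- the active edges, whatever the representation.
  record Generated (O : Orientation G) (F : Subset m) : Set where
    field
      {T}    : Subset m
      {c}    : Vector m
      shifted : Shift O T c
      sound  : ∀ e → e ∈ F → Active shifted e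
      total  : ∀ e → Active shifted e → e ∈ F
  open Generated

  φ-generated : ∀ {O F} → φ O F → Generated O F
  φ-generated {O} {F} (T , c , good , I , rep , gen) = record
    { shifted = s ; sound = generating⁻ s {I} {F} rep gen ; total = generating⁺ s {I} {F} rep gen }
    where
    s : Shift O T c
    s = good-shift {O} {T} {c} good

  well-defined : ∀ O → Compatible G σ O → Σ (Subset m) (λ T → Σ (Vector m) (λ c → GoodPair G σ σ* O T c
    × (∀ T' c' → GoodPair G σ σ* O T' c' → T' ≡ T × c' ≗v c)
    × IsStandardCell (ShiftedHoc G σ σ* T c)))
  well-defined O compat = conclude (orientation-tree O (compatible-comp O compat))
    where
    conclude : (Σ (Fin m → Bool) λ T → Σ (Fin m → Bool) λ P → Tree T P × Pot (βv P -v βv O)) → _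
    conclude (T , P , t , l) = tabulate T , βv P -v βv O , shift-good s ,
      (λ T′ c′ good → shift-unique s (good-shift {O} {T′} {c′} good)) , cells s , cells-rep s
      where
      s : Shift O (tabulate T) (βv P -v βv O)
      s = tabulated t l

  generated-functional : ∀ {O F F′} → Generated O F → Generated O F′ → F ⊆ F′
  generated-functional g g′ {e} e∈ = let (Te , Pe) = sound g e e∈ in
    total g′ e (trans (shift-unique-tree (shifted g) (shifted g′) e) Te , trans
        (shift-unique-dir (shifted g) (shifted g′) e) Pe)

  generated-forest : ∀ {O F} → Generated O F → SpanningForest G F
  generated-forest g C c C⊆F = indep-forest {T g} (ind (base (isTree (shifted g)))) C c (λ {e} e∈ → true⇒∈ (proj₁ (sound g e (C⊆F e∈))))

  generated-injective : ∀ {O O′ F} → Generated O F → Generated O′ F → ∀ e → O e ≡ O′ e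
  generated-injective g g′ = forest-injective duality (isTree (shifted g)) (isTree (shifted g′))
      (isPot (shifted g)) (isPot (shifted g′))
    (λ e Te Pe → sound g′ e (total g e (Te , Pe))) (λ e Te Pe → sound g e (total g′ e (Te , Pe)))

  φ-surjective : ∀ F → SpanningForest G F → Σ (Orientation G) (λ O → Compatible G σ O × φ O F)
  φ-surjective F forest = conclude (forest-surjective (lookup F) (forest-indep forest))
    where
    conclude : Preimage (lookup F) → Σ (Orientation G) (λ O → Compatible G σ O × φ O F)
    conclude (O , comp , T , P , t , l , F→ , →F) = O , comp-compatible O comp ,
      tabulate T , βv P -v βv O , shift-good s , cells s , cells-rep s , generating
      where
      s : Shift O (tabulate T) (βv P -v βv O)
      s = tabulated t l
      T≡ : ∀ e → lookup (tabulate T) e ≡ T e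
      T≡ = Vecₚ.lookup∘tabulate T
      generating : GeneratingSet (cells s) F
      generating e = (λ e∈ → let (Te , Pe) = F→ e (∈⇒true e∈) in
          cell-nonpoint⁺ (lookup (tabulate T) e) (P e) (O e) (trans (T≡ e) Te) Pe) ,
        (λ np → let (Te , Pe) = cell-nonpoint⁻ (lookup (tabulate T) e) (P e) (O e) np in
          true⇒∈ (→F e (trans (sym (T≡ e)) Te) Pe))

theorem3p30 : ∀ (k m : ℕ) (G : Graph (suc (suc k)) m) → Connected G →
    (σ : Subset m → Vector m) → CycleSignature G σ →
    (σ* : Subset m → Vector m) → CocycleSignature G σ* →
    (∀ O → Compatible G σ O →
    Σ (Subset m) (λ T → Σ (Vector m) (λ c → GoodPair G σ σ* O T c
    × (∀ T' c' → GoodPair G σ σ* O T' c' → T' ≡ T × c' ≗v c)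
    × IsStandardCell (ShiftedHoc G σ σ* T c))))
    × (∀ O F F' → Compatible G σ O → Phi G σ σ* O F → Phi G σ σ* O F' → F ≡ F')
    × (∀ O F → Compatible G σ O → Phi G σ σ* O F → SpanningForest G F)
    × (∀ O O' F → Compatible G σ O → Compatible G σ O' →
    Phi G σ σ* O F → Phi G σ σ* O' F → ∀ e → O e ≡ O' e)
    × (∀ F → SpanningForest G F → Σ (Orientation G) (λ O → Compatible G σ O × Phi G σ σ* O F))
theorem3p30 k m G conn σ sig σ* sig* =
    well-defined
  , (λ O F F′ _ φF φF′ → Subsetₚ.⊆-antisym (generated-functional (generated O F φF) (generated O F′ φF′))
                                           (generated-functional (generated O F′ φF′) (generated O F φF)))
  , (λ O F _ φF → generated-forest (generated O F φF))
  , (λ O O′ F _ _ φO φO′ → generated-injective (generated O F φO) (generated O′ F φO′))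
  , φ-surjective
  where
  open Main G conn σ sig σ* sig*
  generated : ∀ O F → Phi G σ σ* O F → Generated O F
  generated O F = φ-generated {O} {F}
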